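{- Let $\alpha > 1/8$ be fixed. For every sufficiently large prime $p$ and every set $A \subseteq \mathbb{F}_p$ with $|A| \geqslant \alpha p$, one has $A(A+A) \supseteq \mathbb{F}_p^*$, where $A(A+A) = \{x(y+z) : x, y, z \in A\}$.
   Context: $\mathbb{F}_p$ is the field with $p$ elements ($p$ prime) and $\mathbb{F}_p^* = \mathbb{F}_p \setminus \{0\}$. -}

module Defs where

open import Data.Nat using (ℕ; NonZero; _+_; _*_)
open import Data.Nat.DivMod using (_mod_)
open import Data.Fin using (Fin; toℕ)
open import Data.Fin.Subset using (Subset; _∈_)
open import Data.Product using (∃; _×_; _,_)
open import Relation.Binary.PropositionalEquality using (_≡_)

module _ {p : ℕ} .{{_ : NonZero p}} where

  _+ₚ_ : Fin p → Fin p → Fin p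
  x +ₚ y = (toℕ x + toℕ y) mod p

  _*ₚ_ : Fin p → Fin p → Fin p
  x *ₚ y = (toℕ x * toℕ y) mod p

  infixl 6 _+ₚ_
  infixl 7 _*ₚ_

  _∈A[A+A]_ : Fin p → Subset p → Set
  t ∈A[A+A] A = ∃ λ x → ∃ λ y → ∃ λ z →
    x ∈ A × y ∈ A × z ∈ A × x *ₚ (y +ₚ z) ≡ t

{-# OPTIONS --safe #-}
module Submission where

-- Suppose t ∉ A(A+A) and let f be the indicator of A, of density a.  Let r(z) be the proportion of y ∈ A with
-- z - y ∈ A, and v = (1-r)ᵏ.  Then v is 1 on t/A, because t/A misses A+A, while the average of v(x+y) over
-- x, y ∈ A is small, because r(1-r)ᵏ is.  Now replace one copy of A after the other by a majorant of the same
-- kind: w₁ = (1-u₁)ˡ, where u₁(x) is the average of v(x+y) over y ∈ A, then w₂ = (1-u₂)ᵐ, where w₁ takes the place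
-- of A.  Both are almost 1 on most of A, and the average of w₁(x)w₂(y)v(x+y) is still small, so that Pollard's
-- theorem gives 𝔼w₁ + 𝔼w₂ + 𝔼v ≤ 1 + o(1), unless 𝔼v = o(1).
-- On the other hand v, w₁, w₂ are bounded multiples of averages of convolutions, and two convolutions are
-- asymptotically independent along the hyperbola xy = t: two applications of the second moment method reduce this
-- to counting pairs of chords of widths d and d′ and equal heights, starting at abscissas x and u = mx; for every
-- slope m the equation for x is linear.  Hence a ≤ 𝔼_x wᵢ(x)v(t/x) + o(1) ≤ 𝔼wᵢ 𝔼v + o(1), and adding both
-- inequalities, 2a ≤ (1 - 𝔼v)𝔼v + o(1) ≤ 1/4 + o(1).

open import Algebra.Bundles using (CommutativeRing)
open import Algebra.Structures using (IsCommutativeRing)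
import Algebra.Properties.Group
import Algebra.Properties.Ring
import Algebra.Properties.Semiring.Exp
import Algebra.Properties.Semiring.Mult
import Algebra.Properties.Semiring.Mult.TCOptimised
import Algebra.Properties.Semiring.Sum
import Algebra.Solver.Ring
open import Algebra.Solver.Ring.AlmostCommutativeRing using (fromCommutativeRing; _-Raw-AlmostCommutative⟶_)
open import Data.Bool using (Bool; true; false; _∧_; _∨_; not; if_then_else_)
open import Data.Bool.Properties using (∧-comm)
open import Data.Empty using (⊥)
open import Data.Fin using (Fin; zero; suc; _≟_)
open import Data.Fin.Permutation using (permutation)
open import Data.Fin.Properties using (suc-injective)
open import Data.Integer as ℤ using (ℤ)
import Data.Integer.Properties as ℤ
open import Data.Maybe using (Maybe; just; nothing)
open import Data.Nat as ℕ using (ℕ; zero; suc; z≤n; s≤s)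
import Data.Nat.DivMod as ℕ
import Data.Nat.Properties as ℕ
open import Data.Product using (∃; _×_; _,_; proj₁; proj₂)
open import Data.Sum using (_⊎_; inj₁; inj₂)
open import Relation.Binary.PropositionalEquality using (_≡_; _≢_; refl; sym; trans; cong; cong₂; subst; subst₂; isEquivalence)
import Relation.Binary.Reasoning.Setoid
open import Relation.Nullary using (¬_; Dec; yes; no; contradiction)
open import Relation.Nullary.Decidable using (¬?; _×-dec_; decidable-stable)

-- Arbitrary sets can be fully correlated along the hyperbola, as B and t/B are. Hence A itself
-- cannot enter the second moment argument, and whatever enters it has to be built from
-- convolutions; the majorants v, w₁, w₂ exist for this reason. A product of two convolutions is an
-- average of convolutions, so independence passes from convolutions to their powers, and the error
-- is only multiplied by constants to the powers k, l, m, which do not depend on p. The copies of A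
-- are replaced one at a time because the bound for u(1-u)ˡ controls an average over a single
-- variable: w₂ can be built only after w₁ has taken its place. Each replacement loses a part of A,
-- which is at most η if the preceding exponent is larger by a factor of order 1/η. This fixes the
-- order of choice: η, then m, l, k, then the correlation error ν, then p. Neither characters nor
-- square roots occur, only averages of squares with a free weight, so that the rational numbers
-- suffice as scalars.

module IntegerCoefficients {c ℓ} (R : CommutativeRing c ℓ) where
  open import Data.Integer using (+_; -[1+_])
  private module R = CommutativeRing R
  open R using (_≈_; 0#; 1#)
  open Algebra.Properties.Ring R.ring
  open Algebra.Properties.Semiring.Mult.TCOptimised R.semiring using (×-homo-+; ×1-homo-*; 1+×) renaming (_×_ to _×′_)
  open Relation.Binary.Reasoning.Setoid R.setoid

  ⟦_⟧ℤ : ℤ → R.Carrier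
  ⟦ + n ⟧ℤ      = n ×′ 1#
  ⟦ -[1+ n ] ⟧ℤ = R.- (suc n ×′ 1#)

  neg-homo : ∀ i → ⟦ ℤ.- i ⟧ℤ ≈ R.- ⟦ i ⟧ℤ
  neg-homo (+ zero)  = R.sym -0#≈0#
  neg-homo (+ suc n) = R.refl
  neg-homo -[1+ n ]  = R.sym (-‿involutive _)

  ⊖-homo : ∀ m n → ⟦ m ℤ.⊖ n ⟧ℤ ≈ m ×′ 1# R.- n ×′ 1#
  ⊖-homo m zero = begin
    ⟦ m ℤ.⊖ 0 ⟧ℤ       ≡⟨ cong ⟦_⟧ℤ (ℤ.⊖-≥ {m} {0} ℕ.z≤n) ⟩
    m ×′ 1#             ≈⟨ R.+-identityʳ _ ⟨
    m ×′ 1# R.+ 0#      ≈⟨ R.+-congˡ -0#≈0# ⟨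
    m ×′ 1# R.- 0#      ∎
  ⊖-homo zero    (suc n) = R.sym (R.+-identityˡ _)
  ⊖-homo (suc m) (suc n) = begin
    ⟦ suc m ℤ.⊖ suc n ⟧ℤ                                ≡⟨ cong ⟦_⟧ℤ (ℤ.[1+m]⊖[1+n]≡m⊖n m n) ⟩
    ⟦ m ℤ.⊖ n ⟧ℤ                                        ≈⟨ ⊖-homo m n ⟩
    x R.- y                                              ≈⟨ R.+-congʳ (R.+-identityʳ _) ⟨
    x R.+ 0# R.- y                                       ≈⟨ R.+-congʳ (R.+-congˡ (R.-‿inverseʳ 1#)) ⟨
    x R.+ (1# R.- 1#) R.- y                              ≈⟨ R.+-congʳ (R.+-assoc _ _ _) ⟨
    x R.+ 1# R.- 1# R.- y                                ≈⟨ R.+-assoc _ _ _ ⟩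
    x R.+ 1# R.+ (R.- 1# R.- y)                          ≈⟨ R.+-cong (R.+-comm _ _) (-‿+-comm _ _) ⟩
    1# R.+ x R.- (1# R.+ y)                              ≈⟨ R.+-cong (1+× m 1#) (R.-‿cong (1+× n 1#)) ⟨
    suc m ×′ 1# R.- suc n ×′ 1#                          ∎
    where
    x = m ×′ 1#
    y = n ×′ 1#

  +-homo : ∀ i j → ⟦ i ℤ.+ j ⟧ℤ ≈ ⟦ i ⟧ℤ R.+ ⟦ j ⟧ℤ
  +-homo (+ m)    (+ n)    = ×-homo-+ 1# m n
  +-homo (+ m)    -[1+ n ] = ⊖-homo m (suc n)
  +-homo -[1+ m ] (+ n)    = R.trans (⊖-homo n (suc m)) (R.+-comm _ _)
  +-homo -[1+ m ] -[1+ n ] = begin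
    R.- (suc (suc (m ℕ.+ n)) ×′ 1#)           ≡⟨ cong (λ k → R.- (k ×′ 1#)) (cong suc (ℕ.+-suc m n)) ⟨
    R.- ((suc m ℕ.+ suc n) ×′ 1#)             ≈⟨ R.-‿cong (×-homo-+ 1# (suc m) (suc n)) ⟩
    R.- (suc m ×′ 1# R.+ suc n ×′ 1#)          ≈⟨ -‿+-comm _ _ ⟨
    R.- (suc m ×′ 1#) R.- suc n ×′ 1#          ∎

  +*-homo : ∀ m j → ⟦ + m ℤ.* j ⟧ℤ ≈ ⟦ + m ⟧ℤ R.* ⟦ j ⟧ℤ
  +*-homo m (+ n) = begin
    ⟦ + m ℤ.* + n ⟧ℤ     ≡⟨ cong ⟦_⟧ℤ (ℤ.pos-* m n) ⟨
    (m ℕ.* n) ×′ 1#      ≈⟨ ×1-homo-* m n ⟩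
    m ×′ 1# R.* n ×′ 1#  ∎
  +*-homo m -[1+ n ] = begin
    ⟦ + m ℤ.* -[1+ n ] ⟧ℤ            ≡⟨ cong ⟦_⟧ℤ (ℤ.neg-distribʳ-* (+ m) (+ suc n)) ⟨
    ⟦ ℤ.- (+ m ℤ.* + suc n) ⟧ℤ       ≈⟨ neg-homo (+ m ℤ.* + suc n) ⟩
    R.- ⟦ + m ℤ.* + suc n ⟧ℤ         ≈⟨ R.-‿cong (+*-homo m (+ suc n)) ⟩
    R.- (m ×′ 1# R.* suc n ×′ 1#)    ≈⟨ -‿distribʳ-* _ _ ⟩
    m ×′ 1# R.* R.- (suc n ×′ 1#)    ∎

  *-homo : ∀ i j → ⟦ i ℤ.* j ⟧ℤ ≈ ⟦ i ⟧ℤ R.* ⟦ j ⟧ℤ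
  *-homo (+ m)    j = +*-homo m j
  *-homo -[1+ m ] j = begin
    ⟦ -[1+ m ] ℤ.* j ⟧ℤ           ≡⟨ cong ⟦_⟧ℤ (ℤ.neg-distribˡ-* (+ suc m) j) ⟨
    ⟦ ℤ.- (+ suc m ℤ.* j) ⟧ℤ      ≈⟨ neg-homo (+ suc m ℤ.* j) ⟩
    R.- ⟦ + suc m ℤ.* j ⟧ℤ        ≈⟨ R.-‿cong (+*-homo (suc m) j) ⟩
    R.- (suc m ×′ 1# R.* ⟦ j ⟧ℤ)  ≈⟨ -‿distribˡ-* _ _ ⟩
    R.- (suc m ×′ 1#) R.* ⟦ j ⟧ℤ  ∎

  homomorphism : CommutativeRing.rawRing ℤ.+-*-commutativeRing -Raw-AlmostCommutative⟶ fromCommutativeRing R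
  homomorphism = record
    { ⟦_⟧    = ⟦_⟧ℤ
    ; +-homo = +-homo
    ; *-homo = *-homo
    ; -‿homo = neg-homo
    ; 0-homo = R.refl
    ; 1-homo = R.refl
    }

  -- Equality is recognised in ℤ only: distinct integers may have the same image, as in
  -- characteristic p, and `nothing` leaves this open.
  ≟-coefficient : ∀ i j → Maybe (⟦ i ⟧ℤ ≈ ⟦ j ⟧ℤ)
  ≟-coefficient i j with i ℤ.≟ j
  ... | yes i≡j = just (R.reflexive (cong ⟦_⟧ℤ i≡j))
  ... | no  _   = nothing

  open Algebra.Solver.Ring _ _ homomorphism ≟-coefficient public
    using (solve; con; _:=_; _:+_; _:*_; _:-_; :-_)

  :0 :1 : ∀ {n} → Algebra.Solver.Ring.Polynomial _ _ homomorphism ≟-coefficient n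
  :0 = con (+ 0)
  :1 = con (+ 1)

-- Ordered fields

record OrderedField : Set₁ where
  infixl 7 _*_
  infixl 6 _+_
  infix  8 -_
  infix  4 _≤_
  field
    Carrier           : Set
    _+_ _*_           : Carrier → Carrier → Carrier
    -_                : Carrier → Carrier
    0# 1#             : Carrier
    isCommutativeRing : IsCommutativeRing _≡_ _+_ _*_ -_ 0# 1#
    _≤_               : Carrier → Carrier → Set
    ≤-refl            : ∀ {x} → x ≤ x
    ≤-trans           : ∀ {x y z} → x ≤ y → y ≤ z → x ≤ z
    ≤-total           : ∀ x y → x ≤ y ⊎ y ≤ x
    +-mono-≤          : ∀ {x y u v} → x ≤ y → u ≤ v → x + u ≤ y + v
    *-nonneg          : ∀ {x y} → 0# ≤ x → 0# ≤ y → 0# ≤ x * y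
    1≰0               : ¬ 1# ≤ 0#
    -- `¬ x ≤ 0#` stands for 0 < x, so that the whole order structure is expressed by `_≤_`.
    recip             : ∀ x → ¬ x ≤ 0# → ∃ λ y → 0# ≤ y × x * y ≡ 1#

  commutativeRing : CommutativeRing _ _
  commutativeRing = record { isCommutativeRing = isCommutativeRing }

  open CommutativeRing commutativeRing public
    hiding (Carrier; _+_; _*_; -_; 0#; 1#; isCommutativeRing; refl; sym; trans; _≈_; zero)

module OrderedFieldProperties (K : OrderedField) where
  open OrderedField K
  open IntegerCoefficients commutativeRing
  open Algebra.Properties.Semiring.Exp semiring public using (_^_)
  open Algebra.Properties.Semiring.Mult.TCOptimised semiring using (×-homo-+; ×1-homo-*; 1+×) renaming (_×_ to _×′_)

  ≤-reflexive : ∀ {x y} → x ≡ y → x ≤ y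
  ≤-reflexive refl = ≤-refl

  infixr 2 _≤⟨_⟩_ _≡⟨_⟩≤_
  infix  3 _□

  _≤⟨_⟩_ : ∀ x {y z} → x ≤ y → y ≤ z → x ≤ z
  _ ≤⟨ p ⟩ q = ≤-trans p q

  _≡⟨_⟩≤_ : ∀ x {y z} → x ≡ y → y ≤ z → x ≤ z
  _ ≡⟨ refl ⟩≤ q = q

  _□ : ∀ x → x ≤ x
  _ □ = ≤-refl

  ≤-by : ∀ {x y} e → 0# ≤ e → y ≡ x + e → x ≤ y
  ≤-by {x} e 0≤e refl = subst (_≤ x + e) (+-identityʳ x) (+-mono-≤ ≤-refl 0≤e)

  x≤y⇒0≤y-x : ∀ {x y} → x ≤ y → 0# ≤ y - x
  x≤y⇒0≤y-x {x} {y} x≤y = subst (_≤ y - x) (-‿inverseʳ x) (+-mono-≤ x≤y ≤-refl)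

  0≤y-x⇒x≤y : ∀ {x y} → 0# ≤ y - x → x ≤ y
  0≤y-x⇒x≤y {x} {y} p = ≤-by (y - x) p (solve 2 (λ x y → y := x :+ (y :- x)) refl x y)

  +-nonneg : ∀ {x y} → 0# ≤ x → 0# ≤ y → 0# ≤ x + y
  +-nonneg {x} {y} p q = subst (_≤ x + y) (+-identityʳ 0#) (+-mono-≤ p q)

  *-monoˡ-≤ : ∀ {x y} c → 0# ≤ c → x ≤ y → c * x ≤ c * y
  *-monoˡ-≤ {x} {y} c 0≤c x≤y = ≤-by (c * (y - x)) (*-nonneg 0≤c (x≤y⇒0≤y-x x≤y))
    (solve 3 (λ c x y → c :* y := c :* x :+ c :* (y :- x)) refl c x y)

  *-mono-≤ : ∀ {x y u v} → 0# ≤ x → 0# ≤ v → x ≤ y → u ≤ v → x * u ≤ y * v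
  *-mono-≤ {x} {y} {u} {v} 0≤x 0≤v x≤y u≤v = ≤-by (x * (v - u) + (y - x) * v)
    (+-nonneg (*-nonneg 0≤x (x≤y⇒0≤y-x u≤v)) (*-nonneg (x≤y⇒0≤y-x x≤y) 0≤v))
    (solve 4 (λ x y u v → y :* v := x :* u :+ (x :* (v :- u) :+ (y :- x) :* v)) refl x y u v)

  ∸-cancelʳ-≤ : ∀ {x y} z → x - z ≤ y - z → x ≤ y
  ∸-cancelʳ-≤ {x} {y} z p = ≤-by (y - z - (x - z)) (x≤y⇒0≤y-x p) (solve 3 (λ x y z → y := x :+ (y :- z :- (x :- z))) refl x y z)

  neg-mono-≤ : ∀ {x y} → x ≤ y → - y ≤ - x
  neg-mono-≤ {x} {y} p = ≤-by (y - x) (x≤y⇒0≤y-x p) (solve 2 (λ x y → :- x := :- y :+ (y :- x)) refl x y)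

  square-nonneg : ∀ x → 0# ≤ x * x
  square-nonneg x with ≤-total 0# x
  ... | inj₁ p = *-nonneg p p
  ... | inj₂ p = subst (0# ≤_) (solve 1 (λ x → (:0 :- x) :* (:0 :- x) := x :* x) refl x) (*-nonneg q q)
    where q = x≤y⇒0≤y-x p

  0≤1 : 0# ≤ 1#
  0≤1 = subst (0# ≤_) (*-identityʳ 1#) (square-nonneg 1#)

  -- With this form of multiple, `fromℕ 4` unfolds to `1# + 1# + 1# + 1#`; numerals and written-out
  -- sums are exchanged freely below.
  fromℕ : ℕ → Carrier
  fromℕ n = n ×′ 1#

  fromℕ-suc : ∀ n → fromℕ (suc n) ≡ 1# + fromℕ n
  fromℕ-suc n = 1+× n 1#

  fromℕ-+ : ∀ m n → fromℕ (m ℕ.+ n) ≡ fromℕ m + fromℕ n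
  fromℕ-+ = ×-homo-+ 1#

  fromℕ-* : ∀ m n → fromℕ (m ℕ.* n) ≡ fromℕ m * fromℕ n
  fromℕ-* = ×1-homo-*

  fromℕ-nonneg : ∀ n → 0# ≤ fromℕ n
  fromℕ-nonneg zero    = ≤-refl
  fromℕ-nonneg (suc n) = subst (0# ≤_) (sym (fromℕ-suc n)) (+-nonneg 0≤1 (fromℕ-nonneg n))

  fromℕ-mono : ∀ {m n} → m ℕ.≤ n → fromℕ m ≤ fromℕ n
  fromℕ-mono {m} m≤n with ℕ.m≤n⇒∃[o]m+o≡n m≤n
  ... | o , refl = ≤-by (fromℕ o) (fromℕ-nonneg o) (fromℕ-+ m o)

  -- Positivity of x, carried as a nonnegative inverse.
  record Positive (x : Carrier) : Set where
    constructor positive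
    field
      inverse     : Carrier
      0≤inverse   : 0# ≤ inverse
      *-inverse   : x * inverse ≡ 1#

  open Positive public

  *-cancelˡ-≤ : ∀ {x y z} → Positive z → z * x ≤ z * y → x ≤ y
  *-cancelˡ-≤ {x} {y} {z} (positive i 0≤i zi≡1) p = subst₂ _≤_ (lemma x) (lemma y) (*-monoˡ-≤ i 0≤i p)
    where
    lemma : ∀ x → i * (z * x) ≡ x
    lemma x = trans (solve 3 (λ i z x → i :* (z :* x) := (z :* i) :* x) refl i z x)
             (trans (cong (_* x) zi≡1) (*-identityˡ x))

  positive-≤ : ∀ {x y} → Positive x → x ≤ y → Positive y
  positive-≤ {x} {y} px x≤y = let (i , 0≤i , e) = recip y y≰0 in positive i 0≤i e
    where
    y≰0 : ¬ y ≤ 0#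
    y≰0 y≤0 = 1≰0 (*-cancelˡ-≤ px (subst₂ _≤_ (sym (*-identityʳ x)) (sym (zeroʳ x)) (≤-trans x≤y y≤0)))

  positive-1 : Positive 1#
  positive-1 = positive 1# 0≤1 (*-identityʳ 1#)

  positive-suc : ∀ n → Positive (fromℕ (suc n))
  positive-suc n = positive-≤ positive-1 (≤-by (fromℕ n) (fromℕ-nonneg n) (fromℕ-suc n))

  positive-* : ∀ {x y} → Positive x → Positive y → Positive (x * y)
  positive-* {x} {y} (positive i 0≤i xi≡1) (positive j 0≤j yj≡1) = positive (i * j) (*-nonneg 0≤i 0≤j)
    (trans (solve 4 (λ x y i j → x :* y :* (i :* j) := (x :* i) :* (y :* j)) refl x y i j)
    (trans (cong₂ _*_ xi≡1 yj≡1) (*-identityʳ 1#)))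

  UnitInterval : Carrier → Set
  UnitInterval x = 0# ≤ x × x ≤ 1#

  unit-* : ∀ {x y} → UnitInterval x → UnitInterval y → UnitInterval (x * y)
  unit-* (0≤x , x≤1) (0≤y , y≤1) = *-nonneg 0≤x 0≤y ,
    subst (_ ≤_) (*-identityʳ 1#) (*-mono-≤ 0≤x 0≤1 x≤1 y≤1)

  unit-1- : ∀ {x} → UnitInterval x → UnitInterval (1# - x)
  unit-1- {x} (0≤x , x≤1) = x≤y⇒0≤y-x x≤1 , ≤-by x 0≤x (solve 1 (λ x → :1 := (:1 :- x) :+ x) refl x)

  unit-0 : UnitInterval 0#
  unit-0 = ≤-refl , 0≤1

  unit-1 : UnitInterval 1#
  unit-1 = 0≤1 , ≤-refl

  unit-^ : ∀ {x} k → UnitInterval x → UnitInterval (x ^ k)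
  unit-^ zero    ux = unit-1
  unit-^ (suc k) ux = unit-* ux (unit-^ k ux)

  bernoulli : ∀ {x} k → UnitInterval x → 1# - fromℕ k * x ≤ (1# - x) ^ k
  bernoulli {x} zero    ux = ≤-reflexive (solve 1 (λ x → :1 :- :0 :* x := :1) refl x)
  bernoulli {x} (suc k) ux@(0≤x , x≤1) =
    1# - fromℕ (suc k) * x        ≤⟨ ≤-by (fromℕ k * (x * x)) (*-nonneg (fromℕ-nonneg k) (square-nonneg x))
                                    (trans (solve 2 (λ n x → (:1 :- x) :* (:1 :- n :* x) := :1 :- (:1 :+ n) :* x :+ n :* (x :* x)) refl
                                        (fromℕ k) x)
                                      (cong (λ n → 1# - n * x + fromℕ k * (x * x)) (sym (fromℕ-suc k)))) ⟩
    (1# - x) * (1# - fromℕ k * x) ≤⟨ *-monoˡ-≤ (1# - x) (x≤y⇒0≤y-x x≤1) (bernoulli k ux) ⟩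
    (1# - x) * (1# - x) ^ k       □

  -- Induction through (k + 2) x(1-x)ᵏ⁺¹ = (1-x)·(k + 1) x(1-x)ᵏ + x(1-x)ᵏ⁺¹ ≤ (1-x) + x.
  x[1-x]^k-bound : ∀ {x} k → UnitInterval x → fromℕ (suc k) * (x * (1# - x) ^ k) ≤ 1#
  x[1-x]^k-bound {x} zero (_ , x≤1) = subst (_≤ 1#) (solve 1 (λ x → x := :1 :* (x :* :1)) refl x) x≤1
  x[1-x]^k-bound {x} (suc k) ux@(0≤x , x≤1) =
    fromℕ (suc (suc k)) * (x * ((1# - x) * y))
      ≡⟨ trans (cong (_* (x * ((1# - x) * y))) (fromℕ-suc (suc k)))
          (solve 3 (λ n x y → (:1 :+ n) :* (x :* ((:1 :- x) :* y)) := (:1 :- x) :* (n :* (x :* y)) :+ x :* ((:1 :- x) :* y)) refl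
            (fromℕ (suc k)) x y) ⟩≤
    (1# - x) * (fromℕ (suc k) * (x * y)) + x * ((1# - x) * y)
      ≤⟨ +-mono-≤ (*-monoˡ-≤ (1# - x) (proj₁ (unit-1- ux)) (x[1-x]^k-bound k ux)) (*-monoˡ-≤ x 0≤x (proj₂ (unit-^ (suc k) (unit-1- ux)))) ⟩
    (1# - x) * 1# + x * 1#
      ≡⟨ solve 1 (λ x → (:1 :- x) :* :1 :+ x :* :1 := :1) refl x ⟩≤
    1# □
    where y = (1# - x) ^ k

-- Finite sums and normalised averages

module FiniteSums (K : OrderedField) where
  open OrderedField K
  open OrderedFieldProperties K
  open IntegerCoefficients commutativeRing
  open Algebra.Properties.Semiring.Sum semiring

  sum-const : ∀ m c → sum {m} (λ _ → c) ≡ fromℕ m * c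
  sum-const zero    c = sym (zeroˡ c)
  sum-const (suc m) c = trans (cong (c +_) (sum-const m c))
    (trans (solve 2 (λ x c → c :+ x :* c := (:1 :+ x) :* c) refl (fromℕ m) c) (cong (_* c) (sym (fromℕ-suc m))))

  sum-mono : ∀ {m} {f g : Fin m → Carrier} → (∀ x → f x ≤ g x) → sum f ≤ sum g
  sum-mono {zero}  f≤g = ≤-refl
  sum-mono {suc m} f≤g = +-mono-≤ (f≤g zero) (sum-mono (λ x → f≤g (suc x)))

  ι : ∀ {a} {A : Set a} → Dec A → Carrier
  ι (yes _) = 1#
  ι (no  _) = 0#

  ι-unit : ∀ {a} {A : Set a} (d : Dec A) → UnitInterval (ι d)
  ι-unit (yes _) = unit-1
  ι-unit (no  _) = unit-0

  ι-cong : ∀ {a b} {A : Set a} {B : Set b} (d : Dec A) (e : Dec B) → (A → B) → (B → A) → ι d ≡ ι e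
  ι-cong (yes a) (yes b) f g = refl
  ι-cong (yes a) (no ¬b) f g = contradiction (f a) ¬b
  ι-cong (no ¬a) (yes b) f g = contradiction (g b) ¬a
  ι-cong (no ¬a) (no ¬b) f g = refl

  sum-ι-none : ∀ {m a} {A : Fin m → Set a} (d : ∀ x → Dec (A x)) → (∀ x → ¬ A x) → sum (λ x → ι (d x)) ≡ 0#
  sum-ι-none {zero}  d ¬A = refl
  sum-ι-none {suc m} d ¬A with d zero
  ... | yes a = contradiction a (¬A zero)
  ... | no  _ = trans (+-identityˡ _) (sum-ι-none (λ x → d (suc x)) (λ x → ¬A (suc x)))

  sum-ι-atMostOne : ∀ {m a} {A : Fin m → Set a} (d : ∀ x → Dec (A x)) → (∀ x y → A x → A y → x ≡ y) → sum (λ x → ι (d x)) ≤ 1#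
  sum-ι-atMostOne {zero}  d unique = 0≤1
  sum-ι-atMostOne {suc m} d unique with d zero
  ... | yes a = ≤-reflexive (trans (cong (1# +_) (sum-ι-none (λ x → d (suc x)) (λ x b → contradiction (unique zero (suc x) a b) λ ())))
      (+-identityʳ 1#))
  ... | no  _ = subst (_≤ 1#) (sym (+-identityˡ _)) (sum-ι-atMostOne (λ x → d (suc x)) (λ x y a b
      → suc-injective (unique (suc x) (suc y) a b)))

  sum-zero : ∀ m → sum {m} (λ _ → 0#) ≡ 0#
  sum-zero m = trans (sum-const m 0#) (zeroʳ _)

  sum-ι-≟ : ∀ {m} (z : Fin m) (f : Fin m → Carrier) → sum (λ x → ι (x ≟ z) * f x) ≡ f z
  sum-ι-≟ {suc m} zero f = trans (cong₂ _+_ (*-identityˡ (f zero)) (trans (sum-cong-≗ (λ x → zeroˡ (f (suc x)))) (sum-zero m)))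
      (+-identityʳ _)
  sum-ι-≟ {suc m} (suc z) f = trans (cong₂ _+_ (zeroˡ (f zero))
      (trans (sum-cong-≗ (λ x → cong (_* f (suc x)) (ι-cong (suc x ≟ suc z) (x ≟ z) suc-injective (cong suc))))
          (sum-ι-≟ z (λ x → f (suc x)))))
      (+-identityˡ _)

module Averages (K : OrderedField) (p : ℕ) (positive-p : OrderedFieldProperties.Positive K (OrderedFieldProperties.fromℕ K p)) where
  open OrderedField K
  open OrderedFieldProperties K
  open IntegerCoefficients commutativeRing
  open Algebra.Properties.Semiring.Sum semiring
  open FiniteSums K public

  G : Set
  G = Fin p

  P : Carrier
  P = fromℕ p

  -- The mass 1/p of one point: each exceptional point, such as 𝟘, costs an error of this size.
  q : Carrier
  q = Positive.inverse positive-p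

  0≤P : 0# ≤ P
  0≤P = fromℕ-nonneg p

  0≤q : 0# ≤ q
  0≤q = Positive.0≤inverse positive-p

  P*q≡1 : P * q ≡ 1#
  P*q≡1 = Positive.*-inverse positive-p

  -- Normalised so that 𝔼 δ(·,z) = 1.
  δ : G → G → Carrier
  δ x y = P * ι (x ≟ y)

  δ-sym : ∀ x y → δ x y ≡ δ y x
  δ-sym x y = cong (P *_) (ι-cong (x ≟ y) (y ≟ x) sym sym)

  δ-nonneg : ∀ x y → 0# ≤ δ x y
  δ-nonneg x y = *-nonneg (fromℕ-nonneg p) (proj₁ (ι-unit (x ≟ y)))

  opaque
    𝔼 : (G → Carrier) → Carrier
    𝔼 f = q * sum f

    P*𝔼 : ∀ (f : G → Carrier) → P * 𝔼 f ≡ sum f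
    P*𝔼 f = trans (sym (*-assoc P q (sum f))) (trans (cong (_* sum f) P*q≡1) (*-identityˡ _))

    𝔼-cong : ∀ {f g : G → Carrier} → (∀ x → f x ≡ g x) → 𝔼 f ≡ 𝔼 g
    𝔼-cong f≗g = cong (q *_) (sum-cong-≗ f≗g)

    𝔼-+ : ∀ (f g : G → Carrier) → 𝔼 (λ x → f x + g x) ≡ 𝔼 f + 𝔼 g
    𝔼-+ f g = trans (cong (q *_) (∑-distrib-+ f g)) (distribˡ q _ _)

    𝔼-* : ∀ c (f : G → Carrier) → 𝔼 (λ x → c * f x) ≡ c * 𝔼 f
    𝔼-* c f = trans (cong (q *_) (sym (*-distribˡ-sum c f)))
      (solve 3 (λ q c s → q :* (c :* s) := c :* (q :* s)) refl q c (sum f))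

    𝔼-const : ∀ c → 𝔼 (λ _ → c) ≡ c
    𝔼-const c = trans (cong (q *_) (sum-const p c))
      (trans (solve 3 (λ q P c → q :* (P :* c) := (P :* q) :* c) refl q P c) (trans (cong (_* c) P*q≡1) (*-identityˡ c)))

    𝔼-mono : ∀ {f g : G → Carrier} → (∀ x → f x ≤ g x) → 𝔼 f ≤ 𝔼 g
    𝔼-mono f≤g = *-monoˡ-≤ q 0≤q (sum-mono f≤g)

    𝔼-comm : ∀ (f : G → G → Carrier) → 𝔼 (λ x → 𝔼 (f x)) ≡ 𝔼 (λ y → 𝔼 (λ x → f x y))
    𝔼-comm f = cong (q *_)
      (trans (sym (*-distribˡ-sum q (λ x → sum (f x))))
      (trans (cong (q *_) (∑-comm f)) (*-distribˡ-sum q (λ y → sum (λ x → f x y)))))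

    𝔼-permute : ∀ (f : G → Carrier) (σ τ : G → G) → (∀ x → σ (τ x) ≡ x) → (∀ x → τ (σ x) ≡ x) → 𝔼 (λ x → f (σ x)) ≡ 𝔼 f
    𝔼-permute f σ τ στ τσ = cong (q *_) (sym (sum-permute f (permutation σ τ στ τσ)))

    𝔼-δ : ∀ (z : G) (f : G → Carrier) → 𝔼 (λ x → δ x z * f x) ≡ f z
    𝔼-δ z f = trans (cong (q *_) (trans (sum-cong-≗ (λ x → *-assoc P (ι (x ≟ z)) (f x))) (sym (*-distribˡ-sum P (λ x → ι (x ≟ z) * f x)))))
      (trans (sym (*-assoc q P _)) (trans (cong₂ _*_ (trans (*-comm q P) P*q≡1) (sum-ι-≟ z f)) (*-identityˡ _)))

    𝔼-ι-≟ : ∀ (z : G) → 𝔼 (λ x → ι (x ≟ z)) ≡ q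
    𝔼-ι-≟ z = trans (cong (q *_) (trans (sum-cong-≗ (λ x → sym (*-identityʳ (ι (x ≟ z))))) (sum-ι-≟ z (λ _ → 1#)))) (*-identityʳ q)

  𝔼-*ʳ : ∀ c (f : G → Carrier) → 𝔼 (λ x → f x * c) ≡ 𝔼 f * c
  𝔼-*ʳ c f = trans (𝔼-cong (λ x → *-comm (f x) c)) (trans (𝔼-* c f) (*-comm c _))

  𝔼-neg : ∀ (f : G → Carrier) → 𝔼 (λ x → - f x) ≡ - 𝔼 f
  𝔼-neg f = trans (𝔼-cong (λ x → solve 1 (λ y → :- y := (:- :1) :* y) refl (f x)))
    (trans (𝔼-* (- 1#) f) (solve 1 (λ y → (:- :1) :* y := :- y) refl (𝔼 f)))

  𝔼-- : ∀ (f g : G → Carrier) → 𝔼 (λ x → f x - g x) ≡ 𝔼 f - 𝔼 g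
  𝔼-- f g = trans (𝔼-+ f (λ x → - g x)) (cong (𝔼 f +_) (𝔼-neg g))

  𝔼-nonneg : ∀ {f : G → Carrier} → (∀ x → 0# ≤ f x) → 0# ≤ 𝔼 f
  𝔼-nonneg {f} 0≤f = subst (_≤ 𝔼 f) (𝔼-const 0#) (𝔼-mono 0≤f)

  𝔼-≤1 : ∀ {f : G → Carrier} → (∀ x → f x ≤ 1#) → 𝔼 f ≤ 1#
  𝔼-≤1 {f} f≤1 = subst (𝔼 f ≤_) (𝔼-const 1#) (𝔼-mono f≤1)

  UnitValued : (G → Carrier) → Set
  UnitValued f = ∀ x → UnitInterval (f x)

  𝔼-unit : ∀ {f : G → Carrier} → UnitValued f → UnitInterval (𝔼 f)
  𝔼-unit uf = 𝔼-nonneg (λ x → proj₁ (uf x)) , 𝔼-≤1 (λ x → proj₂ (uf x))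

  𝔼-product : ∀ (f g : G → Carrier) → 𝔼 f * 𝔼 g ≡ 𝔼 (λ x → 𝔼 (λ y → f x * g y))
  𝔼-product f g = trans (sym (𝔼-*ʳ (𝔼 g) f)) (𝔼-cong (λ x → sym (𝔼-* (f x) g)))

  𝔼-δ-1 : ∀ (z : G) → 𝔼 (λ x → δ x z) ≡ 1#
  𝔼-δ-1 z = trans (𝔼-cong (λ x → sym (*-identityʳ (δ x z)))) (𝔼-δ z (λ _ → 1#))

  -- Averages the square of c f - g. The free weight c takes the place of the norms, whose square
  -- roots need not exist in the field.
  𝔼-weightedCauchySchwarz : ∀ c (f g : G → Carrier) → (1# + 1#) * c * 𝔼 (λ x → f x * g x) ≤ c * c * 𝔼 (λ x → f x * f x) + 𝔼 (λ x
      → g x * g x)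
  𝔼-weightedCauchySchwarz c f g =
    (1# + 1#) * c * 𝔼 (λ x → f x * g x)                            ≡⟨ sym (𝔼-* ((1# + 1#) * c) (λ x → f x * g x)) ⟩≤
    𝔼 (λ x → (1# + 1#) * c * (f x * g x))                          ≤⟨ 𝔼-mono (λ x → ≤-by _ (square-nonneg (c * f x - g x))
      (solve 3 (λ c u v → c :* c :* (u :* u) :+ v :* v := (:1 :+ :1) :* c :* (u :* v) :+ (c :* u :- v) :* (c :* u :- v)) refl c (f x)
          (g x))) ⟩
    𝔼 (λ x → c * c * (f x * f x) + g x * g x)                      ≡⟨ trans (𝔼-+ (λ x → c * c * (f x * f x)) (λ x → g x * g x))
        (cong (_+ 𝔼 (λ x → g x * g x)) (𝔼-* (c * c) (λ x → f x * f x))) ⟩≤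
    c * c * 𝔼 (λ x → f x * f x) + 𝔼 (λ x → g x * g x)             □

  𝔼-variance : ∀ c (f : G → Carrier) → 𝔼 (λ x → (f x - c) * (f x - c)) ≡ 𝔼 (λ x → f x * f x) - (1# + 1#) * c * 𝔼 f + c * c
  𝔼-variance c f =
    trans (𝔼-cong (λ x → solve 2 (λ c u → (u :- c) :* (u :- c) := u :* u :- (:1 :+ :1) :* c :* u :+ c :* c) refl c (f x)))
    (trans (𝔼-+ _ _) (cong₂ _+_ (trans (𝔼-- _ _) (cong (λ z → 𝔼 (λ x → f x * f x) - z) (𝔼-* ((1# + 1#) * c) f))) (𝔼-const (c * c))))

-- The field with p elements and the chords of a hyperbola

record FiniteField (p : ℕ) : Set where
  infixl 7 _⊗_
  infixl 6 _⊕_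
  infix  8 ⊖_
  field
    _⊕_ _⊗_           : Fin p → Fin p → Fin p
    ⊖_                : Fin p → Fin p
    𝟘 𝟙               : Fin p
    isCommutativeRing : IsCommutativeRing _≡_ _⊕_ _⊗_ ⊖_ 𝟘 𝟙
    inv               : Fin p → Fin p
    inv-𝟘             : inv 𝟘 ≡ 𝟘
    ⊗-inv             : ∀ {x} → x ≢ 𝟘 → x ⊗ inv x ≡ 𝟙

  fieldRing : CommutativeRing _ _
  fieldRing = record { isCommutativeRing = isCommutativeRing }

  open Algebra.Properties.Semiring.Mult (CommutativeRing.semiring fieldRing) public using () renaming (_×_ to _·_)

  field
    -- Makes this a prime field: every nonzero element generates the additive group. Pollard's
    -- theorem depends on it, since a proper subgroup would be a counterexample.
    cyclic : ∀ x → ∃ λ k → x ≡ k · 𝟙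

  infixl 6 _⊝_

  _⊝_ : Fin p → Fin p → Fin p
  x ⊝ y = x ⊕ ⊖ y

module FieldProperties {p} (F : FiniteField p) where
  open FiniteField F
  private module R = CommutativeRing fieldRing
  open IntegerCoefficients fieldRing

  ⊕-⊝ : ∀ x y → x ⊕ y ⊝ y ≡ x
  ⊕-⊝ = solve 2 (λ x y → x :+ y :- y := x) refl

  ⊝-⊕ : ∀ x y → x ⊝ y ⊕ y ≡ x
  ⊝-⊕ = solve 2 (λ x y → x :- y :+ y := x) refl

  ⊝-involutive : ∀ c x → c ⊝ (c ⊝ x) ≡ x
  ⊝-involutive = solve 2 (λ c x → c :- (c :- x) := x) refl

  [x⊕d]⊝x : ∀ x d → x ⊕ d ⊝ x ≡ d
  [x⊕d]⊝x = solve 2 (λ x d → x :+ d :- x := d) refl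

  x⊝[x⊝a] : ∀ y x a → y ⊝ (x ⊝ a) ≡ a ⊕ (y ⊝ x)
  x⊝[x⊝a] = solve 3 (λ y x a → y :- (x :- a) := a :+ (y :- x)) refl

  x⊝[a⊕s] : ∀ x a s → x ⊝ (a ⊕ s) ≡ x ⊝ a ⊝ s
  x⊝[a⊕s] = solve 3 (λ x a s → x :- (a :+ s) := x :- a :- s) refl

  x⊕[z⊝y]⊝[x⊝y] : ∀ x y z → x ⊕ (z ⊝ y) ⊝ (x ⊝ y) ≡ z
  x⊕[z⊝y]⊝[x⊝y] = solve 3 (λ x y z → x :+ (z :- y) :- (x :- y) := z) refl

  [a⊝b]⊝a : ∀ a b → a ⊝ b ⊝ a ≡ 𝟘 ⊝ b
  [a⊝b]⊝a = solve 2 (λ a b → a :- b :- a := :0 :- b) refl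

  ⊝-comm : ∀ z a e → z ⊝ a ⊝ e ≡ z ⊝ e ⊝ a
  ⊝-comm = solve 3 (λ z a e → z :- a :- e := z :- e :- a) refl

  ⊗-cancelˡ : ∀ {x y z} → z ≢ 𝟘 → z ⊗ x ≡ z ⊗ y → x ≡ y
  ⊗-cancelˡ {x} {y} {z} z≢𝟘 e = trans (sym (strip x)) (trans (cong (inv z ⊗_) e) (strip y))
    where
    strip : ∀ x → inv z ⊗ (z ⊗ x) ≡ x
    strip x = trans (solve 3 (λ i z x → i :* (z :* x) := (z :* i) :* x) refl (inv z) z x)
      (trans (cong (_⊗ x) (⊗-inv z≢𝟘)) (R.*-identityˡ x))

  ⊗-nonzero : ∀ {x y} → x ≢ 𝟘 → y ≢ 𝟘 → x ⊗ y ≢ 𝟘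
  ⊗-nonzero {x} x≢𝟘 y≢𝟘 e = y≢𝟘 (⊗-cancelˡ x≢𝟘 (trans e (sym (R.zeroʳ x))))

  -- Fixes 𝟘, by the convention inv 𝟘 ≡ 𝟘, and is then an involution of the whole field.
  reflection : Fin p → Fin p → Fin p
  reflection t x = t ⊗ inv x

  reflection-involutive : ∀ {t} → t ≢ 𝟘 → ∀ x → reflection t (reflection t x) ≡ x
  reflection-involutive {t} t≢𝟘 x with x ≟ 𝟘
  ... | yes refl = trans (cong (λ i → t ⊗ inv i) (trans (cong (t ⊗_) inv-𝟘) (R.zeroʳ t)))
                     (trans (cong (t ⊗_) inv-𝟘) (R.zeroʳ t))
  ... | no x≢𝟘 = ⊗-cancelˡ ti≢𝟘
    (trans (solve 3 (λ t i j → (t :* i) :* (t :* j) := t :* i :* j :* t) refl t (inv x) (inv (t ⊗ inv x)))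
    (trans (cong (_⊗ t) (⊗-inv ti≢𝟘))
    (trans (solve 1 (λ t → :1 :* t := t :* :1) refl t)
    (trans (cong (t ⊗_) (sym (⊗-inv x≢𝟘)))
    (solve 3 (λ t x i → t :* (x :* i) := (t :* i) :* x) refl t x (inv x))))))
    where
    i≢𝟘 : inv x ≢ 𝟘
    i≢𝟘 e = x≢𝟘 (trans (sym (R.*-identityʳ x)) (trans (cong (x ⊗_) (trans (sym (⊗-inv x≢𝟘)) (trans (cong (x ⊗_) e) (R.zeroʳ x))))
        (R.zeroʳ x)))
    ti≢𝟘 : t ⊗ inv x ≢ 𝟘
    ti≢𝟘 = ⊗-nonzero t≢𝟘 i≢𝟘

  reflection-nonzero : ∀ {t x} → t ≢ 𝟘 → x ≢ 𝟘 → reflection t x ≢ 𝟘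
  reflection-nonzero {t} {x} t≢𝟘 x≢𝟘 e = x≢𝟘 (trans (sym (reflection-involutive t≢𝟘 x))
    (trans (cong (λ y → t ⊗ inv y) e) (trans (cong (t ⊗_) inv-𝟘) (R.zeroʳ t))))

  -- The height of the chord of the hyperbola xy = t between the abscissas x and x + d.
  chord : Fin p → Fin p → Fin p → Fin p
  chord t d x = reflection t (x ⊕ d) ⊝ reflection t x

  -- This is t/(x+d) - t/x = -td/(x(x+d)) without fractions. Each inverse is first brought next to
  -- the element that it inverts.
  chord-cleared : ∀ {t d x} → x ≢ 𝟘 → x ⊕ d ≢ 𝟘 → chord t d x ⊗ (x ⊗ (x ⊕ d)) ≡ ⊖ (t ⊗ d)
  chord-cleared {t} {d} {x} x≢𝟘 y≢𝟘 =
    trans (solve 5 (λ t d x i j → (t :* j :- t :* i) :* (x :* (x :+ d)) := t :* x :* ((x :+ d) :* j) :- t :* (x :+ d) :*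
        (x :* i)) refl t d x (inv x) (inv (x ⊕ d)))
    (trans (cong₂ (λ u v → t ⊗ x ⊗ u ⊝ t ⊗ (x ⊕ d) ⊗ v) (⊗-inv y≢𝟘) (⊗-inv x≢𝟘))
    (solve 3 (λ t d x → t :* x :* :1 :- t :* (x :+ d) :* :1 := :- (t :* d)) refl t d x))

  EqualChords : (t d d′ m x : Fin p) → Set
  EqualChords t d d′ m x = (x ≢ 𝟘 × x ⊕ d ≢ 𝟘) × (m ⊗ x ≢ 𝟘 × m ⊗ x ⊕ d′ ≢ 𝟘) × chord t d x ≡ chord t d′ (m ⊗ x)

  -- Clearing denominators gives a quadratic equation in x and u. With u = mx both sides contain the
  -- factor x; once it is cancelled, the equation has degree one in x.
  equalChords-linear : ∀ {t d d′ m x} → t ≢ 𝟘 → EqualChords t d d′ m x → x ⊗ (d ⊗ m ⊗ m ⊝ d′) ≡ d ⊗ d′ ⊗ (𝟙 ⊝ m)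
  equalChords-linear {t} {d} {d′} {m} {x} t≢𝟘 ((x≢𝟘 , y≢𝟘) , (X≢𝟘 , Y≢𝟘) , e) =
    trans (solve 4 (λ d d′ m x → x :* (d :* m :* m :- d′) := d :* m :* (m :* x :+ d′) :- d′ :* (x :+ d) :+ d :* d′ :*
        (:1 :- m)) refl d d′ m x)
    (trans (cong (λ z → z ⊝ d′ ⊗ (x ⊕ d) ⊕ d ⊗ d′ ⊗ (𝟙 ⊝ m)) quadric)
    (solve 2 (λ a b → a :- a :+ b := b) refl (d′ ⊗ (x ⊕ d)) (d ⊗ d′ ⊗ (𝟙 ⊝ m))))
    where
    c = chord t d x
    -- The common height times all four abscissas, evaluated through either chord.
    both : t ⊗ (x ⊗ (d ⊗ m ⊗ (m ⊗ x ⊕ d′))) ≡ t ⊗ (x ⊗ (d′ ⊗ (x ⊕ d)))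
    both =
      trans (solve 5 (λ t d d′ m x → t :* (x :* (d :* m :* (m :* x :+ d′))) := :-
          (:- (t :* d) :* (m :* x :* (m :* x :+ d′)))) refl t d d′ m x)
      (trans (cong (λ z → ⊖ (z ⊗ (m ⊗ x ⊗ (m ⊗ x ⊕ d′)))) (sym (chord-cleared x≢𝟘 y≢𝟘)))
      (trans (solve 3 (λ c u v → :- (c :* u :* v) := :- (c :* v :* u)) refl c (x ⊗ (x ⊕ d)) (m ⊗ x ⊗ (m ⊗ x ⊕ d′)))
      (trans (cong (λ z → ⊖ (z ⊗ (m ⊗ x ⊗ (m ⊗ x ⊕ d′)) ⊗ (x ⊗ (x ⊕ d)))) e)
      (trans (cong (λ z → ⊖ (z ⊗ (x ⊗ (x ⊕ d)))) (chord-cleared X≢𝟘 Y≢𝟘))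
      (solve 4 (λ t d d′ x → :- (:- (t :* d′) :* (x :* (x :+ d))) := t :* (x :* (d′ :* (x :+ d)))) refl t d d′ x)))))
    quadric : d ⊗ m ⊗ (m ⊗ x ⊕ d′) ≡ d′ ⊗ (x ⊕ d)
    quadric = ⊗-cancelˡ x≢𝟘 (⊗-cancelˡ t≢𝟘 both)

  -- For a fixed ratio m of the endpoints, the coincidence of two chords is a linear equation in x.
  equalChords-unique : ∀ {t d d′ m x y} → t ≢ 𝟘 → d ≢ 𝟘 → d′ ≢ 𝟘 → ¬ (m ≡ 𝟙 × d ≡ d′) →
    EqualChords t d d′ m x → EqualChords t d d′ m y → x ≡ y
  equalChords-unique {t} {d} {d′} {m} {x} {y} t≢𝟘 d≢𝟘 d′≢𝟘 generic ex ey with d ⊗ m ⊗ m ⊝ d′ ≟ 𝟘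
  ... | no slope≢𝟘 = ⊗-cancelˡ slope≢𝟘 (trans (R.*-comm _ x) (trans
      (trans (equalChords-linear t≢𝟘 ex) (sym (equalChords-linear t≢𝟘 ey))) (R.*-comm y _)))
  -- Without its term in x the equation reads dd′(1 - m) = 0. So m = 1, and then the vanishing
  -- coefficient dm² - d′ gives d = d′.
  ... | yes slope≡𝟘 = contradiction (m≡𝟙 , d≡d′) generic
    where
    m≡𝟙 : m ≡ 𝟙
    m≡𝟙 = trans (solve 1 (λ m → m := :1 :- (:1 :- m)) refl m)
      (trans (cong (𝟙 ⊝_) (⊗-cancelˡ (⊗-nonzero d≢𝟘 d′≢𝟘)
        (trans (sym (equalChords-linear t≢𝟘 ex)) (trans (cong (x ⊗_) slope≡𝟘) (trans (R.zeroʳ x) (sym (R.zeroʳ (d ⊗ d′))))))))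
      (solve 0 (:1 :- :0 := :1) refl))
    d≡d′ : d ≡ d′
    d≡d′ = trans (solve 2 (λ d d′ → d := d :* :1 :* :1 :- d′ :+ d′) refl d d′)
      (trans (cong (λ z → d ⊗ z ⊗ z ⊝ d′ ⊕ d′) (sym m≡𝟙)) (trans (cong (_⊕ d′) slope≡𝟘) (R.+-identityˡ d′)))

-- Averages over the field and convolutions

module FieldAverages (K : OrderedField) {p : ℕ} (positive-p : OrderedFieldProperties.Positive K (OrderedFieldProperties.fromℕ K p)) (F : FiniteField p) where
  open OrderedField K
  open OrderedFieldProperties K
  open IntegerCoefficients commutativeRing
  open Averages K p positive-p
  open FiniteField F hiding (isCommutativeRing)
  open FieldProperties F

  𝔼-shift : ∀ c f → 𝔼 (λ x → f (x ⊕ c)) ≡ 𝔼 f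
  𝔼-shift c f = 𝔼-permute f (_⊕ c) (_⊝ c) (λ x → ⊝-⊕ x c) (λ x → ⊕-⊝ x c)

  𝔼-shift⁻ : ∀ c f → 𝔼 (λ x → f (x ⊝ c)) ≡ 𝔼 f
  𝔼-shift⁻ c f = 𝔼-permute f (_⊝ c) (_⊕ c) (λ x → ⊕-⊝ x c) (λ x → ⊝-⊕ x c)

  𝔼-reflect : ∀ c f → 𝔼 (λ x → f (c ⊝ x)) ≡ 𝔼 f
  𝔼-reflect c f = 𝔼-permute f (c ⊝_) (c ⊝_) (⊝-involutive c) (⊝-involutive c)

  𝔼-dilate : ∀ {c} → c ≢ 𝟘 → ∀ f → 𝔼 (λ x → f (x ⊗ c)) ≡ 𝔼 f
  𝔼-dilate {c} c≢𝟘 f = 𝔼-permute f (_⊗ c) (_⊗ inv c)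
    (λ x → trans (R.*-assoc x (inv c) c) (trans (cong (x ⊗_) (trans (R.*-comm _ c) (⊗-inv c≢𝟘))) (R.*-identityʳ x)))
    (λ x → trans (R.*-assoc x c (inv c)) (trans (cong (x ⊗_) (⊗-inv c≢𝟘)) (R.*-identityʳ x)))
    where module R = CommutativeRing fieldRing

  χ : G → Carrier
  χ x = ι (¬? (x ≟ 𝟘))

  χ-unit : UnitValued χ
  χ-unit x = ι-unit (¬? (x ≟ 𝟘))

  χ-𝟘 : ∀ x → χ x ≡ 1# - ι (x ≟ 𝟘)
  χ-𝟘 x with x ≟ 𝟘
  ... | yes _ = solve 0 (:0 := :1 :- :1) refl
  ... | no  _ = solve 0 (:1 := :1 :- :0) refl

  -- Under the weight `χ x` one may assume `x ≢ 𝟘`. This brings substitutions such as u = mx into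
  -- averages over the whole field.
  χ-cong : ∀ x {a b} → (x ≢ 𝟘 → a ≡ b) → χ x * a ≡ χ x * b
  χ-cong x {a} {b} e with x ≟ 𝟘
  ... | yes _    = trans (zeroˡ a) (sym (zeroˡ b))
  ... | no  x≢𝟘 = cong (1# *_) (e x≢𝟘)

  χ-mono : ∀ x {a b} → (x ≢ 𝟘 → a ≤ b) → χ x * a ≤ χ x * b
  χ-mono x {a} {b} e with x ≟ 𝟘
  ... | yes _    = ≤-reflexive (trans (zeroˡ a) (sym (zeroˡ b)))
  ... | no  x≢𝟘 = *-monoˡ-≤ 1# 0≤1 (e x≢𝟘)

  ι-× : ∀ {A B : Set} (d : Dec A) (e : Dec B) → ι d * ι e ≡ ι (d ×-dec e)
  ι-× (yes _) (yes _) = *-identityˡ 1#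
  ι-× (yes _) (no _)  = *-identityˡ 0#
  ι-× (no _)  e       = zeroˡ (ι e)

  𝔼-χ : 𝔼 χ ≡ 1# - q
  𝔼-χ = trans (𝔼-cong χ-𝟘) (trans (𝔼-- (λ _ → 1#) (λ x → ι (x ≟ 𝟘))) (cong₂ _-_ (𝔼-const 1#) (𝔼-ι-≟ 𝟘)))

  𝔼-⊕ : ∀ x f → 𝔼 (λ d → f (x ⊕ d)) ≡ 𝔼 f
  𝔼-⊕ x f = trans (𝔼-cong (λ d → cong f (CommutativeRing.+-comm fieldRing x d))) (𝔼-shift x f)

  conv : (G → Carrier) → (G → Carrier) → G → Carrier
  conv φ θ x = 𝔼 (λ a → φ a * θ (x ⊝ a))

  conv-mean : ∀ φ θ → 𝔼 (conv φ θ) ≡ 𝔼 φ * 𝔼 θ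
  conv-mean φ θ = trans (𝔼-comm (λ x a → φ a * θ (x ⊝ a)))
    (trans (𝔼-cong (λ a → trans (𝔼-* (φ a) (λ x → θ (x ⊝ a))) (cong (φ a *_) (𝔼-shift⁻ a θ)))) (𝔼-*ʳ (𝔼 θ) φ))

-- Equidistribution of the heights of chords

module Equidistribution (K : OrderedField) {p : ℕ} (positive-p : OrderedFieldProperties.Positive K (OrderedFieldProperties.fromℕ K p))
                        (F : FiniteField p) (t : Fin p) (t≢𝟘 : t ≢ FiniteField.𝟘 F) where
  open OrderedField K
  open OrderedFieldProperties K
  open IntegerCoefficients commutativeRing
  open Averages K p positive-p
  open FiniteField F hiding (isCommutativeRing)
  open FieldProperties F
  open FieldAverages K positive-p F

  τ : G → G
  τ = reflection t

  -- Selects the chords whose two end points lie on the hyperbola: `τ` is defined at 𝟘 by convention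
  -- only.
  N : G → G → Carrier
  N d x = χ x * χ (x ⊕ d)

  N-unit : ∀ d x → UnitInterval (N d x)
  N-unit d x = unit-* (χ-unit x) (χ-unit (x ⊕ d))

  -- At most the two points x = 0 and x = -d are lost.
  N-mean : ∀ d → 1# - (1# + 1#) * q ≤ 𝔼 (N d)
  N-mean d =
    1# - (1# + 1#) * q
      ≡⟨ solve 1 (λ q → :1 :- (:1 :+ :1) :* q := :1 :- q :- q) refl q ⟩≤
    1# - q - q
      ≡⟨ sym (trans (𝔼-- (λ x → 1# - a x) b) (cong₂ _-_ (trans (𝔼-- (λ _ → 1#) a) (cong₂ _-_ (𝔼-const 1#) (𝔼-ι-≟ 𝟘)))
          (trans (𝔼-shift d a) (𝔼-ι-≟ 𝟘)))) ⟩≤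
    𝔼 (λ x → 1# - a x - b x)
      ≤⟨ 𝔼-mono (λ x → ≤-by (a x * b x) (*-nonneg (proj₁ (ι-unit (x ≟ 𝟘))) (proj₁ (ι-unit (x ⊕ d ≟ 𝟘))))
           (trans (cong₂ _*_ (χ-𝟘 x) (χ-𝟘 (x ⊕ d))) (solve 2 (λ a b → (:1 :- a) :* (:1 :- b) := :1 :- a :- b :+ a :* b) refl (a x)
               (b x)))) ⟩
    𝔼 (N d) □
    where
    a b : G → Carrier
    a x = ι (x ≟ 𝟘)
    b x = ι (x ⊕ d ≟ 𝟘)

  equalChords? : ∀ d d′ m x → Dec (EqualChords t d d′ m x)
  equalChords? d d′ m x = (¬? (x ≟ 𝟘) ×-dec ¬? (x ⊕ d ≟ 𝟘)) ×-dec
      ((¬? (m ⊗ x ≟ 𝟘) ×-dec ¬? (m ⊗ x ⊕ d′ ≟ 𝟘)) ×-dec (chord t d x ≟ chord t d′ (m ⊗ x)))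

  coincidence : G → G → G → G → Carrier
  coincidence d d′ x u = N d′ u * δ (chord t d x) (chord t d′ u)

  coincidence-ι : ∀ d d′ m x → χ x * (χ (x ⊕ d) * coincidence d d′ x (m ⊗ x)) ≡ P * ι (equalChords? d d′ m x)
  coincidence-ι d d′ m x =
    trans (solve 6 (λ a b c e f P → a :* (b :* ((c :* e) :* (P :* f))) := P :* ((a :* b) :* ((c :* e) :* f))) refl
      (χ x) (χ (x ⊕ d)) (χ (m ⊗ x)) (χ (m ⊗ x ⊕ d′)) (ι f?) P)
    (cong (P *_) (trans (cong₂ _*_ (ι-× a? b?) (trans (cong (_* ι f?) (ι-× c? e?)) (ι-× (c? ×-dec e?) f?)))
        (ι-× (a? ×-dec b?) ((c? ×-dec e?) ×-dec f?))))
    where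
    a? = ¬? (x ≟ 𝟘)
    b? = ¬? (x ⊕ d ≟ 𝟘)
    c? = ¬? (m ⊗ x ≟ 𝟘)
    e? = ¬? (m ⊗ x ⊕ d′ ≟ 𝟘)
    f? = chord t d x ≟ chord t d′ (m ⊗ x)

  -- A single x contributes P·q = 1 to the average, and for a given m there is at most one, unless m
  -- = 𝟙 and d = d′, where the two chords are the same.
  coincidence-slope : ∀ {d d′} → d ≢ 𝟘 → d′ ≢ 𝟘 → ∀ m →
    𝔼 (λ x → χ x * (χ (x ⊕ d) * coincidence d d′ x (m ⊗ x))) ≤ 1# + q * δ d d′ * δ m 𝟙
  coincidence-slope {d} {d′} d≢𝟘 d′≢𝟘 m = ≤-trans (≤-reflexive (𝔼-cong (coincidence-ι d d′ m))) cases
    where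
    e : G → Carrier
    e x = ι (equalChords? d d′ m x)
    nonneg : 0# ≤ q * δ d d′ * δ m 𝟙
    nonneg = *-nonneg (*-nonneg 0≤q (δ-nonneg d d′)) (δ-nonneg m 𝟙)
    generic : ¬ (m ≡ 𝟙 × d ≡ d′) → 𝔼 (λ x → P * e x) ≤ 1# + q * δ d d′ * δ m 𝟙
    generic ne =
      𝔼 (λ x → P * e x) ≡⟨ trans (𝔼-* P e) (P*𝔼 e) ⟩≤
      _                 ≤⟨ sum-ι-atMostOne (equalChords? d d′ m) (λ x y → equalChords-unique t≢𝟘 d≢𝟘 d′≢𝟘 ne) ⟩
      1#                ≤⟨ ≤-by _ nonneg refl ⟩
      1# + q * δ d d′ * δ m 𝟙 □
    cases : 𝔼 (λ x → P * e x) ≤ 1# + q * δ d d′ * δ m 𝟙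
    cases with m ≟ 𝟙 in m=𝟙 | d ≟ d′ in d=d′
    ... | no m≢𝟙 | de       = subst₂ (λ u v → 𝔼 (λ x → P * e x) ≤ 1# + q * (P * ι u) * (P * ι v)) d=d′ m=𝟙 (generic (λ (m≡𝟙 , _) → m≢𝟙 m≡𝟙))
    ... | yes m≡𝟙 | no d≢d′ = subst₂ (λ u v → 𝔼 (λ x → P * e x) ≤ 1# + q * (P * ι u) * (P * ι v)) d=d′ m=𝟙
        (generic (λ (_ , d≡d′) → d≢d′ d≡d′))
    -- Every x may count here. The resulting bound P equals q·P·P, which is the value of the second
    -- term on the diagonal.
    ... | yes m≡𝟙 | yes d≡d′ =
      𝔼 (λ x → P * e x) ≤⟨ 𝔼-mono (λ x → *-monoˡ-≤ P 0≤P (proj₂ (ι-unit (equalChords? d d′ m x)))) ⟩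
      𝔼 (λ x → P * 1#)  ≡⟨ 𝔼-const (P * 1#) ⟩≤
      P * 1#            ≡⟨ trans (cong (P *_) (sym P*q≡1)) (solve 2 (λ P q → P :* (P :* q) := q :* (P :* :1) :* (P :* :1)) refl P q) ⟩≤
      q * (P * 1#) * (P * 1#) ≤⟨ ≤-by 1# 0≤1 (+-comm 1# _) ⟩
      1# + q * (P * 1#) * (P * 1#) □

  -- Writing u = m x turns the coincidence of two chords into one linear equation for each m.
  coincidence-bound : ∀ {d d′} → d ≢ 𝟘 → d′ ≢ 𝟘 →
    𝔼 (λ x → 𝔼 (λ u → N d x * coincidence d d′ x u)) ≤ 1# + q * δ d d′
  coincidence-bound {d} {d′} d≢𝟘 d′≢𝟘 =
    𝔼 (λ x → 𝔼 (λ u → N d x * coincidence d d′ x u))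
      ≡⟨ 𝔼-cong (λ x → trans (𝔼-cong (λ u → *-assoc (χ x) (χ (x ⊕ d)) (coincidence d d′ x u)))
           (trans (𝔼-* (χ x) (λ u → χ (x ⊕ d) * coincidence d d′ x u))
           (trans (χ-cong x (λ x≢𝟘 → sym (𝔼-dilate x≢𝟘 (λ u → χ (x ⊕ d) * coincidence d d′ x u))))
           (sym (𝔼-* (χ x) (λ m → χ (x ⊕ d) * coincidence d d′ x (m ⊗ x))))))) ⟩≤
    𝔼 (λ x → 𝔼 (λ m → χ x * (χ (x ⊕ d) * coincidence d d′ x (m ⊗ x))))
      ≡⟨ 𝔼-comm (λ x m → χ x * (χ (x ⊕ d) * coincidence d d′ x (m ⊗ x))) ⟩≤
    𝔼 (λ m → 𝔼 (λ x → χ x * (χ (x ⊕ d) * coincidence d d′ x (m ⊗ x))))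
      ≤⟨ 𝔼-mono (coincidence-slope d≢𝟘 d′≢𝟘) ⟩
    𝔼 (λ m → 1# + q * δ d d′ * δ m 𝟙)
      ≡⟨ trans (𝔼-+ (λ _ → 1#) (λ m → q * δ d d′ * δ m 𝟙)) (cong₂ _+_ (𝔼-const 1#)
           (trans (𝔼-* (q * δ d d′) (λ m → δ m 𝟙)) (trans (cong (q * δ d d′ *_) (𝔼-δ-1 𝟙)) (*-identityʳ _)))) ⟩≤
    1# + q * δ d d′ □

  module ChordDistribution (C : G → Carrier) (C-unit : UnitValued C) where
    -- The factor `χ d` removes the width 𝟘, for which all chords have height 𝟘.
    W : G → G → Carrier
    W d x = χ d * C d * N d x

    -- The weighted frequency of the height e among all chords. It would have mean `μ` if no chord
    -- were excluded by `N`.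
    S : G → Carrier
    S e = 𝔼 (λ d → 𝔼 (λ x → W d x * δ e (chord t d x)))

    μ : Carrier
    μ = 𝔼 (λ d → χ d * C d)

    χC-unit : UnitValued (λ d → χ d * C d)
    χC-unit d = unit-* (χ-unit d) (C-unit d)

    μ-unit : UnitInterval μ
    μ-unit = 𝔼-unit χC-unit

    𝔼-*S : ∀ h → 𝔼 (λ e → h e * S e) ≡ 𝔼 (λ d → 𝔼 (λ x → W d x * h (chord t d x)))
    𝔼-*S h =
      trans (𝔼-cong (λ e → trans (sym (𝔼-* (h e) _)) (𝔼-cong (λ d → sym (𝔼-* (h e) _)))))
      (trans (𝔼-comm (λ e d → 𝔼 (λ x → h e * (W d x * δ e (chord t d x)))))
      (𝔼-cong (λ d → trans (𝔼-comm (λ e x → h e * (W d x * δ e (chord t d x))))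
      (𝔼-cong (λ x → trans (𝔼-cong (λ e → solve 3 (λ h w d → h :* (w :* d) := w :* (d :* h)) refl (h e) (W d x) (δ e (chord t d x))))
        (trans (𝔼-* (W d x) _) (cong (W d x *_) (𝔼-δ (chord t d x) h))))))))

    S-mean : μ * (1# - (1# + 1#) * q) ≤ 𝔼 S
    S-mean =
      μ * (1# - (1# + 1#) * q)
        ≡⟨ sym (𝔼-*ʳ (1# - (1# + 1#) * q) (λ d → χ d * C d)) ⟩≤
      𝔼 (λ d → χ d * C d * (1# - (1# + 1#) * q))
        ≤⟨ 𝔼-mono (λ d → *-monoˡ-≤ (χ d * C d) (proj₁ (χC-unit d)) (N-mean d)) ⟩
      𝔼 (λ d → χ d * C d * 𝔼 (N d))
        ≡⟨ 𝔼-cong (λ d → trans (sym (𝔼-* (χ d * C d) (N d))) (𝔼-cong (λ x → sym (*-identityʳ (W d x))))) ⟩≤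
      𝔼 (λ d → 𝔼 (λ x → W d x * 1#))
        ≡⟨ sym (𝔼-*S (λ _ → 1#)) ⟩≤
      𝔼 (λ e → 1# * S e)
        ≡⟨ 𝔼-cong (λ e → *-identityˡ (S e)) ⟩≤
      𝔼 S □

    -- The square counts pairs of chords of equal height. For fixed widths `coincidence-bound` gives
    -- 1, which sums to μ², plus a diagonal term for equal widths, which sums to at most `q`.
    S-square : 𝔼 (λ e → S e * S e) ≤ μ * μ + q
    S-square =
      𝔼 (λ e → S e * S e)
        ≡⟨ 𝔼-*S S ⟩≤
      𝔼 (λ d → 𝔼 (λ x → W d x * S (chord t d x)))
        ≡⟨ 𝔼-cong (λ d → trans (𝔼-cong (λ x → trans (sym (𝔼-* (W d x) _)) (𝔼-cong (λ d′ → sym (𝔼-* (W d x) _)))))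
             (trans (𝔼-comm (λ x d′ → 𝔼 (λ u → W d x * (W d′ u * δ (chord t d x) (chord t d′ u)))))
             (𝔼-cong (λ d′ → regroup d d′)))) ⟩≤
      𝔼 (λ d → 𝔼 (λ d′ → χ d * (χ d′ * (C d * C d′ * B d d′))))
        ≤⟨ 𝔼-mono (λ d → 𝔼-mono (λ d′ → χ-mono d (λ d≢𝟘 → χ-mono d′ (λ d′≢𝟘 →
             *-monoˡ-≤ (C d * C d′) (*-nonneg (proj₁ (C-unit d)) (proj₁ (C-unit d′))) (coincidence-bound d≢𝟘 d′≢𝟘))))) ⟩
      𝔼 (λ d → 𝔼 (λ d′ → χ d * (χ d′ * (C d * C d′ * (1# + q * δ d d′)))))
        ≡⟨ 𝔼-cong (λ d → trans (𝔼-cong (λ d′ → trans (solve 6 (λ a b c e q z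
            → a :* (b :* (c :* e :* (:1 :+ q :* z))) := a :* c :* (b :* e) :+ q :* (a :* c) :* (z :* (b :* e))) refl (χ d) (χ d′) (C d)
              (C d′) q (δ d d′))
               (cong (λ z → χ d * C d * (χ d′ * C d′) + q * (χ d * C d) * (z * (χ d′ * C d′))) (δ-sym d d′))))
             (trans (𝔼-+ _ _) (cong (𝔼 (λ d′ → χ d * C d * (χ d′ * C d′)) +_)
                 (trans (𝔼-* (q * (χ d * C d)) _) (cong (q * (χ d * C d) *_) (𝔼-δ d (λ d′ → χ d′ * C d′))))))) ⟩≤
      𝔼 (λ d → 𝔼 (λ d′ → χ d * C d * (χ d′ * C d′)) + q * (χ d * C d) * (χ d * C d))
        ≤⟨ 𝔼-mono (λ d → +-mono-≤ ≤-refl (subst (q * (χ d * C d) * (χ d * C d) ≤_) (*-identityʳ q)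
             (subst (_≤ q * 1#) (sym (*-assoc q (χ d * C d) (χ d * C d))) (*-monoˡ-≤ q 0≤q (proj₂ (unit-* (χC-unit d) (χC-unit d))))))) ⟩
      𝔼 (λ d → 𝔼 (λ d′ → χ d * C d * (χ d′ * C d′)) + q)
        ≡⟨ trans (𝔼-+ _ (λ _ → q)) (cong₂ _+_ (sym (𝔼-product (λ d → χ d * C d) (λ d → χ d * C d))) (𝔼-const q)) ⟩≤
      μ * μ + q □
      where
      B : G → G → Carrier
      B d d′ = 𝔼 (λ x → 𝔼 (λ u → N d x * coincidence d d′ x u))
      regroup : ∀ d d′ → 𝔼 (λ x → 𝔼 (λ u → W d x * (W d′ u * δ (chord t d x) (chord t d′ u)))) ≡ χ d * (χ d′ * (C d * C d′ * B d d′))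
      regroup d d′ =
        trans (𝔼-cong (λ x → trans (𝔼-cong (λ u → solve 7 (λ a c n b e m z
            → a :* c :* n :* (b :* e :* m :* z) := a :* (b :* (c :* e)) :* (n :* (m :* z))) refl (χ d) (C d) (N d x) (χ d′) (C d′)
              (N d′ u) (δ (chord t d x) (chord t d′ u))))
          (𝔼-* (χ d * (χ d′ * (C d * C d′))) (λ u → N d x * coincidence d d′ x u))))
        (trans (𝔼-* (χ d * (χ d′ * (C d * C d′))) (λ x → 𝔼 (λ u → N d x * coincidence d d′ x u)))
        (solve 4 (λ a b c z → a :* (b :* c) :* z := a :* (b :* (c :* z))) refl (χ d) (χ d′) (C d * C d′) (B d d′)))

    -- One `q` from the equal widths in `S-square`; four from the two abscissas excluded in
    -- `S-mean`, doubled by the cross term of the variance.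
    five : Carrier
    five = 1# + 1# + 1# + 1# + 1#

    S-variance : 𝔼 (λ e → (S e - μ) * (S e - μ)) ≤ five * q
    S-variance =
      𝔼 (λ e → (S e - μ) * (S e - μ))
        ≡⟨ 𝔼-variance μ S ⟩≤
      𝔼 (λ e → S e * S e) - (1# + 1#) * μ * 𝔼 S + μ * μ
        ≤⟨ +-mono-≤ (+-mono-≤ S-square (neg-mono-≤ (*-monoˡ-≤ ((1# + 1#) * μ) (*-nonneg (+-nonneg 0≤1 0≤1) (proj₁ μ-unit)) S-mean)))
            ≤-refl ⟩
      μ * μ + q - (1# + 1#) * μ * (μ * (1# - (1# + 1#) * q)) + μ * μ
        ≡⟨ solve 2 (λ μ q → μ :* μ :+ q :- (:1 :+ :1) :* μ :* (μ :* (:1 :- (:1 :+ :1) :* q)) :+ μ :* μ := q :+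
            (:1 :+ :1 :+ :1 :+ :1) :* q :* (μ :* μ)) refl μ q ⟩≤
      q + (1# + 1# + 1# + 1#) * q * (μ * μ)
        ≤⟨ +-mono-≤ ≤-refl (*-monoˡ-≤ ((1# + 1# + 1# + 1#) * q) (*-nonneg (fromℕ-nonneg 4) 0≤q) (proj₂ (unit-* μ-unit μ-unit))) ⟩
      q + (1# + 1# + 1# + 1#) * q * 1#
        ≡⟨ solve 1 (λ q → q :+ (:1 :+ :1 :+ :1 :+ :1) :* q :* :1 := (:1 :+ :1 :+ :1 :+ :1 :+ :1) :* q) refl q ⟩≤
      five * q □

    -- The difference is the average of H(S - μ), to which Cauchy-Schwarz with weight ν applies.
    -- Dividing by 2ν shows that ν should be of the order of the square root of `q`.
    chords-equidistributed : ∀ ν H → UnitValued H →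
      (1# + 1#) * ν * (𝔼 (λ d → 𝔼 (λ x → W d x * H (chord t d x))) - 𝔼 H * μ) ≤ ν * ν + five * q
    chords-equidistributed ν H uH =
      (1# + 1#) * ν * (𝔼 (λ d → 𝔼 (λ x → W d x * H (chord t d x))) - 𝔼 H * μ)
        ≡⟨ cong ((1# + 1#) * ν *_) (sym (trans (𝔼-cong (λ e → solve 3 (λ h s m → h :* (s :- m) := h :* s :- h :* m) refl (H e) (S e) μ))
             (trans (𝔼-- (λ e → H e * S e) (λ e → H e * μ)) (cong₂ _-_ (𝔼-*S H) (𝔼-*ʳ μ H))))) ⟩≤
      (1# + 1#) * ν * 𝔼 (λ e → H e * (S e - μ))
        ≤⟨ 𝔼-weightedCauchySchwarz ν H (λ e → S e - μ) ⟩
      ν * ν * 𝔼 (λ e → H e * H e) + 𝔼 (λ e → (S e - μ) * (S e - μ))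
        ≤⟨ +-mono-≤ (subst (ν * ν * 𝔼 (λ e → H e * H e) ≤_) (*-identityʳ (ν * ν))
            (*-monoˡ-≤ (ν * ν) (square-nonneg ν) (𝔼-≤1 (λ e → proj₂ (unit-* (uH e) (uH e)))))) S-variance ⟩
      ν * ν + five * q □

-- Independence of two convolutions along the hyperbola

module HyperbolaCorrelation (K : OrderedField) {p : ℕ} (positive-p : OrderedFieldProperties.Positive K (OrderedFieldProperties.fromℕ K p))
                            (F : FiniteField p) (t : Fin p) (t≢𝟘 : t ≢ FiniteField.𝟘 F) where
  open OrderedField K
  open OrderedFieldProperties K
  open IntegerCoefficients commutativeRing
  open Averages K p positive-p
  open FiniteField F hiding (isCommutativeRing)
  open FieldProperties F
  open FieldAverages K positive-p F
  open Equidistribution K positive-p F t t≢𝟘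

  autocorrelation : (G → Carrier) → G → Carrier
  autocorrelation θ d = 𝔼 (λ a → θ a * θ (a ⊕ d))

  autocorrelation-unit : ∀ {θ} → UnitValued θ → UnitValued (autocorrelation θ)
  autocorrelation-unit uθ d = 𝔼-unit (λ a → unit-* (uθ a) (uθ (a ⊕ d)))

  autocorrelation-difference : ∀ θ x y → 𝔼 (λ a → θ (x ⊝ a) * θ (y ⊝ a)) ≡ autocorrelation θ (y ⊝ x)
  autocorrelation-difference θ x y =
    trans (𝔼-cong (λ a → cong (λ z → θ (x ⊝ a) * θ z) (shifted a))) (𝔼-reflect x (λ a → θ a * θ (a ⊕ (y ⊝ x))))
    where
    shifted : ∀ a → y ⊝ a ≡ x ⊝ a ⊕ (y ⊝ x)
    shifted a = trans (cong (y ⊝_) (sym (⊝-involutive x a))) (x⊝[x⊝a] y x (x ⊝ a))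

  autocorrelation-mean : ∀ θ → 𝔼 (autocorrelation θ) ≡ 𝔼 θ * 𝔼 θ
  autocorrelation-mean θ =
    trans (𝔼-comm (λ d a → θ a * θ (a ⊕ d)))
    (trans (𝔼-cong (λ a → trans (𝔼-* (θ a) (λ d → θ (a ⊕ d))) (cong (θ a *_) (𝔼-⊕ a θ))))
    (𝔼-*ʳ (𝔼 θ) θ))

  𝔼-comm₂ : ∀ (f : G → G → G → Carrier) → 𝔼 (λ a → 𝔼 (λ b → 𝔼 (f a b))) ≡ 𝔼 (λ x → 𝔼 (λ a → 𝔼 (λ b → f a b x)))
  𝔼-comm₂ f = trans (𝔼-cong (λ a → 𝔼-comm (f a))) (𝔼-comm (λ a x → 𝔼 (λ b → f a b x)))

  𝔼₂-separate : ∀ c (f g : G → Carrier) → 𝔼 (λ a → 𝔼 (λ b → c * (f a * g b))) ≡ c * (𝔼 f * 𝔼 g)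
  𝔼₂-separate c f g =
    trans (𝔼-cong (λ a → 𝔼-* c (λ b → f a * g b)))
    (trans (𝔼-* c (λ a → 𝔼 (λ b → f a * g b))) (cong (c *_) (sym (𝔼-product f g))))

  module Translates (θ θ′ : G → Carrier) (uθ : UnitValued θ) (uθ′ : UnitValued θ′) where
    T T′ c : Carrier
    T  = 𝔼 θ
    T′ = 𝔼 θ′
    c  = T * T′

    c-unit : UnitInterval c
    c-unit = unit-* (𝔼-unit uθ) (𝔼-unit uθ′)

    C C′ : G → Carrier
    C  = autocorrelation θ
    C′ = autocorrelation θ′

    -- The correlation along the hyperbola of θ translated by a and θ′ translated by b. A single
    -- value can be anything; the aim is that most values are near c.
    M : G → G → Carrier
    M a b = 𝔼 (λ x → χ x * (θ (x ⊝ a) * θ′ (τ x ⊝ b)))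

    M-mean : 𝔼 (λ a → 𝔼 (M a)) ≡ (1# - q) * c
    M-mean =
      trans (𝔼-comm₂ (λ a b x → χ x * (θ (x ⊝ a) * θ′ (τ x ⊝ b))))
      (trans (𝔼-cong (λ x → trans (𝔼₂-separate (χ x) (λ a → θ (x ⊝ a)) (λ b → θ′ (τ x ⊝ b)))
        (cong (χ x *_) (cong₂ _*_ (𝔼-reflect x θ) (𝔼-reflect (τ x) θ′)))))
      (trans (𝔼-*ʳ c χ) (cong (_* c) 𝔼-χ)))

    -- For two points x and y = x + d of the hyperbola the averages over a and b separate. They
    -- leave the autocorrelation of θ at the width d and that of θ′ at the height of the chord, so
    -- the second moment is a count of chords.
    M-square : 𝔼 (λ a → 𝔼 (λ b → M a b * M a b)) ≡ 𝔼 (λ d → 𝔼 (λ x → N d x * (C d * C′ (chord t d x))))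
    M-square =
      trans (𝔼-cong (λ a → 𝔼-cong (λ b → 𝔼-product (m a b) (m a b))))
      (trans (𝔼-comm₂ (λ a b x → 𝔼 (λ y → m a b x * m a b y)))
      (trans (𝔼-cong (λ x → 𝔼-comm₂ (λ a b y → m a b x * m a b y)))
      (trans (𝔼-cong (λ x → trans (𝔼-cong (λ y → inner x y)) (sym (𝔼-⊕ x (λ y → χ x * χ y * (C (y ⊝ x) * C′ (τ y ⊝ τ x)))))))
      (trans (𝔼-comm (λ x d → χ x * χ (x ⊕ d) * (C (x ⊕ d ⊝ x) * C′ (τ (x ⊕ d) ⊝ τ x))))
      (𝔼-cong (λ d → 𝔼-cong (λ x → cong (λ z → N d x * (C z * C′ (chord t d x))) ([x⊕d]⊝x x d))))))))
      where
      m : G → G → G → Carrier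
      m a b x = χ x * (θ (x ⊝ a) * θ′ (τ x ⊝ b))
      inner : ∀ x y → 𝔼 (λ a → 𝔼 (λ b → m a b x * m a b y)) ≡ χ x * χ y * (C (y ⊝ x) * C′ (τ y ⊝ τ x))
      inner x y =
        trans (𝔼-cong (λ a → 𝔼-cong (λ b → solve 6 (λ e f g h i j
            → (e :* (f :* g)) :* (h :* (i :* j)) := e :* h :* ((f :* i) :* (g :* j))) refl
          (χ x) (θ (x ⊝ a)) (θ′ (τ x ⊝ b)) (χ y) (θ (y ⊝ a)) (θ′ (τ y ⊝ b)))))
        (trans (𝔼₂-separate (χ x * χ y) (λ a → θ (x ⊝ a) * θ (y ⊝ a)) (λ b → θ′ (τ x ⊝ b) * θ′ (τ y ⊝ b)))
        (cong (χ x * χ y *_) (cong₂ _*_ (autocorrelation-difference θ x y) (autocorrelation-difference θ′ (τ x) (τ y)))))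

    C-unit : UnitValued C
    C-unit = autocorrelation-unit uθ

    C′-unit : UnitValued C′
    C′-unit = autocorrelation-unit uθ′

    open ChordDistribution C C-unit using (W; μ; χC-unit; five; chords-equidistributed)

    Q : Carrier
    Q = 𝔼 (λ d → 𝔼 (λ x → W d x * C′ (chord t d x)))

    -- Passing to `W` drops the width 𝟘, which contributes at most `q`.
    M-square-≤ : 𝔼 (λ a → 𝔼 (λ b → M a b * M a b)) ≤ Q + q
    M-square-≤ =
      _ ≡⟨ M-square ⟩≤
      𝔼 (λ d → 𝔼 (λ x → N d x * (C d * C′ (chord t d x))))
        ≤⟨ 𝔼-mono (λ d → 𝔼-mono (λ x → pointwise d x)) ⟩
      𝔼 (λ d → 𝔼 (λ x → W d x * C′ (chord t d x) + ι (d ≟ 𝟘)))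
        ≡⟨ trans (𝔼-cong (λ d → trans (𝔼-+ (λ x → W d x * C′ (chord t d x)) (λ _ → ι (d ≟ 𝟘)))
            (cong (𝔼 (λ x → W d x * C′ (chord t d x)) +_) (𝔼-const (ι (d ≟ 𝟘))))))
             (trans (𝔼-+ (λ d → 𝔼 (λ x → W d x * C′ (chord t d x))) (λ d → ι (d ≟ 𝟘))) (cong (Q +_) (𝔼-ι-≟ 𝟘))) ⟩≤
      Q + q □
      where
      pointwise : ∀ d x → N d x * (C d * C′ (chord t d x)) ≤ W d x * C′ (chord t d x) + ι (d ≟ 𝟘)
      pointwise d x = ≤-by (ι (d ≟ 𝟘) * (1# - N d x * (C d * C′ (chord t d x))))
        (*-nonneg (proj₁ (ι-unit (d ≟ 𝟘))) (proj₁ (unit-1- (unit-* (N-unit d x) (unit-* (C-unit d) (C′-unit (chord t d x)))))))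
        (trans (cong (λ z → z * C d * N d x * C′ (chord t d x) + ι (d ≟ 𝟘)) (χ-𝟘 d))
          (solve 4 (λ i n u v → (:1 :- i) :* u :* n :* v :+ i := n :* (u :* v) :+ i :* (:1 :- n :* (u :* v))) refl (ι (d ≟ 𝟘)) (N d x)
              (C d) (C′ (chord t d x))))

    -- One `q` comes from the width 𝟘. The mean of M falls short of c by qc, and this adds 2qc² ≤ 2q
    -- through the cross term.
    M-variance : 𝔼 (λ a → 𝔼 (λ b → (M a b - c) * (M a b - c))) ≤ Q - c * c + (1# + 1# + 1#) * q
    M-variance =
      _ ≡⟨ trans (𝔼-cong (λ a → 𝔼-variance c (M a)))
           (trans (𝔼-+ (λ a → 𝔼 (λ b → M a b * M a b) - (1# + 1#) * c * 𝔼 (M a)) (λ _ → c * c))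
           (cong₂ _+_ (trans (𝔼-- (λ a → 𝔼 (λ b → M a b * M a b)) (λ a → (1# + 1#) * c * 𝔼 (M a)))
             (cong (λ z → 𝔼 (λ a → 𝔼 (λ b → M a b * M a b)) - z) (trans (𝔼-* ((1# + 1#) * c) (λ a → 𝔼 (M a)))
                 (cong ((1# + 1#) * c *_) M-mean)))) (𝔼-const (c * c)))) ⟩≤
      𝔼 (λ a → 𝔼 (λ b → M a b * M a b)) - (1# + 1#) * c * ((1# - q) * c) + c * c
        ≤⟨ +-mono-≤ (+-mono-≤ M-square-≤ ≤-refl) ≤-refl ⟩
      Q + q - (1# + 1#) * c * ((1# - q) * c) + c * c
        ≤⟨ ≤-by ((1# + 1#) * q * (1# - c * c)) (*-nonneg (*-nonneg (fromℕ-nonneg 2) 0≤q) (proj₁ (unit-1- (unit-* c-unit c-unit))))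
             (solve 3 (λ Q q c → Q :- c :* c :+ (:1 :+ :1 :+ :1) :* q := Q :+ q :- (:1 :+ :1) :* c :* ((:1 :- q) :* c) :+ c :* c :+
                 (:1 :+ :1) :* q :* (:1 :- c :* c)) refl Q q c) ⟩
      Q - c * c + (1# + 1# + 1#) * q □

    -- The mean of an autocorrelation is the square of the mean, so the main term of the second
    -- moment does not exceed c² and the variance is all error.
    𝔼C′*μ≤c² : 𝔼 C′ * μ ≤ c * c
    𝔼C′*μ≤c² =
      𝔼 C′ * μ                 ≤⟨ *-monoˡ-≤ (𝔼 C′) (proj₁ (𝔼-unit C′-unit))
          (𝔼-mono (λ d → subst (χ d * C d ≤_) (*-identityˡ (C d))
            (*-mono-≤ (proj₁ (χ-unit d)) (proj₁ (C-unit d)) (proj₂ (χ-unit d)) ≤-refl))) ⟩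
      𝔼 C′ * 𝔼 C               ≡⟨ cong₂ _*_ (autocorrelation-mean θ′) (autocorrelation-mean θ) ⟩≤
      (T′ * T′) * (T * T)      ≡⟨ solve 2 (λ u v → (v :* v) :* (u :* u) := (u :* v) :* (u :* v)) refl T T′ ⟩≤
      c * c □

    -- 5 from `chords-equidistributed` and 2·3 from `M-variance`.
    eleven : Carrier
    eleven = fromℕ 11

    -- Equidistribution of the heights with weight ε, tested against the autocorrelation `C′`; the
    -- factor 2ε is then cancelled.
    M-concentrated : ∀ {ε} → Positive ε → UnitInterval ε → eleven * q ≤ ε * ε → 𝔼 (λ a → 𝔼 (λ b → (M a b - c) * (M a b - c))) ≤ ε
    M-concentrated {ε} pos (0≤ε , ε≤1) small = *-cancelˡ-≤ (positive-* (positive-suc 1) pos) (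
      (1# + 1#) * ε * _
        ≤⟨ *-monoˡ-≤ ((1# + 1#) * ε) 0≤2ε M-variance ⟩
      (1# + 1#) * ε * (Q - c * c + (1# + 1# + 1#) * q)
        ≤⟨ *-monoˡ-≤ ((1# + 1#) * ε) 0≤2ε (+-mono-≤ (+-mono-≤ ≤-refl (neg-mono-≤ 𝔼C′*μ≤c²)) ≤-refl) ⟩
      (1# + 1#) * ε * (Q - 𝔼 C′ * μ + (1# + 1# + 1#) * q)
        ≡⟨ solve 3 (λ ε z q → (:1 :+ :1) :* ε :* (z :+ (:1 :+ :1 :+ :1) :* q) := (:1 :+ :1) :* ε :* z :+ con (ℤ.+ 6) :* q :* ε) refl ε
            (Q - 𝔼 C′ * μ) q ⟩≤
      (1# + 1#) * ε * (Q - 𝔼 C′ * μ) + fromℕ 6 * q * ε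
        ≤⟨ +-mono-≤ (chords-equidistributed ε C′ C′-unit) (*-monoˡ-≤ (fromℕ 6 * q) (*-nonneg (fromℕ-nonneg 6) 0≤q) ε≤1) ⟩
      ε * ε + five * q + fromℕ 6 * q * 1#
        ≡⟨ solve 2 (λ e q → e :+ (:1 :+ :1 :+ :1 :+ :1 :+ :1) :* q :+ con (ℤ.+ 6) :* q :* :1 := e :+ con (ℤ.+ 11) :* q) refl (ε * ε) q ⟩≤
      ε * ε + eleven * q
        ≤⟨ +-mono-≤ ≤-refl small ⟩
      ε * ε + ε * ε
        ≡⟨ solve 1 (λ ε → ε :* ε :+ ε :* ε := (:1 :+ :1) :* ε :* ε) refl ε ⟩≤
      (1# + 1#) * ε * ε □)
      where
      0≤2ε : 0# ≤ (1# + 1#) * ε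
      0≤2ε = *-nonneg (fromℕ-nonneg 2) 0≤ε

    -- A convolution with θ is a φ-weighted average of translates of θ, so that only the values of M
    -- are involved.
    conv-correlation : ∀ φ φ′ → 𝔼 (λ x → χ x * (conv φ θ x * conv φ′ θ′ (τ x))) ≡ 𝔼 (λ a → 𝔼 (λ b → φ a * φ′ b * M a b))
    conv-correlation φ φ′ =
      trans (𝔼-cong (λ x → trans (cong (χ x *_) (𝔼-product (λ a → φ a * θ (x ⊝ a)) (λ b → φ′ b * θ′ (τ x ⊝ b))))
        (trans (sym (𝔼-* (χ x) _)) (𝔼-cong (λ a → trans (sym (𝔼-* (χ x) _)) (𝔼-cong (λ b →
          solve 5 (λ k f g h i → k :* ((f :* g) :* (h :* i)) := f :* h :* (k :* (g :* i))) refl (χ x) (φ a) (θ (x ⊝ a)) (φ′ b)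
              (θ′ (τ x ⊝ b)))))))))
      (trans (sym (𝔼-comm₂ (λ a b x → φ a * φ′ b * (χ x * (θ (x ⊝ a) * θ′ (τ x ⊝ b))))))
      (𝔼-cong (λ a → 𝔼-cong (λ b → 𝔼-* (φ a * φ′ b) (λ x → χ x * (θ (x ⊝ a) * θ′ (τ x ⊝ b)))))))

    -- M is replaced by c through 2νF(M - c) ≤ ν² + (M - c)² for F = φ(a)φ′(b), with variance at
    -- most ν². Each of the two uses of the second moment method takes a square root, hence ν⁴ in
    -- the assumption.
    correlation-bound : ∀ {ν φ φ′} → Positive ν → UnitInterval ν → eleven * q ≤ (ν * ν) * (ν * ν) → UnitValued φ → UnitValued φ′ →
      𝔼 (λ x → χ x * (conv φ θ x * conv φ′ θ′ (τ x))) ≤ 𝔼 φ * 𝔼 φ′ * c + ν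
    correlation-bound {ν} {φ} {φ′} pos uν small uφ uφ′ = *-cancelˡ-≤ (positive-* (positive-suc 1) pos) (
      (1# + 1#) * ν * _
        ≡⟨ cong ((1# + 1#) * ν *_) (conv-correlation φ φ′) ⟩≤
      (1# + 1#) * ν * 𝔼 (λ a → 𝔼 (λ b → φ a * φ′ b * M a b))
        ≡⟨ trans (sym (𝔼-* ((1# + 1#) * ν) _)) (𝔼-cong (λ a → sym (𝔼-* ((1# + 1#) * ν) _))) ⟩≤
      𝔼 (λ a → 𝔼 (λ b → (1# + 1#) * ν * (φ a * φ′ b * M a b)))
        ≤⟨ 𝔼-mono (λ a → 𝔼-mono (λ b → pointwise a b)) ⟩
      𝔼 (λ a → 𝔼 (λ b → ν * ν + (1# + 1#) * ν * c * (φ a * φ′ b) + (M a b - c) * (M a b - c)))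
        ≡⟨ trans (𝔼-cong (λ a → trans (𝔼-+ (λ b → ν * ν + (1# + 1#) * ν * c * (φ a * φ′ b)) (λ b → (M a b - c) * (M a b - c)))
               (cong (_+ 𝔼 (λ b → (M a b - c) * (M a b - c))) (trans (𝔼-+ (λ _ → ν * ν) (λ b → (1# + 1#) * ν * c * (φ a * φ′ b)))
                   (cong (_+ 𝔼 (λ b → (1# + 1#) * ν * c * (φ a * φ′ b))) (𝔼-const (ν * ν)))))))
             (trans (𝔼-+ (λ a → ν * ν + 𝔼 (λ b → (1# + 1#) * ν * c * (φ a * φ′ b))) (λ a → 𝔼 (λ b → (M a b - c) * (M a b - c))))
               (cong (_+ 𝔼 (λ a → 𝔼 (λ b → (M a b - c) * (M a b - c))))
                   (trans (𝔼-+ (λ _ → ν * ν) (λ a → 𝔼 (λ b → (1# + 1#) * ν * c * (φ a * φ′ b))))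
                 (cong₂ _+_ (𝔼-const (ν * ν)) (𝔼₂-separate ((1# + 1#) * ν * c) φ φ′))))) ⟩≤
      ν * ν + (1# + 1#) * ν * c * (𝔼 φ * 𝔼 φ′) + 𝔼 (λ a → 𝔼 (λ b → (M a b - c) * (M a b - c)))
        ≤⟨ +-mono-≤ ≤-refl (M-concentrated (positive-* pos pos) (unit-* uν uν) small) ⟩
      ν * ν + (1# + 1#) * ν * c * (𝔼 φ * 𝔼 φ′) + ν * ν
        ≡⟨ solve 3 (λ ν c f → ν :* ν :+ (:1 :+ :1) :* ν :* c :* f :+ ν :* ν := (:1 :+ :1) :* ν :* (f :* c :+ ν)) refl ν c (𝔼 φ * 𝔼 φ′) ⟩≤
      (1# + 1#) * ν * (𝔼 φ * 𝔼 φ′ * c + ν) □)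
      where
      pointwise : ∀ a b → (1# + 1#) * ν * (φ a * φ′ b * M a b) ≤ ν * ν + (1# + 1#) * ν * c * (φ a * φ′ b) + (M a b - c) * (M a b - c)
      pointwise a b = ≤-by ((ν * f - (M a b - c)) * (ν * f - (M a b - c)) + ν * ν * (1# - f * f))
        (+-nonneg (square-nonneg _) (*-nonneg (square-nonneg ν) (proj₁ (unit-1- (unit-* uf uf)))))
        (solve 4 (λ ν f m c → ν :* ν :+ (:1 :+ :1) :* ν :* c :* f :+ (m :- c) :* (m :- c) :=
           (:1 :+ :1) :* ν :* (f :* m) :+ ((ν :* f :- (m :- c)) :* (ν :* f :- (m :- c)) :+ ν :* ν :* (:1 :- f :* f))) refl ν f (M a b) c)
        where
        f : Carrier
        f = φ a * φ′ b
        uf : UnitInterval f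
        uf = unit-* (uφ a) (uφ′ b)

-- From convolutions to their powers

module PowersOfConvolutions (K : OrderedField) {p : ℕ} (positive-p : OrderedFieldProperties.Positive K (OrderedFieldProperties.fromℕ K p))
                            (F : FiniteField p) (t : Fin p) (t≢𝟘 : t ≢ FiniteField.𝟘 F) where
  open OrderedField K
  open OrderedFieldProperties K
  open IntegerCoefficients commutativeRing
  open Averages K p positive-p
  open FiniteField F hiding (isCommutativeRing)
  open FieldProperties F
  open FieldAverages K positive-p F
  open Equidistribution K positive-p F t t≢𝟘
  open HyperbolaCorrelation K positive-p F t t≢𝟘

  -- The bound has to hold for all unit-valued φ and θ at once: only so is it inherited when g is
  -- multiplied by a convolution.
  ConvolutionBound : (G → Carrier) → Carrier → Set
  ConvolutionBound g ε = ∀ φ θ → UnitValued φ → UnitValued θ → 𝔼 (λ x → conv φ θ x * g x) ≤ ε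

  -- The constant 1 is its own convolution square.
  convolutionBound-mean : ∀ {g ε} → ConvolutionBound g ε → 𝔼 g ≤ ε
  convolutionBound-mean {g} {ε} bound = ≤-trans (≤-reflexive (𝔼-cong (λ x
      → sym (trans (cong (_* g x) (trans (𝔼-cong (λ a → *-identityʳ 1#)) (𝔼-const 1#))) (*-identityˡ (g x))))))
    (bound (λ _ → 1#) (λ _ → 1#) (λ _ → unit-1) (λ _ → unit-1))

  -- Substitute b = a + s in the double average over a and b.
  conv-*-conv : ∀ φ θ f h x → conv φ θ x * conv f h x ≡ 𝔼 (λ s → conv (λ a → φ a * f (a ⊕ s)) (λ b → θ b * h (b ⊝ s)) x)
  conv-*-conv φ θ f h x =
    trans (𝔼-product (λ a → φ a * θ (x ⊝ a)) (λ b → f b * h (x ⊝ b)))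
    (trans (𝔼-cong (λ a → trans (sym (𝔼-⊕ a (λ b → φ a * θ (x ⊝ a) * (f b * h (x ⊝ b))))) (𝔼-cong (λ s → regroup a s))))
    (𝔼-comm (λ a s → φ a * f (a ⊕ s) * (θ (x ⊝ a) * h (x ⊝ a ⊝ s)))))
    where
    regroup : ∀ a s → φ a * θ (x ⊝ a) * (f (a ⊕ s) * h (x ⊝ (a ⊕ s))) ≡ φ a * f (a ⊕ s) * (θ (x ⊝ a) * h (x ⊝ a ⊝ s))
    regroup a s = trans (cong (λ z → φ a * θ (x ⊝ a) * (f (a ⊕ s) * h z)) (x⊝[a⊕s] x a s))
      (solve 4 (λ u v w z → u :* v :* (w :* z) := u :* w :* (v :* z)) refl (φ a) (θ (x ⊝ a)) (f (a ⊕ s)) (h (x ⊝ a ⊝ s)))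

  -- The test convolution times `conv f h` is an average of convolutions of unit-valued functions,
  -- and the bound for g applies to each of them.
  convolutionBound-* : ∀ {g ε κ f h} → 0# ≤ κ → UnitValued f → UnitValued h → ConvolutionBound g ε →
    ConvolutionBound (λ x → κ * conv f h x * g x) (κ * ε)
  convolutionBound-* {g} {ε} {κ} {f} {h} 0≤κ uf uh bound φ θ uφ uθ =
    𝔼 (λ x → conv φ θ x * (κ * conv f h x * g x))
      ≡⟨ trans (𝔼-cong (λ x → solve 4 (λ a k b g → a :* (k :* b :* g) := k :* (a :* b :* g)) refl (conv φ θ x) κ (conv f h x) (g x)))
           (trans (𝔼-* κ (λ x → conv φ θ x * conv f h x * g x)) (cong (κ *_)
               (trans (𝔼-cong (λ x → trans (cong (_* g x) (conv-*-conv φ θ f h x)) (sym (𝔼-*ʳ (g x) (λ s → conv (φₛ s) (θₛ s) x)))))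
             (𝔼-comm (λ x s → conv (φₛ s) (θₛ s) x * g x))))) ⟩≤
    κ * 𝔼 (λ s → 𝔼 (λ x → conv (φₛ s) (θₛ s) x * g x))
      ≤⟨ *-monoˡ-≤ κ 0≤κ (𝔼-mono (λ s → bound (φₛ s) (θₛ s) (λ a → unit-* (uφ a) (uf (a ⊕ s))) (λ b → unit-* (uθ b) (uh (b ⊝ s))))) ⟩
    κ * 𝔼 (λ s → ε)
      ≡⟨ cong (κ *_) (𝔼-const ε) ⟩≤
    κ * ε □
    where
    φₛ θₛ : G → G → Carrier
    φₛ s a = φ a * f (a ⊕ s)
    θₛ s b = θ b * h (b ⊝ s)

  convolutionBound-^ : ∀ {g ε κ f h} k → 0# ≤ κ → UnitValued f → UnitValued h → ConvolutionBound g ε →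
    ConvolutionBound (λ x → (κ * conv f h x) ^ k * g x) (κ ^ k * ε)
  convolutionBound-^ {g} {ε} zero 0≤κ uf uh bound φ θ uφ uθ =
    subst₂ _≤_ (𝔼-cong (λ x → cong (conv φ θ x *_) (sym (*-identityˡ (g x))))) (sym (*-identityˡ ε)) (bound φ θ uφ uθ)
  convolutionBound-^ {g} {ε} {κ} {f} {h} (suc k) 0≤κ uf uh bound φ θ uφ uθ =
    subst₂ _≤_ (𝔼-cong (λ x → cong (conv φ θ x *_) (sym (*-assoc (κ * conv f h x) ((κ * conv f h x) ^ k) (g x)))))
        (sym (*-assoc κ (κ ^ k) ε))
      (convolutionBound-* 0≤κ uf uh (convolutionBound-^ k 0≤κ uf uh bound) φ θ uφ uθ)

  -- The substitution of t/x for x moves `τ` from one factor to the other.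
  χ-reflection : ∀ (f g : G → Carrier) → 𝔼 (λ x → χ x * (f x * g (τ x))) ≡ 𝔼 (λ x → χ x * (f (τ x) * g x))
  χ-reflection f g =
    trans (sym (𝔼-permute (λ x → χ x * (f x * g (τ x))) τ τ (reflection-involutive t≢𝟘) (reflection-involutive t≢𝟘)))
    (𝔼-cong (λ x → cong₂ (λ u v → u * (f (τ x) * g v))
      (ι-cong (¬? (τ x ≟ 𝟘)) (¬? (x ≟ 𝟘)) (λ τx≢𝟘 e → τx≢𝟘 (trans (cong τ e) (trans (cong (t ⊗_) inv-𝟘) (R.zeroʳ t))))
          (reflection-nonzero t≢𝟘)) (reflection-involutive t≢𝟘 x)))
    where module R = CommutativeRing fieldRing

  -- Puts the failure of independence into the form of a correlation of f with one function, to
  -- which `ConvolutionBound` can be applied.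
  deviation : ∀ (f g : G → Carrier) → 𝔼 (λ x → f x * (χ x * g (τ x) - 𝔼 g)) ≡ 𝔼 (λ x → χ x * (f x * g (τ x))) - 𝔼 f * 𝔼 g
  deviation f g =
    trans (𝔼-cong (λ x → solve 4 (λ f c g m → f :* (c :* g :- m) := c :* (f :* g) :- f :* m) refl (f x) (χ x) (g (τ x)) (𝔼 g)))
    (trans (𝔼-- (λ x → χ x * (f x * g (τ x))) (λ x → f x * 𝔼 g)) (cong (λ z → 𝔼 (λ x → χ x * (f x * g (τ x))) - z) (𝔼-*ʳ (𝔼 g) f)))

  x≤y+ε⇒x-y≤ε : ∀ {x y ε} → x ≤ y + ε → x - y ≤ ε
  x≤y+ε⇒x-y≤ε {x} {y} {ε} x≤y+ε = ≤-by (y + ε - x) (x≤y⇒0≤y-x x≤y+ε) (solve 3 (λ x y e → e := x :- y :+ (y :+ e :- x)) refl x y ε)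

  x-y≤ε⇒x≤y+ε : ∀ {x y ε} → x - y ≤ ε → x ≤ y + ε
  x-y≤ε⇒x≤y+ε {x} {y} {ε} p = ≤-by (ε - (x - y)) (x≤y⇒0≤y-x p) (solve 3 (λ x y e → y :+ e := x :+ (e :- (x :- y))) refl x y ε)

  -- The factors are promoted to powers one after the other, and each promotion multiplies the error
  -- by the power of the corresponding constant.
  powers-correlation : ∀ {ν κ f h κ′ f′ h′} k l → Positive ν → UnitInterval ν → fromℕ 11 * q ≤ (ν * ν) * (ν * ν) →
    0# ≤ κ → UnitValued f → UnitValued h → 0# ≤ κ′ → UnitValued f′ → UnitValued h′ →
    𝔼 (λ x → χ x * ((κ′ * conv f′ h′ x) ^ l * (κ * conv f h (τ x)) ^ k))
      ≤ 𝔼 (λ x → (κ′ * conv f′ h′ x) ^ l) * 𝔼 (λ x → (κ * conv f h x) ^ k) + κ′ ^ l * (κ ^ k * ν)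
  powers-correlation {ν} {κ} {f} {h} {κ′} {f′} {h′} k l pos uν small 0≤κ uf uh 0≤κ′ uf′ uh′ =
    x-y≤ε⇒x≤y+ε (subst (_≤ κ′ ^ l * (κ ^ k * ν)) (deviation w v) (convolutionBound-mean (convolutionBound-^ l 0≤κ′ uf′ uh′ second)))
    where
    v w : G → Carrier
    v x = (κ * conv f h x) ^ k
    w x = (κ′ * conv f′ h′ x) ^ l
    -- Both factors are still convolutions, and the product of the means is that of the four
    -- functions in `correlation-bound`.
    first : ∀ φ θ → UnitValued φ → UnitValued θ → ConvolutionBound (λ y → χ y * conv φ θ (τ y) - 𝔼 (conv φ θ)) ν
    first φ θ uφ uθ φ′ θ′ uφ′ uθ′ = subst (_≤ ν) (sym (deviation (conv φ′ θ′) (conv φ θ))) (x≤y+ε⇒x-y≤ε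
      (subst (λ z → 𝔼 (λ x → χ x * (conv φ′ θ′ x * conv φ θ (τ x))) ≤ z + ν)
        (trans (solve 4 (λ a b c d → a :* b :* (c :* d) := (a :* c) :* (b :* d)) refl (𝔼 φ′) (𝔼 φ) (𝔼 θ′) (𝔼 θ))
            (sym (cong₂ _*_ (conv-mean φ′ θ′) (conv-mean φ θ))))
        (Translates.correlation-bound θ′ θ uθ′ uθ pos uν small uφ′ uφ)))
    -- `first` multiplied by the convolutions in v, with `χ-reflection` exchanging the roles: v now
    -- stands on the side of `τ`, against an arbitrary convolution.
    second : ConvolutionBound (λ x → χ x * v (τ x) - 𝔼 v) (κ ^ k * ν)
    second φ θ uφ uθ = subst (_≤ κ ^ k * ν)
      (trans (deviation v (conv φ θ)) (trans (cong₂ _-_ (trans (𝔼-cong (λ x → cong (χ x *_) (*-comm (v x) _)))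
          (sym (χ-reflection (conv φ θ) v))) (*-comm (𝔼 v) (𝔼 (conv φ θ)))) (sym (deviation (conv φ θ) v))))
      (convolutionBound-mean (convolutionBound-^ k 0≤κ uf uh (first φ θ uφ uθ)))

-- Counting members of finite sets

module Counting where
  open Algebra.Properties.Semiring.Sum ℕ.+-*-semiring

  bit : Bool → ℕ
  bit b = if b then 1 else 0

  count : ∀ {m} → (Fin m → Bool) → ℕ
  count X = sum (λ x → bit (X x))

  count-cong : ∀ {m} {X Y : Fin m → Bool} → (∀ x → X x ≡ Y x) → count X ≡ count Y
  count-cong X≗Y = sum-cong-≗ (λ x → cong bit (X≗Y x))

  count-split : ∀ {m} (X Y : Fin m → Bool) → count X ≡ count (λ x → X x ∧ Y x) ℕ.+ count (λ x → X x ∧ not (Y x))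
  count-split X Y = trans (sum-cong-≗ (λ x → split (X x) (Y x))) (∑-distrib-+ (λ x → bit (X x ∧ Y x)) (λ x → bit (X x ∧ not (Y x))))
    where
    split : ∀ a b → bit a ≡ bit (a ∧ b) ℕ.+ bit (a ∧ not b)
    split true  true  = refl
    split true  false = refl
    split false b     = refl

  count-all : ∀ m → count {m} (λ _ → true) ≡ m
  count-all zero    = refl
  count-all (suc m) = cong suc (count-all m)

  count-permute : ∀ {m} (X : Fin m → Bool) (σ τ : Fin m → Fin m) → (∀ x → σ (τ x) ≡ x) → (∀ x → τ (σ x) ≡ x)
      → count (λ x → X (σ x)) ≡ count X
  count-permute X σ τ στ τσ = sym (sum-permute (λ x → bit (X x)) (permutation σ τ στ τσ))

  count-nonempty : ∀ {m} (X : Fin m → Bool) → 0 ℕ.< count X → ∃ λ x → X x ≡ true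
  count-nonempty {suc m} X 0<X with X zero in X0
  ... | true  = zero , X0
  ... | false = let (x , Xx) = count-nonempty (λ x → X (suc x)) 0<X in suc x , Xx

  member⇒count-positive : ∀ {m} (X : Fin m → Bool) x → X x ≡ true → 0 ℕ.< count X
  member⇒count-positive X zero    Xx rewrite Xx = s≤s z≤n
  member⇒count-positive X (suc x) Xx = ℕ.m≤n⇒m≤o+n (bit (X zero)) (member⇒count-positive (λ x → X (suc x)) x Xx)

  count-twoMembers : ∀ {m} (X : Fin m → Bool) → 1 ℕ.< count X → ∃ λ x → ∃ λ y → x ≢ y × X x ≡ true × X y ≡ true
  count-twoMembers {suc m} X 1<X with X zero in X0
  ... | true  = let (y , Xy) = count-nonempty (λ x → X (suc x)) (ℕ.≤-pred 1<X) in zero , suc y , (λ ()) , X0 , Xy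
  ... | false = let (x , y , x≢y , Xx , Xy) = count-twoMembers (λ x → X (suc x)) 1<X in
                suc x , suc y , (λ e → x≢y (suc-injective e)) , Xx , Xy

  count-missing : ∀ {m} (X : Fin m → Bool) → count X ℕ.< m → ∃ λ x → X x ≡ false
  count-missing {m} X X<m = let (x , e) = count-nonempty (λ x → not (X x)) positive in x , not-true e
    where
    total : m ≡ count X ℕ.+ count (λ x → not (X x))
    total = trans (sym (count-all m)) (count-split (λ _ → true) X)
    positive : 0 ℕ.< count (λ x → not (X x))
    positive = ℕ.+-cancelˡ-< (count X) 0 _ (subst₂ ℕ._<_ (sym (ℕ.+-identityʳ (count X))) total X<m)
    not-true : ∀ {b} → not b ≡ true → b ≡ false
    not-true {false} _ = refl

-- Pollard's theorem

module Pollard (K : OrderedField) {p : ℕ} (positive-p : OrderedFieldProperties.Positive K (OrderedFieldProperties.fromℕ K p)) (F : FiniteField p) where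
  open OrderedField K
  open OrderedFieldProperties K
  open IntegerCoefficients commutativeRing
  open Averages K p positive-p
  open FiniteField F hiding (isCommutativeRing)
  open FieldProperties F
  open FieldAverages K positive-p F
  open Counting

  𝟏 : Bool → Carrier
  𝟏 true  = 1#
  𝟏 false = 0#

  𝟏-unit : ∀ b → UnitInterval (𝟏 b)
  𝟏-unit true  = unit-1
  𝟏-unit false = unit-0

  ind : (G → Bool) → G → Carrier
  ind X x = 𝟏 (X x)

  fromℕ-count : ∀ {m} (X : Fin m → Bool) → fromℕ (count X) ≡ Algebra.Properties.Semiring.Sum.sum semiring (λ x → 𝟏 (X x))
  fromℕ-count {zero} X = refl
  fromℕ-count {suc m} X = trans (fromℕ-+ (bit (X zero)) _) (cong₂ _+_ (fromℕ-bit (X zero)) (fromℕ-count (λ x → X (suc x))))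
    where
    fromℕ-bit : ∀ b → fromℕ (bit b) ≡ 𝟏 b
    fromℕ-bit true  = refl
    fromℕ-bit false = refl

  density : ℕ → Carrier
  density m = q * fromℕ m

  density-+ : ∀ m k → density (m ℕ.+ k) ≡ density m + density k
  density-+ m k = trans (cong (q *_) (fromℕ-+ m k)) (distribˡ q _ _)

  density-mono : ∀ {m k} → m ℕ.≤ k → density m ≤ density k
  density-mono m≤k = *-monoˡ-≤ q 0≤q (fromℕ-mono m≤k)

  density-p : density p ≡ 1#
  density-p = trans (*-comm q P) P*q≡1

  𝔼-ind : ∀ X → 𝔼 (ind X) ≡ density (count X)
  𝔼-ind X = sym (trans (cong (q *_) (trans (fromℕ-count X) (sym (P*𝔼 (ind X)))))
    (trans (solve 3 (λ q P e → q :* (P :* e) := (P :* q) :* e) refl q P (𝔼 (ind X))) (trans (cong (_* 𝔼 (ind X)) P*q≡1) (*-identityˡ _))))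

  conv-comm : ∀ φ θ x → conv φ θ x ≡ conv θ φ x
  conv-comm φ θ x = trans (sym (𝔼-reflect x (λ a → φ a * θ (x ⊝ a))))
    (𝔼-cong (λ a → trans (cong (λ z → φ (x ⊝ a) * θ z) (⊝-involutive x a)) (*-comm _ _)))

  conv-+ˡ : ∀ (f g θ : G → Carrier) x → conv (λ y → f y + g y) θ x ≡ conv f θ x + conv g θ x
  conv-+ˡ f g θ x = trans (𝔼-cong (λ a → distribʳ (θ (x ⊝ a)) (f a) (g a))) (𝔼-+ (λ a → f a * θ (x ⊝ a)) (λ a → g a * θ (x ⊝ a)))

  conv-congˡ : ∀ {f g : G → Carrier} θ x → (∀ y → f y ≡ g y) → conv f θ x ≡ conv g θ x
  conv-congˡ θ x f≗g = 𝔼-cong (λ a → cong (_* θ (x ⊝ a)) (f≗g a))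

  conv-nonneg : ∀ {f g} → UnitValued f → UnitValued g → ∀ x → 0# ≤ conv f g x
  conv-nonneg uf ug x = 𝔼-nonneg (λ a → proj₁ (unit-* (uf a) (ug (x ⊝ a))))

  -- The identity behind the Dyson transform, with U = f + g + i and I = i.
  conv-dyson : ∀ (f g i : G → Carrier) x →
    conv (λ y → f y + i y) (λ y → g y + i y) x ≡ conv (λ y → f y + (i y + g y)) i x + conv f g x
  conv-dyson f g i x =
    trans (conv-+ˡ f i (λ y → g y + i y) x)
    (trans (cong₂ _+_ (right f) (right i))
    (trans (cong (λ z → conv f g x + conv f i x + (z + conv i i x)) (conv-comm i g x))
    (trans (solve 4 (λ fg fi gi ii → fg :+ fi :+ (gi :+ ii) := fi :+ (ii :+ gi) :+ fg) refl (conv f g x) (conv f i x) (conv g i x)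
        (conv i i x))
    (sym (cong (_+ conv f g x) (trans (conv-+ˡ f (λ y → i y + g y) i x) (cong (conv f i x +_) (conv-+ˡ i g i x))))))))
    where
    right : ∀ h → conv h (λ y → g y + i y) x ≡ conv h g x + conv h i x
    right h = trans (conv-comm h (λ y → g y + i y) x) (trans (conv-+ˡ g i h x) (cong₂ _+_ (conv-comm g h x) (conv-comm i h x)))

  module _ where
    private module R = CommutativeRing fieldRing
    open Algebra.Properties.Semiring.Mult R.semiring using (×-assoc-*)

    multiple : ∀ {d} → d ≢ 𝟘 → ∀ x → ∃ λ k → x ≡ k · d
    multiple {d} d≢𝟘 x = let (k , e) = cyclic (inv d ⊗ x) in k ,
      trans (sym (R.*-identityˡ x)) (trans (cong (_⊗ x) (sym (⊗-inv d≢𝟘))) (trans (R.*-assoc d (inv d) x) (trans (cong (d ⊗_) e)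
      (trans (R.*-comm d (k · 𝟙)) (trans (×-assoc-* k 𝟙 d) (cong (k ·_) (R.*-identityˡ d)))))))

    exit : ∀ (X : G → Bool) d k x → X x ≡ true → X (x ⊕ k · d) ≡ false → ∃ λ a → X a ≡ true × X (a ⊕ d) ≡ false
    exit X d zero x Xx Xy = contradiction (trans (sym Xx) (trans (cong X (sym (R.+-identityʳ x))) Xy)) (λ ())
    exit X d (suc k) x Xx Xy with X (x ⊕ d) in Xd
    ... | false = x , Xx , Xd
    ... | true  = exit X d k (x ⊕ d) Xd (trans (cong X (R.+-assoc x d (k · d))) Xy)

    -- Since d generates the additive group, steps of length d lead from x to y, and one of them
    -- leaves X.
    boundary : ∀ (X : G → Bool) {d x y} → d ≢ 𝟘 → X x ≡ true → X y ≡ false → ∃ λ a → X a ≡ true × X (a ⊕ d) ≡ false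
    boundary X {d} {x} {y} d≢𝟘 Xx Xy = let (k , e) = multiple d≢𝟘 (y ⊝ x) in
      exit X d k x Xx (trans (cong X (trans (cong (x ⊕_) (sym e)) (trans (R.+-comm x (y ⊝ x)) (⊝-⊕ y x)))) Xy)

  -- Pollard bounds the average of min(r, d) from below by d(x + y - d), where r is the convolution,
  -- d the density of m, and x, y those of X, Y. As min(r, d) is the least value of vr + (1 - v)d
  -- over weights v, this is the same inequality, linear in v.
  PollardBound : (X Y : G → Bool) (v : G → Carrier) (m : ℕ) → Set
  PollardBound X Y v m = density m * (𝔼 (ind X) + 𝔼 (ind Y) + 𝔼 v) ≤ 𝔼 (λ z → v z * conv (ind X) (ind Y) z) +
      (density m * density m + density m)

  -- No r(z) exceeds the density y of Y, so the truncation at this level has no effect. The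
  -- inequality is the average of (1 - v)(y - r) ≥ 0.
  pollard-saturated : ∀ X Y v → UnitValued v → PollardBound X Y v (count Y)
  pollard-saturated X Y v uv = subst (λ y → y * (𝔼 (ind X) + 𝔼 (ind Y) + 𝔼 v) ≤ 𝔼 (λ z → v z * r z) + (y * y + y)) (𝔼-ind Y)
    (≤-by (𝔼 (λ z → (1# - v z) * (y - r z)))
      (𝔼-nonneg (λ z → *-nonneg (proj₁ (unit-1- (uv z))) (x≤y⇒0≤y-x (r≤y z))))
      (sym (trans (cong (y * (𝔼 (ind X) + y + 𝔼 v) +_) expand)
        (solve 4 (λ y x v w → y :* (x :+ y :+ v) :+ (y :- x :* y :- y :* v :+ w) := w :+ (y :* y :+ y)) refl y (𝔼 (ind X)) (𝔼 v)
            (𝔼 (λ z → v z * r z))))))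
    where
    y : Carrier
    y = 𝔼 (ind Y)
    r : G → Carrier
    r = conv (ind X) (ind Y)
    r≤y : ∀ z → r z ≤ y
    r≤y z = ≤-trans (𝔼-mono (λ a → subst (ind X a * ind Y (z ⊝ a) ≤_) (*-identityˡ _)
      (*-mono-≤ (proj₁ (𝟏-unit (X a))) (proj₁ (𝟏-unit (Y (z ⊝ a)))) (proj₂ (𝟏-unit (X a))) ≤-refl))) (≤-reflexive (𝔼-reflect z (ind Y)))
    expand : 𝔼 (λ z → (1# - v z) * (y - r z)) ≡ y - 𝔼 (ind X) * y - y * 𝔼 v + 𝔼 (λ z → v z * r z)
    expand =
      trans (𝔼-cong (λ z → solve 3 (λ v y r → (:1 :- v) :* (y :- r) := y :- r :- y :* v :+ v :* r) refl (v z) y (r z)))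
      (trans (𝔼-+ (λ z → y - r z - y * v z) (λ z → v z * r z)) (cong (_+ 𝔼 (λ z → v z * r z))
      (trans (𝔼-- (λ z → y - r z) (λ z → y * v z)) (cong₂ _-_ (trans (𝔼-- (λ _ → y) r)
          (cong₂ _-_ (𝔼-const y) (conv-mean (ind X) (ind Y)))) (𝔼-* y v)))))

  pollard-zero : ∀ X Y v → UnitValued v → PollardBound X Y v 0
  pollard-zero X Y v uv = subst₂ _≤_
    (sym (solve 2 (λ q s → q :* :0 :* s := :0) refl q (𝔼 (ind X) + 𝔼 (ind Y) + 𝔼 v)))
    (sym (solve 2 (λ q s → s :+ (q :* :0 :* (q :* :0) :+ q :* :0) := s) refl q (𝔼 (λ z → v z * conv (ind X) (ind Y) z))))
    (𝔼-nonneg (λ z → *-nonneg (proj₁ (uv z)) (conv-nonneg (λ x → 𝟏-unit (X x)) (λ y → 𝟏-unit (Y y)) z)))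

  pollard-translate : ∀ X Y v e {m} → PollardBound X (λ y → Y (y ⊝ e)) (λ z → v (z ⊝ e)) m → PollardBound X Y v m
  pollard-translate X Y v e {m} bound = subst₂ (λ a b → density m * a ≤ b + (density m * density m + density m))
    (cong₂ (λ a b → 𝔼 (ind X) + a + b) (𝔼-shift⁻ e (ind Y)) (𝔼-shift⁻ e v))
    (trans (𝔼-cong (λ z → cong (v (z ⊝ e) *_) (𝔼-cong (λ a → cong (λ y → ind X a * ind Y y) (⊝-comm z a e)))))
        (𝔼-shift⁻ e (λ z → v z * conv (ind X) (ind Y) z)))
    bound

  module Dyson (X Y : G → Bool) where
    I U X₁ Y₁ : G → Bool
    I   x = X x ∧ Y x
    U   x = X x ∨ Y x
    X₁ x = X x ∧ not (Y x)
    Y₁ x = Y x ∧ not (X x)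

    i x∖y y∖x : ℕ
    i   = count I
    x∖y = count X₁
    y∖x = count Y₁

    count-X : count X ≡ i ℕ.+ x∖y
    count-X = count-split X Y

    count-Y : count Y ≡ i ℕ.+ y∖x
    count-Y = trans (count-split Y X) (cong (ℕ._+ y∖x) (count-cong (λ x → ∧-comm (Y x) (X x))))

    count-U : count U ≡ i ℕ.+ x∖y ℕ.+ y∖x
    count-U = trans (count-split U X) (cong₂ ℕ._+_ (trans (count-cong (λ x → absorb (X x) (Y x))) count-X)
        (count-cong (λ x → rest (X x) (Y x))))
      where
      absorb : ∀ a b → (a ∨ b) ∧ a ≡ a
      absorb true  b     = refl
      absorb false true  = refl
      absorb false false = refl
      rest : ∀ a b → (a ∨ b) ∧ not a ≡ b ∧ not a
      rest true  true  = refl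
      rest true  false = refl
      rest false b     = refl

    conv-XY : ∀ z → conv (ind X) (ind Y) z ≡ conv (ind U) (ind I) z + conv (ind X₁) (ind Y₁) z
    conv-XY z =
      trans (𝔼-cong (λ a → cong₂ _*_ (X-split (X a) (Y a)) (Y-split (X (z ⊝ a)) (Y (z ⊝ a)))))
      (trans (conv-dyson (ind X₁) (ind Y₁) (ind I) z)
      (cong (_+ conv (ind X₁) (ind Y₁) z) (conv-congˡ (ind I) z (λ a → U-split (X a) (Y a)))))
      where
      X-split : ∀ a b → 𝟏 a ≡ 𝟏 (a ∧ not b) + 𝟏 (a ∧ b)
      X-split true  true  = sym (+-identityˡ 1#)
      X-split true  false = sym (+-identityʳ 1#)
      X-split false b     = sym (+-identityʳ 0#)
      Y-split : ∀ a b → 𝟏 b ≡ 𝟏 (b ∧ not a) + 𝟏 (a ∧ b)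
      Y-split true  true  = sym (+-identityˡ 1#)
      Y-split true  false = sym (+-identityʳ 0#)
      Y-split false true  = sym (+-identityʳ 1#)
      Y-split false false = sym (+-identityʳ 0#)
      U-split : ∀ a b → 𝟏 (a ∧ not b) + (𝟏 (a ∧ b) + 𝟏 (b ∧ not a)) ≡ 𝟏 (a ∨ b)
      U-split true  true  = trans (+-identityˡ _) (+-identityʳ 1#)
      U-split true  false = trans (cong (1# +_) (+-identityʳ 0#)) (+-identityʳ 1#)
      U-split false true  = trans (+-identityˡ _) (+-identityˡ 1#)
      U-split false false = trans (+-identityˡ _) (+-identityʳ 0#)

    correlation-XY : ∀ (v : G → Carrier) → 𝔼 (λ z → v z * conv (ind X) (ind Y) z) ≡ 𝔼 (λ z → v z * conv (ind U) (ind I) z) + 𝔼 (λ z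
        → v z * conv (ind X₁) (ind Y₁) z)
    correlation-XY v = trans (𝔼-cong (λ z → trans (cong (v z *_) (conv-XY z)) (distribˡ (v z) _ _)))
      (𝔼-+ (λ z → v z * conv (ind U) (ind I) z) (λ z → v z * conv (ind X₁) (ind Y₁) z))

    density-X : 𝔼 (ind X) ≡ density i + density x∖y
    density-X = trans (𝔼-ind X) (trans (cong density count-X) (density-+ i x∖y))

    density-Y : 𝔼 (ind Y) ≡ density i + density y∖x
    density-Y = trans (𝔼-ind Y) (trans (cong density count-Y) (density-+ i y∖x))

    density-U : 𝔼 (ind U) ≡ density i + density x∖y + density y∖x
    density-U = trans (𝔼-ind U) (trans (cong density count-U) (trans (density-+ (i ℕ.+ x∖y) y∖x) (cong (_+ density y∖x) (density-+ i x∖y))))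

    -- Union and intersection have together as many elements as X and Y, and the transform only
    -- removes representations.
    dyson-small : ∀ v {m} → UnitValued v → PollardBound U I v m → PollardBound X Y v m
    dyson-small v {m} uv bound =
      density m * (𝔼 (ind X) + 𝔼 (ind Y) + 𝔼 v)
        ≡⟨ cong (λ z → density m * (z + 𝔼 v)) (trans (cong₂ _+_ density-X density-Y)
             (trans (solve 3 (λ i x y → i :+ x :+ (i :+ y) := i :+ x :+ y :+ i) refl (density i) (density x∖y) (density y∖x))
                 (sym (cong₂ _+_ density-U (𝔼-ind I))))) ⟩≤
      density m * (𝔼 (ind U) + 𝔼 (ind I) + 𝔼 v)
        ≤⟨ bound ⟩
      𝔼 (λ z → v z * conv (ind U) (ind I) z) + rest
        ≤⟨ +-mono-≤ (≤-by (𝔼 (λ z → v z * conv (ind X₁) (ind Y₁) z))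
             (𝔼-nonneg (λ z → *-nonneg (proj₁ (uv z)) (conv-nonneg (λ x → 𝟏-unit (X₁ x)) (λ x → 𝟏-unit (Y₁ x)) z)))
                 (correlation-XY v)) ≤-refl ⟩
      𝔼 (λ z → v z * conv (ind X) (ind Y) z) + rest □
      where
      rest : Carrier
      rest = density m * density m + density m

    -- The level is divided: i of it goes to union and intersection, where it is saturated, and o to
    -- the two differences. Their representations add up to those of X and Y, and the mixed terms
    -- 2oi cancel.
    dyson-large : ∀ v o → UnitValued v → PollardBound X₁ Y₁ v o → PollardBound X Y v (i ℕ.+ o)
    dyson-large v o uv bound =
      ∸-cancelʳ-≤ (o′ * i′ + o′ * i′) (subst₂ _≤_ left right (+-mono-≤ (pollard-saturated U I v uv) bound))
      where
      a b : Carrier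
      a = 𝔼 (λ z → v z * conv (ind U) (ind I) z)
      b = 𝔼 (λ z → v z * conv (ind X₁) (ind Y₁) z)
      i′ o′ x′ y′ v′ : Carrier
      i′ = density i
      o′ = density o
      x′ = density x∖y
      y′ = density y∖x
      v′ = 𝔼 v
      left : i′ * (𝔼 (ind U) + 𝔼 (ind I) + v′) + o′ * (𝔼 (ind X₁) + 𝔼 (ind Y₁) + v′) ≡ density (i ℕ.+ o) *
          (𝔼 (ind X) + 𝔼 (ind Y) + v′) - (o′ * i′ + o′ * i′)
      left = trans (cong₂ (λ u w → i′ * (u + v′) + o′ * (w + v′)) (cong₂ _+_ density-U (𝔼-ind I)) (cong₂ _+_ (𝔼-ind X₁) (𝔼-ind Y₁)))
        (trans (solve 5 (λ i o x y v → i :* (i :+ x :+ y :+ i :+ v) :+ o :* (x :+ y :+ v) := (i :+ o) :* (i :+ x :+ (i :+ y) :+ v) :-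
            (o :* i :+ o :* i)) refl i′ o′ x′ y′ v′)
        (sym (cong₂ (λ d w → d * (w + v′) - (o′ * i′ + o′ * i′)) (density-+ i o) (cong₂ _+_ density-X density-Y))))
      right : a + (i′ * i′ + i′) + (b + (o′ * o′ + o′)) ≡ 𝔼 (λ z → v z * conv (ind X) (ind Y) z) +
          (density (i ℕ.+ o) * density (i ℕ.+ o) + density (i ℕ.+ o)) - (o′ * i′ + o′ * i′)
      right = trans (solve 4 (λ a b i o → a :+ (i :* i :+ i) :+ (b :+ (o :* o :+ o)) := a :+ b :+ ((i :+ o) :* (i :+ o) :+ (i :+ o)) :-
          (o :* i :+ o :* i)) refl a b i′ o′)
        (sym (cong₂ (λ w d → w + (d * d + d) - (o′ * i′ + o′ * i′)) (correlation-XY v) (density-+ i o)))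

  -- A Dyson transform replaces Y by a translate meeting X in a nonempty proper subset of it.
  pollard : ∀ fuel X Y v m → count Y ℕ.≤ fuel → UnitValued v → m ℕ.≤ count X → m ℕ.≤ count Y → count X ℕ.+ count Y ℕ.≤ p ℕ.+ m
      → PollardBound X Y v m
  pollard fuel X Y v zero Y≤fuel uv m≤X m≤Y small = pollard-zero X Y v uv
  pollard zero X Y v (suc m) Y≤0 uv m≤X m≤Y small = contradiction (ℕ.≤-trans m≤Y Y≤0) (λ ())
  pollard (suc fuel) X Y v m@(suc _) Y≤fuel uv m≤X m≤Y small with ℕ.m≤n⇒m<n∨m≡n m≤Y
  ... | inj₂ m≡Y = subst (PollardBound X Y v) (sym m≡Y) (pollard-saturated X Y v uv)
  ... | inj₁ m<Y = pollard-translate X Y v e {m} (split (ℕ.≤-total m D.i))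
    where
    module R = CommutativeRing fieldRing
    two = count-twoMembers Y (ℕ.≤-trans (s≤s (s≤s z≤n)) m<Y)
    b₁ = proj₁ two
    b₂ = proj₁ (proj₂ two)
    b₁≢b₂ = proj₁ (proj₂ (proj₂ two))
    Yb₁ = proj₁ (proj₂ (proj₂ (proj₂ two)))
    Yb₂ = proj₂ (proj₂ (proj₂ (proj₂ two)))
    -- As m < |Y|, the bound on |X| + |Y| leaves X a proper subset.
    X<p : count X ℕ.< p
    X<p = ℕ.+-cancelʳ-< (count Y) (count X) p (ℕ.≤-<-trans small (ℕ.+-monoʳ-< p m<Y))
    d≢𝟘 : b₂ ⊝ b₁ ≢ 𝟘
    d≢𝟘 d≡𝟘 = b₁≢b₂ (sym (trans (sym (⊝-⊕ b₂ b₁)) (trans (cong (_⊕ b₁) d≡𝟘) (R.+-identityˡ b₁))))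
    -- Translating Y by a - b₁ moves b₁ to a, inside X, and b₂ to a + (b₂ - b₁), outside X.
    edge = boundary X d≢𝟘 (proj₂ (count-nonempty X (ℕ.≤-trans (s≤s z≤n) m≤X))) (proj₂ (count-missing X X<p))
    a = proj₁ edge
    e = a ⊝ b₁
    Y′ : G → Bool
    Y′ y = Y (y ⊝ e)
    v′ : G → Carrier
    v′ z = v (z ⊝ e)
    uv′ : UnitValued v′
    uv′ z = uv (z ⊝ e)
    module D = Dyson X Y′
    Y′≡Y : count Y′ ≡ count Y
    Y′≡Y = count-permute Y (_⊝ e) (_⊕ e) (λ x → ⊕-⊝ x e) (λ x → ⊝-⊕ x e)
    a∈I : D.I a ≡ true
    a∈I = cong₂ _∧_ (proj₁ (proj₂ edge)) (trans (cong Y (⊝-involutive a b₁)) Yb₁)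
    b∈Y₁ : D.Y₁ (a ⊕ (b₂ ⊝ b₁)) ≡ true
    b∈Y₁ = cong₂ (λ s t → s ∧ not t) (trans (cong Y (x⊕[z⊝y]⊝[x⊝y] a b₁ b₂)) Yb₂) (proj₂ (proj₂ edge))
    0<i : 0 ℕ.< D.i
    0<i = member⇒count-positive D.I a a∈I
    0<y : 0 ℕ.< D.y∖x
    0<y = member⇒count-positive D.Y₁ (a ⊕ (b₂ ⊝ b₁)) b∈Y₁
    iy≤fuel : D.i ℕ.+ D.y∖x ℕ.≤ suc fuel
    iy≤fuel = ℕ.≤-trans (ℕ.≤-reflexive (trans (sym D.count-Y) Y′≡Y)) Y≤fuel
    total : D.i ℕ.+ D.x∖y ℕ.+ (D.i ℕ.+ D.y∖x) ℕ.≤ p ℕ.+ m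
    total = ℕ.≤-trans (ℕ.≤-reflexive (cong₂ ℕ._+_ (sym D.count-X) (trans (sym D.count-Y) Y′≡Y))) small
    m≤ix : m ℕ.≤ D.i ℕ.+ D.x∖y
    m≤ix = ℕ.≤-trans m≤X (ℕ.≤-reflexive D.count-X)
    m≤iy : m ℕ.≤ D.i ℕ.+ D.y∖x
    m≤iy = ℕ.≤-trans m≤Y (ℕ.≤-reflexive (trans (sym Y′≡Y) D.count-Y))
    -- In both cases the second set becomes smaller than Y: the intersection because Y′ is not
    -- contained in X, the difference because Y′ meets X.
    split : m ℕ.≤ D.i ⊎ D.i ℕ.≤ m → PollardBound X Y′ v′ m
    split (inj₁ m≤i) = D.dyson-small v′ {m} uv′ (pollard fuel D.U D.I v′ m
      (ℕ.≤-pred (ℕ.≤-trans (ℕ.≤-trans (ℕ.≤-reflexive (ℕ.+-comm 1 D.i)) (ℕ.+-monoʳ-≤ D.i 0<y)) iy≤fuel)) uv′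
      (ℕ.≤-trans m≤i (ℕ.≤-trans (ℕ.m≤m+n D.i (D.x∖y ℕ.+ D.y∖x)) (ℕ.≤-reflexive
          (trans (sym (ℕ.+-assoc D.i D.x∖y D.y∖x)) (sym D.count-U))))) m≤i
      (ℕ.≤-trans (ℕ.≤-reflexive (trans (cong (ℕ._+ D.i) D.count-U) (regroup D.i D.x∖y D.y∖x))) total))
      where
      regroup : ∀ i x y → i ℕ.+ x ℕ.+ y ℕ.+ i ≡ i ℕ.+ x ℕ.+ (i ℕ.+ y)
      regroup i x y = trans (ℕ.+-assoc (i ℕ.+ x) y i) (cong (i ℕ.+ x ℕ.+_) (ℕ.+-comm y i))
    split (inj₂ i≤m) = let (o , i+o≡m) = ℕ.m≤n⇒∃[o]m+o≡n i≤m in large o i+o≡m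
      where
      large : ∀ o → D.i ℕ.+ o ≡ m → PollardBound X Y′ v′ m
      large o i+o≡m = subst (PollardBound X Y′ v′) i+o≡m (D.dyson-large v′ o uv′ (pollard fuel D.X₁ D.Y₁ v′ o
        (ℕ.≤-pred (ℕ.≤-trans (ℕ.+-monoˡ-≤ D.y∖x 0<i) iy≤fuel)) uv′
        (ℕ.+-cancelˡ-≤ D.i o D.x∖y (ℕ.≤-trans (ℕ.≤-reflexive i+o≡m) m≤ix))
        (ℕ.+-cancelˡ-≤ D.i o D.y∖x (ℕ.≤-trans (ℕ.≤-reflexive i+o≡m) m≤iy))
        (ℕ.+-cancelˡ-≤ D.i (D.x∖y ℕ.+ D.y∖x) (p ℕ.+ o) (ℕ.≤-trans
            (ℕ.≤-trans (ℕ.+-mono-≤ (ℕ.≤-refl {D.i}) (ℕ.+-monoʳ-≤ D.x∖y (ℕ.m≤n+m D.y∖x D.i)))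
          (ℕ.≤-reflexive (sym (ℕ.+-assoc D.i D.x∖y (D.i ℕ.+ D.y∖x)))))
              (ℕ.≤-trans total (ℕ.≤-reflexive (trans (cong (p ℕ.+_) (sym i+o≡m)) (swap p D.i o))))))))
        where
        swap : ∀ p i o → p ℕ.+ (i ℕ.+ o) ≡ i ℕ.+ (p ℕ.+ o)
        swap p i o = trans (sym (ℕ.+-assoc p i o)) (trans (cong (ℕ._+ o) (ℕ.+-comm p i)) (ℕ.+-assoc i p o))

-- Majorants of convolution type

module Wrapping (K : OrderedField) {p : ℕ} (positive-p : OrderedFieldProperties.Positive K (OrderedFieldProperties.fromℕ K p)) (F : FiniteField p) where
  open OrderedField K
  open OrderedFieldProperties K
  open IntegerCoefficients commutativeRing
  open Averages K p positive-p
  open FiniteField F hiding (isCommutativeRing)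
  open FieldProperties F
  open FieldAverages K positive-p F
  open Pollard K positive-p F using (conv-comm)

  mirror : (G → Carrier) → G → Carrier
  mirror f x = f (𝟘 ⊝ x)

  complement : (G → Carrier) → G → Carrier
  complement f x = 1# - f x

  complement-unit : ∀ {f} → UnitValued f → UnitValued (complement f)
  complement-unit uf x = unit-1- (uf x)

  -- As κ = 1/𝔼 g, the constant 1 is κ times the convolution of g with 1. Hence 1 - u is again a
  -- multiple of a convolution, as `powers-correlation` requires of the base of w.
  conv-complement : ∀ {κ} (g v : G → Carrier) → 𝔼 g * κ ≡ 1# → ∀ x → κ * conv g (complement v) x ≡ 1# - κ * conv g v x
  conv-complement {κ} g v gκ≡1 x =
    trans (cong (κ *_) (trans (𝔼-cong (λ a → solve 2 (λ g v → g :* (:1 :- v) := g :- g :* v) refl (g a) (v (x ⊝ a))))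
        (𝔼-- g (λ a → g a * v (x ⊝ a)))))
    (trans (solve 3 (λ κ e c → κ :* (e :- c) := e :* κ :- κ :* c) refl κ (𝔼 g) (conv g v x)) (cong (_- (κ * conv g v x)) gκ≡1))

  conv-unit : ∀ {κ g v} → 0# ≤ κ → UnitValued g → UnitValued v → 𝔼 g * κ ≡ 1# → UnitValued (λ x → κ * conv g v x)
  conv-unit {κ} {g} {v} 0≤κ ug uv gκ≡1 x = nonneg uv ,
    ≤-by (κ * conv g (complement v) x) (nonneg (complement-unit uv))
      (trans (solve 1 (λ c → :1 := c :+ (:1 :- c)) refl (κ * conv g v x)) (cong ((κ * conv g v x) +_) (sym (conv-complement g v gκ≡1 x))))
    where
    nonneg : ∀ {v} → UnitValued v → 0# ≤ κ * conv g v x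
    nonneg uv = *-nonneg 0≤κ (𝔼-nonneg (λ a → proj₁ (unit-* (ug a) (uv (x ⊝ a)))))

  triple : (f g v : G → Carrier) → Carrier
  triple f g v = 𝔼 (λ z → v z * conv f g z)

  triple-comm : ∀ f g v → triple f g v ≡ triple g f v
  triple-comm f g v = 𝔼-cong (λ z → cong (v z *_) (conv-comm f g z))

  -- The weighted count of solutions of z = y + b, seen from y: mirroring g turns the difference in
  -- the convolution into a sum, so v is averaged over y + b.
  triple-mirror : ∀ f g v → triple f g v ≡ 𝔼 (λ y → f y * conv (mirror g) v y)
  triple-mirror f g v =
    trans (𝔼-cong (λ z → sym (𝔼-* (v z) (λ a → f a * g (z ⊝ a)))))
    (trans (𝔼-comm (λ z a → v z * (f a * g (z ⊝ a))))
    (𝔼-cong (λ a → trans (sym (𝔼-reflect a (λ z → v z * (f a * g (z ⊝ a)))))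
      (trans (𝔼-cong (λ b → trans (cong (λ y → v (a ⊝ b) * (f a * g y)) ([a⊝b]⊝a a b))
        (solve 3 (λ v f g → v :* (f :* g) := f :* (g :* v)) refl (v (a ⊝ b)) (f a) (g (𝟘 ⊝ b)))))
      (𝔼-* (f a) (λ b → g (𝟘 ⊝ b) * v (a ⊝ b)))))))

  -- One replacement. With g and v both equal to f, u is the proportion r and w the function v of
  -- the overview; the two later stages use mirrored weights.
  module Stage (κ : Carrier) (0≤κ : 0# ≤ κ) (g v : G → Carrier) (ug : UnitValued g) (uv : UnitValued v) (gκ≡1 : 𝔼 g * κ ≡ 1#) (l : ℕ) where
    u w : G → Carrier
    u x = κ * conv g v x
    w x = (κ * conv g (complement v) x) ^ l

    u-unit : UnitValued u
    u-unit = conv-unit 0≤κ ug uv gκ≡1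

    w-unit : UnitValued w
    w-unit x = unit-^ l (conv-unit 0≤κ ug (complement-unit uv) gκ≡1 x)

    w≡ : ∀ x → w x ≡ (1# - u x) ^ l
    w≡ x = cong (_^ l) (conv-complement g v gκ≡1 x)

    -- Where u is not small, its damping factor (1 - u)ˡ is.
    𝔼-u*w : fromℕ (suc l) * 𝔼 (λ x → w x * u x) ≤ 1#
    𝔼-u*w = subst (_≤ 1#) (𝔼-* (fromℕ (suc l)) (λ x → w x * u x)) (𝔼-≤1 (λ x →
      subst (λ z → fromℕ (suc l) * z ≤ 1#) (trans (cong (u x *_) (sym (w≡ x))) (*-comm (u x) (w x))) (x[1-x]^k-bound l (u-unit x))))

    -- By Bernoulli's inequality w is at least 1 - lu; so w covers f up to l times the average of
    -- fu.
    𝔼-*w : ∀ {f} → UnitValued f → 𝔼 f - fromℕ l * 𝔼 (λ x → f x * u x) ≤ 𝔼 (λ x → f x * w x)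
    𝔼-*w {f} uf =
      𝔼 f - fromℕ l * 𝔼 (λ x → f x * u x)
        ≡⟨ sym (trans (𝔼-- f (λ x → fromℕ l * (f x * u x))) (cong (λ z → 𝔼 f - z) (𝔼-* (fromℕ l) (λ x → f x * u x)))) ⟩≤
      𝔼 (λ x → f x - fromℕ l * (f x * u x))
        ≡⟨ 𝔼-cong (λ x → solve 3 (λ f l u → f :- l :* (f :* u) := f :* (:1 :- l :* u)) refl (f x) (fromℕ l) (u x)) ⟩≤
      𝔼 (λ x → f x * (1# - fromℕ l * u x))
        ≤⟨ 𝔼-mono (λ x → *-monoˡ-≤ (f x) (proj₁ (uf x)) (≤-trans (bernoulli l (u-unit x)) (≤-reflexive (sym (w≡ x))))) ⟩
      𝔼 (λ x → f x * w x) □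

-- The majorants of a set that avoids t

module Wrappers (K : OrderedField) {p : ℕ} (positive-p : OrderedFieldProperties.Positive K (OrderedFieldProperties.fromℕ K p))
                (F : FiniteField p) (t : Fin p) (t≢𝟘 : t ≢ FiniteField.𝟘 F) (A : Fin p → Bool)
                (avoids : ∀ x y z → A x ≡ true → A y ≡ true → A z ≡ true → FiniteField._⊗_ F x (FiniteField._⊕_ F y z) ≢ t) where
  open OrderedField K
  open OrderedFieldProperties K
  open IntegerCoefficients commutativeRing
  open Averages K p positive-p
  open FiniteField F hiding (isCommutativeRing)
  open FieldProperties F
  open FieldAverages K positive-p F
  open Equidistribution K positive-p F t t≢𝟘 using (τ)
  open Pollard K positive-p F using (ind; 𝟏-unit)
  open Wrapping K positive-p F
  private module R = CommutativeRing fieldRing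

  f : G → Carrier
  f = ind A

  f-unit : UnitValued f
  f-unit x = 𝟏-unit (A x)

  a : Carrier
  a = 𝔼 f

  a-unit : UnitInterval a
  a-unit = 𝔼-unit f-unit

  module Scales (positive-a : Positive a) (k l m : ℕ) where
    κ : Carrier
    κ = inverse positive-a

    module V = Stage κ (0≤inverse positive-a) f f f-unit f-unit (*-inverse positive-a) k
    open V using () renaming (w to v; w-unit to v-unit)
    module W₁ = Stage κ (0≤inverse positive-a) (mirror f) v (λ x → f-unit (𝟘 ⊝ x)) v-unit
      (trans (cong (_* κ) (𝔼-reflect 𝟘 f)) (*-inverse positive-a)) l
    open W₁ using () renaming (w to w₁; w-unit to w₁-unit)

    convff-vanishes : ∀ x → x ≢ 𝟘 → A x ≡ true → conv f f (τ x) ≡ 0#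
    convff-vanishes x x≢𝟘 Ax = trans (𝔼-cong vanishes) (𝔼-const 0#)
      where
      sum≡t : ∀ y → x ⊗ (y ⊕ (τ x ⊝ y)) ≡ t
      sum≡t y = trans (cong (x ⊗_) (trans (R.+-comm y (τ x ⊝ y)) (⊝-⊕ (τ x) y)))
        (trans (cong (x ⊗_) (R.*-comm t (inv x))) (trans (sym (R.*-assoc x (inv x) t)) (trans (cong (_⊗ t) (⊗-inv x≢𝟘)) (R.*-identityˡ t))))
      vanishes : ∀ y → f y * f (τ x ⊝ y) ≡ 0#
      vanishes y with A y in Ay | A (τ x ⊝ y) in Az
      ... | false | _     = zeroˡ _
      ... | true  | false = zeroʳ 1#
      ... | true  | true  = contradiction (sum≡t y) (avoids x y (τ x ⊝ y) Ax Ay Az)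

    v≡1 : ∀ x → x ≢ 𝟘 → A x ≡ true → v (τ x) ≡ 1#
    v≡1 x x≢𝟘 Ax = trans (V.w≡ (τ x)) (trans (cong (_^ k) (trans (cong (λ c → 1# - κ * c) (convff-vanishes x x≢𝟘 Ax))
        (solve 1 (λ κ → :1 :- κ :* :0 := :1) refl κ))) (1^ k))
      where
      1^ : ∀ k → 1# ^ k ≡ 1#
      1^ zero    = refl
      1^ (suc k) = trans (*-identityˡ _) (1^ k)

    -- On A the factor `v (τ x)` is 1 unless x = 0, and this one point costs `q`.
    captured : ∀ {w} → UnitValued w → 𝔼 (λ x → f x * w x) - q ≤ 𝔼 (λ x → χ x * (w x * v (τ x)))
    captured {w} uw = ≤-trans (≤-reflexive (sym (trans (𝔼-- (λ x → f x * w x) (λ x → ι (x ≟ 𝟘)))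
        (cong (λ z → 𝔼 (λ x → f x * w x) - z) (𝔼-ι-≟ 𝟘))))) (𝔼-mono pointwise)
      where
      pointwise : ∀ x → f x * w x - ι (x ≟ 𝟘) ≤ χ x * (w x * v (τ x))
      pointwise x with x ≟ 𝟘
      ... | yes _ = ≤-by (1# - f x * w x) (proj₁ (unit-1- (unit-* (f-unit x) (uw x))))
          (solve 2 (λ y z → :0 :* y := z :- :1 :+ (:1 :- z)) refl (w x * v (τ x)) (f x * w x))
      ... | no x≢𝟘 with A x in Ax
      ...   | true  = ≤-reflexive (trans (solve 1 (λ y → :1 :* y :- :0 := :1 :* (y :* :1)) refl (w x))
          (cong (λ z → 1# * (w x * z)) (sym (v≡1 x x≢𝟘 Ax))))
      ...   | false = ≤-by (w x * v (τ x)) (proj₁ (unit-* (uw x) (v-unit (τ x))))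
          (solve 2 (λ y z → :1 :* y := :0 :* z :- :0 :+ y) refl (w x * v (τ x)) (w x))

    -- The average of f u₁ and that of v r are the same triple average seen from two variables, and
    -- the second is damped.
    loss₁ : fromℕ (suc k) * 𝔼 (λ y → f y * W₁.u y) ≤ 1#
    loss₁ = ≤-trans (≤-reflexive (cong (fromℕ (suc k) *_)
      (trans (𝔼-cong (λ y → solve 3 (λ f κ c → f :* (κ :* c) := κ :* (f :* c)) refl (f y) κ (conv (mirror f) v y)))
      (trans (𝔼-* κ (λ y → f y * conv (mirror f) v y)) (trans (cong (κ *_) (sym (triple-mirror f f v)))
      (trans (sym (𝔼-* κ (λ z → v z * conv f f z))) (𝔼-cong (λ z → solve 3 (λ κ v c → κ :* (v :* c) := v :* (κ :* c)) refl κ (v z)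
          (conv f f z)))))))))
      V.𝔼-u*w

    module Second (positive-w₁ : Positive (𝔼 w₁)) where
      κ₁ : Carrier
      κ₁ = inverse positive-w₁

      module W₂ = Stage κ₁ (0≤inverse positive-w₁) (mirror w₁) v (λ x → w₁-unit (𝟘 ⊝ x)) v-unit
        (trans (cong (_* κ₁) (𝔼-reflect 𝟘 w₁)) (*-inverse positive-w₁)) m
      open W₂ using () renaming (w to w₂; w-unit to w₂-unit)

      triple-u : ∀ {κ} g → (h : G → Carrier) (gh : 𝔼 g * κ ≡ 1#) → triple h g v ≡ 𝔼 g * 𝔼 (λ y → h y * (κ * conv (mirror g) v y))
      triple-u {κ} g h gκ≡1 = trans (triple-mirror h g v) (trans (𝔼-cong (λ y →
          trans (sym (*-identityˡ _)) (trans (cong (_* (h y * conv (mirror g) v y)) (sym gκ≡1))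
              (solve 4 (λ e κ h c → e :* κ :* (h :* c) := e :* (h :* (κ :* c))) refl (𝔼 g) κ (h y) (conv (mirror g) v y)))))
        (𝔼-* (𝔼 g) (λ y → h y * (κ * conv (mirror g) v y))))

      -- The triple average of f, w₁ and v is 𝔼 w₁ times the average of f u₂, and also a times the
      -- damped average of w₁ u₁.
      loss₂ : fromℕ (suc l) * 𝔼 (λ y → f y * W₂.u y) ≤ κ₁ * a
      loss₂ =
        fromℕ (suc l) * 𝔼 (λ y → f y * W₂.u y)
          ≡⟨ cong (fromℕ (suc l) *_) (trans (𝔼-cong (λ y → solve 3 (λ f κ c → f :* (κ :* c) := κ :* (f :* c)) refl (f y) κ₁
              (conv (mirror w₁) v y)))
               (trans (𝔼-* κ₁ (λ y → f y * conv (mirror w₁) v y))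
                   (cong (κ₁ *_) (trans (sym (triple-mirror f w₁ v))
                     (trans (triple-comm f w₁ v) (triple-u f w₁ (*-inverse positive-a))))))) ⟩≤
        fromℕ (suc l) * (κ₁ * (a * 𝔼 (λ y → w₁ y * W₁.u y)))
          ≡⟨ solve 4 (λ n κ a e → n :* (κ :* (a :* e)) := κ :* a :* (n :* e)) refl (fromℕ (suc l)) κ₁ a (𝔼 (λ y → w₁ y * W₁.u y)) ⟩≤
        κ₁ * a * (fromℕ (suc l) * 𝔼 (λ y → w₁ y * W₁.u y))
          ≤⟨ *-monoˡ-≤ (κ₁ * a) (*-nonneg (0≤inverse positive-w₁) (proj₁ a-unit)) W₁.𝔼-u*w ⟩
        κ₁ * a * 1#
          ≡⟨ *-identityʳ (κ₁ * a) ⟩≤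
        κ₁ * a □

      -- Seen from w₂, the triples amount to 𝔼 w₁ times the average of w₂ u₂, which is damped.
      few-triples : fromℕ (suc m) * triple w₂ w₁ v ≤ 1#
      few-triples =
        fromℕ (suc m) * triple w₂ w₁ v
          ≡⟨ cong (fromℕ (suc m) *_) (triple-u w₁ w₂ (*-inverse positive-w₁)) ⟩≤
        fromℕ (suc m) * (𝔼 w₁ * 𝔼 (λ y → w₂ y * W₂.u y))
          ≡⟨ solve 3 (λ n a e → n :* (a :* e) := a :* (n :* e)) refl (fromℕ (suc m)) (𝔼 w₁) (𝔼 (λ y → w₂ y * W₂.u y)) ⟩≤
        𝔼 w₁ * (fromℕ (suc m) * 𝔼 (λ y → w₂ y * W₂.u y))
          ≤⟨ *-monoˡ-≤ (𝔼 w₁) (proj₁ (𝔼-unit w₁-unit)) W₂.𝔼-u*w ⟩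
        𝔼 w₁ * 1#
          ≤⟨ subst (_≤ 1#) (sym (*-identityʳ (𝔼 w₁))) (proj₂ (𝔼-unit w₁-unit)) ⟩
        1# □

-- Pollard's theorem for weights

module PopularSums (K : OrderedField) {p : ℕ} (positive-p : OrderedFieldProperties.Positive K (OrderedFieldProperties.fromℕ K p)) (F : FiniteField p) where
  open OrderedField K
  open OrderedFieldProperties K
  open IntegerCoefficients commutativeRing
  open Averages K p positive-p
  open FiniteField F hiding (isCommutativeRing)
  open FieldAverages K positive-p F
  open Counting
  open Pollard K positive-p F
  open Wrapping K positive-p F

  -- Pollard's theorem concerns sets, so weights are cut at the level η. This costs η in the mean
  -- and a factor η for each weight in the triples.
  superlevel : Carrier → (G → Carrier) → G → Bool
  superlevel η w x with ≤-total η (w x)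
  ... | inj₁ _ = true
  ... | inj₂ _ = false

  superlevel-≤ : ∀ {η w} → UnitValued w → ∀ x → η * ind (superlevel η w) x ≤ w x
  superlevel-≤ {η} {w} uw x with ≤-total η (w x)
  ... | inj₁ η≤w = subst (_≤ w x) (sym (*-identityʳ η)) η≤w
  ... | inj₂ w≤η = subst (_≤ w x) (sym (zeroʳ η)) (proj₁ (uw x))

  ≤-superlevel : ∀ {η w} → 0# ≤ η → UnitValued w → ∀ x → w x ≤ ind (superlevel η w) x + η
  ≤-superlevel {η} {w} 0≤η uw x with ≤-total η (w x)
  ... | inj₁ η≤w = ≤-trans (proj₂ (uw x)) (≤-by η 0≤η refl)
  ... | inj₂ w≤η = subst (w x ≤_) (sym (+-identityˡ η)) w≤η

  mean-superlevel : ∀ {η w} → 0# ≤ η → UnitValued w → 𝔼 w ≤ 𝔼 (ind (superlevel η w)) + η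
  mean-superlevel {η} {w} 0≤η uw = ≤-trans (𝔼-mono (≤-superlevel 0≤η uw))
      (≤-reflexive (trans (𝔼-+ (ind (superlevel η w)) (λ _ → η)) (cong (𝔼 (ind (superlevel η w)) +_) (𝔼-const η))))

  triple-superlevel : ∀ {η w w′ v} → 0# ≤ η → UnitValued w → UnitValued w′ → UnitValued v →
    η * η * triple (ind (superlevel η w)) (ind (superlevel η w′)) v ≤ triple w w′ v
  triple-superlevel {η} {w} {w′} {v} 0≤η uw uw′ uv = ≤-trans (≤-reflexive push)
    (𝔼-mono (λ z → *-monoˡ-≤ (v z) (proj₁ (uv z)) (𝔼-mono (λ a → *-mono-≤ (nonneg w a) (proj₁ (uw′ (z ⊝ a))) (superlevel-≤ uw a)
        (superlevel-≤ uw′ (z ⊝ a))))))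
    where
    X Y : G → Carrier
    X = ind (superlevel η w)
    Y = ind (superlevel η w′)
    nonneg : ∀ w a → 0# ≤ η * ind (superlevel η w) a
    nonneg w a = *-nonneg 0≤η (proj₁ (𝟏-unit (superlevel η w a)))
    push : η * η * triple X Y v ≡ 𝔼 (λ z → v z * 𝔼 (λ a → η * X a * (η * Y (z ⊝ a))))
    push = trans (sym (𝔼-* (η * η) (λ z → v z * conv X Y z))) (𝔼-cong (λ z →
      trans (solve 3 (λ e v c → e :* (v :* c) := v :* (e :* c)) refl (η * η) (v z) (conv X Y z))
      (cong (v z *_) (trans (sym (𝔼-* (η * η) (λ a → X a * Y (z ⊝ a))))
          (𝔼-cong (λ a → solve 3 (λ η x y → η :* η :* (x :* y) := η :* x :* (η :* y)) refl η (X a) (Y (z ⊝ a))))))))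

  -- Inclusion and exclusion for X and z - Y. It serves where X and Y are too large for Pollard's
  -- theorem.
  conv-overlap : ∀ X Y z → 𝔼 (ind X) + 𝔼 (ind Y) - 1# ≤ conv (ind X) (ind Y) z
  conv-overlap X Y z = ≤-by (𝔼 (λ a → (1# - ind X a) * (1# - ind Y (z ⊝ a))))
    (𝔼-nonneg (λ a → *-nonneg (proj₁ (unit-1- (𝟏-unit (X a)))) (proj₁ (unit-1- (𝟏-unit (Y (z ⊝ a)))))))
    (sym (trans (cong (𝔼 (ind X) + 𝔼 (ind Y) - 1# +_)
      (trans (𝔼-cong (λ a → solve 2 (λ x y → (:1 :- x) :* (:1 :- y) := :1 :- x :- y :+ x :* y) refl (ind X a) (ind Y (z ⊝ a))))
      (trans (𝔼-+ (λ a → 1# - ind X a - ind Y (z ⊝ a)) (λ a → ind X a * ind Y (z ⊝ a))) (cong (_+ conv (ind X) (ind Y) z)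
      (trans (𝔼-- (λ a → 1# - ind X a) (λ a → ind Y (z ⊝ a))) (cong₂ _-_
          (trans (𝔼-- (λ _ → 1#) (ind X)) (cong (_- 𝔼 (ind X)) (𝔼-const 1#))) (𝔼-reflect z (ind Y))))))))
      (solve 3 (λ x y c → x :+ y :- :1 :+ (:1 :- x :- y :+ c) := c) refl (𝔼 (ind X)) (𝔼 (ind Y)) (conv (ind X) (ind Y) z))))

  density-reflects-≤ : ∀ {η j X} → Positive η → 0# ≤ η → density j ≤ η → η + η ≤ 𝔼 (ind X) → j ℕ.≤ count X
  density-reflects-≤ {η} {j} {X} pos 0≤η j≤η 2η≤X with ℕ.≤-total j (count X)
  ... | inj₁ j≤X = j≤X
  ... | inj₂ X≤j = contradiction
    (*-cancelˡ-≤ pos (subst₂ _≤_ (sym (*-identityʳ η)) (sym (zeroʳ η)) (∸-cancelʳ-≤ (- η) (subst₂ _≤_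
      (solve 1 (λ η → η :+ η := η :- :- η) refl η) (solve 1 (λ η → η := :0 :- :- η) refl η)
      (≤-trans 2η≤X (≤-trans (≤-reflexive (𝔼-ind X)) (≤-trans (density-mono X≤j) j≤η)))))))
    1≰0

  module _ {η : Carrier} (positive-η : Positive η) (0≤η : 0# ≤ η) {j : ℕ} (j≤η : density j ≤ η) (η≤2j : η ≤ density j + density j)
           {w w′ v : G → Carrier} (uw : UnitValued w) (uw′ : UnitValued w′) (uv : UnitValued v)
           (few : triple w w′ v + triple w w′ v ≤ η * η * (η * η))
           (3η≤w : η + η + η ≤ 𝔼 w) (3η≤w′ : η + η + η ≤ 𝔼 w′) where
    X Y : G → Bool
    X = superlevel η w
    Y = superlevel η w′

    x y T d : Carrier
    x = 𝔼 (ind X)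
    y = 𝔼 (ind Y)
    T = triple (ind X) (ind Y) v
    d = density j

    positive-d : Positive d
    positive-d = record
      { inverse   = (1# + 1#) * i
      ; 0≤inverse = *-nonneg (fromℕ-nonneg 2) (0≤inverse positive-2d)
      ; *-inverse = trans (solve 2 (λ d i → d :* ((:1 :+ :1) :* i) := (d :+ d) :* i) refl d i) (*-inverse positive-2d)
      }
      where
      positive-2d : Positive (d + d)
      positive-2d = positive-≤ positive-η η≤2j
      i : Carrier
      i = inverse positive-2d

    -- T is at most η⁻² times the triple average of the weights, hence at most η²/2, and η/2 ≤ d.
    T≤dη : T ≤ d * η
    T≤dη = *-cancelˡ-≤ (positive-* (positive-suc 1) (positive-* positive-η positive-η)) (
      (1# + 1#) * (η * η) * T      ≡⟨ solve 2 (λ e T → (:1 :+ :1) :* e :* T := e :* T :+ e :* T) refl (η * η) T ⟩≤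
      η * η * T + η * η * T        ≤⟨ +-mono-≤ (triple-superlevel 0≤η uw uw′ uv) (triple-superlevel 0≤η uw uw′ uv) ⟩
      triple w w′ v + triple w w′ v ≤⟨ few ⟩
      η * η * (η * η)              ≤⟨ *-monoˡ-≤ (η * η) (*-nonneg 0≤η 0≤η) (*-monoˡ-≤ η 0≤η η≤2j) ⟩
      η * η * (η * (d + d))        ≡⟨ solve 2 (λ η d → η :* η :* (η :* (d :+ d)) := (:1 :+ :1) :* (η :* η) :* (d :* η)) refl η d ⟩≤
      (1# + 1#) * (η * η) * (d * η) □)

    2η≤x : ∀ {w x} → η + η + η ≤ w → w ≤ x + η → η + η ≤ x
    2η≤x {w} {x} 3η≤w w≤x+η = ∸-cancelʳ-≤ (- η) (subst₂ _≤_ (solve 1 (λ η → η :+ η :+ η := η :+ η :- :- η) refl η)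
        (solve 2 (λ x η → x :+ η := x :- :- η) refl x η) (≤-trans 3η≤w w≤x+η))

    -- If |X| + |Y| ≤ p + j, Pollard's theorem divided by d gives 1 + T/d + d ≤ 1 + 2η; cutting w
    -- and w′ costs the other 2η. Otherwise every z has convolution at least d.
    few-sums : 𝔼 w + 𝔼 w′ + 𝔼 v ≤ 1# + (η + η + η + η) ⊎ 𝔼 v ≤ η
    few-sums with ℕ.≤-total (count X ℕ.+ count Y) (p ℕ.+ j)
    ... | inj₁ small = inj₁ (
      𝔼 w + 𝔼 w′ + 𝔼 v
        ≤⟨ +-mono-≤ (+-mono-≤ (mean-superlevel 0≤η uw) (mean-superlevel 0≤η uw′)) ≤-refl ⟩
      x + η + (y + η) + 𝔼 v
        ≡⟨ solve 4 (λ x η y v → x :+ η :+ (y :+ η) :+ v := x :+ y :+ v :+ (η :+ η)) refl x η y (𝔼 v) ⟩≤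
      x + y + 𝔼 v + (η + η)
        ≤⟨ +-mono-≤ (*-cancelˡ-≤ positive-d bound) ≤-refl ⟩
      1# + (η + η) + (η + η)
        ≡⟨ solve 1 (λ η → :1 :+ (η :+ η) :+ (η :+ η) := :1 :+ (η :+ η :+ η :+ η)) refl η ⟩≤
      1# + (η + η + η + η) □)
      where
      bound : d * (x + y + 𝔼 v) ≤ d * (1# + (η + η))
      bound =
        d * (x + y + 𝔼 v)
          ≤⟨ pollard (count Y) X Y v j ℕ.≤-refl uv (density-reflects-≤ positive-η 0≤η j≤η (2η≤x 3η≤w (mean-superlevel 0≤η uw)))
               (density-reflects-≤ positive-η 0≤η j≤η (2η≤x 3η≤w′ (mean-superlevel 0≤η uw′))) small ⟩
        T + (d * d + d)
          ≤⟨ +-mono-≤ T≤dη (+-mono-≤ (*-monoˡ-≤ d (*-nonneg 0≤q (fromℕ-nonneg j)) j≤η) ≤-refl) ⟩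
        d * η + (d * η + d)
          ≡⟨ solve 2 (λ d η → d :* η :+ (d :* η :+ d) := d :* (:1 :+ (η :+ η))) refl d η ⟩≤
        d * (1# + (η + η)) □
    ... | inj₂ large = inj₂ (*-cancelˡ-≤ positive-d (
      d * 𝔼 v                     ≡⟨ trans (*-comm d (𝔼 v)) (sym (𝔼-*ʳ d v)) ⟩≤
      𝔼 (λ z → v z * d)          ≤⟨ 𝔼-mono (λ z → *-monoˡ-≤ (v z) (proj₁ (uv z)) (≤-trans d≤ (conv-overlap X Y z))) ⟩
      T                           ≤⟨ T≤dη ⟩
      d * η □))
      where
      d≤ : d ≤ x + y - 1#
      d≤ = ∸-cancelʳ-≤ (- 1#) (subst₂ _≤_
        (trans (density-+ p j) (trans (cong (_+ d) density-p) (solve 1 (λ d → :1 :+ d := d :- :- :1) refl d)))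
        (trans (density-+ (count X) (count Y)) (trans (sym (cong₂ _+_ (𝔼-ind X) (𝔼-ind Y)))
            (solve 2 (λ x y → x :+ y := x :+ y :- :1 :- :- :1) refl x y)))
        (density-mono large))

-- The bound 1/8 on the density

module DensityBound (K : OrderedField) {p : ℕ} (positive-p : OrderedFieldProperties.Positive K (OrderedFieldProperties.fromℕ K p))
                    (F : FiniteField p) (t : Fin p) (t≢𝟘 : t ≢ FiniteField.𝟘 F) (A : Fin p → Bool)
                    (avoids : ∀ x y z → A x ≡ true → A y ≡ true → A z ≡ true → FiniteField._⊗_ F x (FiniteField._⊕_ F y z) ≢ t) where
  open OrderedField K
  open OrderedFieldProperties K
  open IntegerCoefficients commutativeRing
  open Averages K p positive-p
  open FieldAverages K positive-p F using (χ)
  open Equidistribution K positive-p F t t≢𝟘 using (τ)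
  open PowersOfConvolutions K positive-p F t t≢𝟘 using (powers-correlation)
  open Pollard K positive-p F using (density)
  open PopularSums K positive-p F using (few-sums)
  open Wrapping K positive-p F
  open Wrappers K positive-p F t t≢𝟘 A avoids

  ^-mono : ∀ {x y} k → 0# ≤ x → x ≤ y → 0# ≤ x ^ k × x ^ k ≤ y ^ k
  ^-mono zero    0≤x x≤y = 0≤1 , ≤-refl
  ^-mono {x} {y} (suc k) 0≤x x≤y = let (0≤xᵏ , xᵏ≤yᵏ) = ^-mono k 0≤x x≤y in
    *-nonneg 0≤x 0≤xᵏ , *-mono-≤ 0≤x (≤-trans 0≤xᵏ xᵏ≤yᵏ) x≤y xᵏ≤yᵏ

  inverse-≤ : ∀ {x} (pos : Positive x) {b} → 1# ≤ b * x → inverse pos ≤ b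
  inverse-≤ {x} pos {b} 1≤bx =
    i           ≡⟨ sym (*-identityʳ i) ⟩≤
    i * 1#      ≤⟨ *-monoˡ-≤ i (0≤inverse pos) 1≤bx ⟩
    i * (b * x) ≡⟨ trans (solve 3 (λ i b x → i :* (b :* x) := b :* (x :* i)) refl i b x)
        (trans (cong (b *_) (*-inverse pos)) (*-identityʳ b)) ⟩≤
    b □
    where
    i : Carrier
    i = inverse pos

  𝔼-*-≤ : ∀ {w} → UnitValued w → 𝔼 (λ x → f x * w x) ≤ 𝔼 w
  𝔼-*-≤ {w} uw = 𝔼-mono (λ x → subst (f x * w x ≤_) (*-identityˡ (w x))
      (*-mono-≤ (proj₁ (f-unit x)) (proj₁ (uw x)) (proj₂ (f-unit x)) ≤-refl))

  -- `l≤ηk` and `2m≤ηl` limit the part of A lost at each stage to η; `2≤η⁴m` makes the triples few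
  -- enough for `few-sums`; `error₁≤η` and `error₂≤η` absorb the constants of the powers; `1≤8a`
  -- bounds κ and κ₁.
  module _ {η ν : Carrier} (k l m j : ℕ) (positive-η : Positive η) (0≤η : 0# ≤ η) (32η≤1 : fromℕ 32 * η ≤ 1#)
           (positive-ν : Positive ν) (ν-unit : UnitInterval ν) (11q≤ν⁴ : fromℕ 11 * q ≤ (ν * ν) * (ν * ν)) (q≤η : q ≤ η)
           (j≤η : density j ≤ η) (η≤2j : η ≤ density j + density j)
           (l≤ηk : fromℕ l ≤ η * fromℕ (suc k)) (2m≤ηl : fromℕ 2 * fromℕ m ≤ η * fromℕ (suc l))
               (2≤η⁴m : fromℕ 2 ≤ η * η * (η * η) * fromℕ (suc m))
           (error₁≤η : fromℕ 16 ^ l * (fromℕ 16 ^ k * ν) ≤ η) (error₂≤η : fromℕ 16 ^ m * (fromℕ 16 ^ k * ν) ≤ η)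
           (1≤8a : 1# ≤ fromℕ 8 * a) where

    4η≤a : fromℕ 4 * η ≤ a
    4η≤a = *-cancelˡ-≤ (positive-suc 7) (≤-trans (≤-reflexive (solve 1 (λ η
        → con (ℤ.+ 8) :* (con (ℤ.+ 4) :* η) := con (ℤ.+ 32) :* η) refl η)) (≤-trans 32η≤1 1≤8a))

    positive-a : Positive a
    positive-a = positive-≤ (positive-* (positive-suc 3) positive-η) 4η≤a

    open Scales positive-a k l m
    open V using () renaming (w to v; w-unit to v-unit)
    open W₁ using () renaming (w to w₁; w-unit to w₁-unit)

    a-η≤𝔼fw₁ : a - η ≤ 𝔼 (λ x → f x * w₁ x)
    a-η≤𝔼fw₁ = ≤-trans (+-mono-≤ ≤-refl (neg-mono-≤ (
      fromℕ l * E             ≤⟨ *-mono-≤ (fromℕ-nonneg l) 0≤E l≤ηk ≤-refl ⟩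
      η * fromℕ (suc k) * E   ≡⟨ *-assoc η (fromℕ (suc k)) E ⟩≤
      η * (fromℕ (suc k) * E) ≤⟨ *-monoˡ-≤ η 0≤η loss₁ ⟩
      η * 1#                  ≡⟨ *-identityʳ η ⟩≤
      η □))) (W₁.𝔼-*w f-unit)
      where
      E : Carrier
      E = 𝔼 (λ y → f y * W₁.u y)
      0≤E : 0# ≤ E
      0≤E = 𝔼-nonneg (λ y → proj₁ (unit-* (f-unit y) (W₁.u-unit y)))

    3η≤ : ∀ {w} → UnitValued w → a - η ≤ 𝔼 (λ x → f x * w x) → η + η + η ≤ 𝔼 w
    3η≤ uw h = ≤-trans (≤-reflexive (solve 1 (λ η → η :+ η :+ η := con (ℤ.+ 4) :* η :- η) refl η))
        (≤-trans (+-mono-≤ 4η≤a ≤-refl) (≤-trans h (𝔼-*-≤ uw)))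

    3η≤𝔼w₁ : η + η + η ≤ 𝔼 w₁
    3η≤𝔼w₁ = 3η≤ w₁-unit a-η≤𝔼fw₁

    η≤𝔼w₁ : η ≤ 𝔼 w₁
    η≤𝔼w₁ = ≤-trans (≤-by (η + η) (+-nonneg 0≤η 0≤η) (solve 1 (λ η → η :+ η :+ η := η :+ (η :+ η)) refl η)) 3η≤𝔼w₁

    open Second (positive-≤ positive-η η≤𝔼w₁)
    open W₂ using () renaming (w to w₂; w-unit to w₂-unit)

    a≤2w₁ : a ≤ fromℕ 2 * 𝔼 w₁
    a≤2w₁ =
      a                      ≡⟨ solve 2 (λ a η → a := a :- η :+ η) refl a η ⟩≤
      a - η + η              ≤⟨ +-mono-≤ (≤-trans a-η≤𝔼fw₁ (𝔼-*-≤ w₁-unit)) η≤𝔼w₁ ⟩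
      𝔼 w₁ + 𝔼 w₁          ≡⟨ solve 1 (λ w → w :+ w := (:1 :+ :1) :* w) refl (𝔼 w₁) ⟩≤
      fromℕ 2 * 𝔼 w₁ □

    κ₁a≤2 : κ₁ * a ≤ fromℕ 2
    κ₁a≤2 =
      κ₁ * a                  ≤⟨ *-monoˡ-≤ κ₁ (0≤inverse (positive-≤ positive-η η≤𝔼w₁)) a≤2w₁ ⟩
      κ₁ * (fromℕ 2 * 𝔼 w₁)  ≡⟨ trans (solve 3 (λ k c w → k :* (c :* w) := c :* (w :* k)) refl κ₁ (fromℕ 2) (𝔼 w₁))
          (trans (cong (fromℕ 2 *_) (*-inverse (positive-≤ positive-η η≤𝔼w₁))) (*-identityʳ _)) ⟩≤
      fromℕ 2 □

    a-η≤𝔼fw₂ : a - η ≤ 𝔼 (λ x → f x * w₂ x)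
    a-η≤𝔼fw₂ = ≤-trans (+-mono-≤ ≤-refl (neg-mono-≤ (*-cancelˡ-≤ (positive-suc 1) (
      fromℕ 2 * (fromℕ m * E)     ≡⟨ sym (*-assoc (fromℕ 2) (fromℕ m) E) ⟩≤
      fromℕ 2 * fromℕ m * E       ≤⟨ *-mono-≤ (*-nonneg (fromℕ-nonneg 2) (fromℕ-nonneg m)) 0≤E 2m≤ηl ≤-refl ⟩
      η * fromℕ (suc l) * E       ≡⟨ *-assoc η (fromℕ (suc l)) E ⟩≤
      η * (fromℕ (suc l) * E)     ≤⟨ *-monoˡ-≤ η 0≤η (≤-trans loss₂ κ₁a≤2) ⟩
      η * fromℕ 2                 ≡⟨ *-comm η (fromℕ 2) ⟩≤
      fromℕ 2 * η □)))) (W₂.𝔼-*w f-unit)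
      where
      E : Carrier
      E = 𝔼 (λ y → f y * W₂.u y)
      0≤E : 0# ≤ E
      0≤E = 𝔼-nonneg (λ y → proj₁ (unit-* (f-unit y) (W₂.u-unit y)))

    -- 1/a ≤ 8, but κ₁ requires 16, as 𝔼 w₁ is only known to be at least a/2; one constant serves
    -- both.
    κ≤16 : κ ≤ fromℕ 16
    κ≤16 = inverse-≤ positive-a (≤-trans 1≤8a (*-mono-≤ (fromℕ-nonneg 8) (proj₁ a-unit)
        (≤-by (fromℕ 8) (fromℕ-nonneg 8) (fromℕ-+ 8 8)) ≤-refl))

    κ₁≤16 : κ₁ ≤ fromℕ 16
    κ₁≤16 = inverse-≤ (positive-≤ positive-η η≤𝔼w₁) (≤-trans 1≤8a (≤-trans (*-monoˡ-≤ (fromℕ 8) (fromℕ-nonneg 8) a≤2w₁)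
      (≤-reflexive (trans (sym (*-assoc (fromℕ 8) (fromℕ 2) (𝔼 w₁))) (cong (_* 𝔼 w₁) (sym (fromℕ-* 8 2)))))))

    0≤κ : 0# ≤ κ
    0≤κ = 0≤inverse positive-a

    0≤κ₁ : 0# ≤ κ₁
    0≤κ₁ = 0≤inverse (positive-≤ positive-η η≤𝔼w₁)

    error-bound : ∀ {κ′} n → 0# ≤ κ′ → κ′ ≤ fromℕ 16 → κ′ ^ n * (κ ^ k * ν) ≤ fromℕ 16 ^ n * (fromℕ 16 ^ k * ν)
    error-bound n 0≤κ′ κ′≤16 = let (0≤x , x≤y) = ^-mono n 0≤κ′ κ′≤16 ; (0≤z , z≤w) = ^-mono k 0≤κ κ≤16 in
      *-mono-≤ 0≤x (*-nonneg (≤-trans 0≤z z≤w) (proj₁ ν-unit)) x≤y (*-mono-≤ 0≤z (proj₁ ν-unit) z≤w ≤-refl)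

    -- One η for the part of A that w misses, one for the correlation error, one for the point 𝟘.
    a≤ : ∀ {w e} → UnitValued w → a - η ≤ 𝔼 (λ x → f x * w x) → 𝔼 (λ x → χ x * (w x * v (τ x))) ≤ 𝔼 w * 𝔼 v + e → e ≤ η
        → a ≤ 𝔼 w * 𝔼 v + (η + η + η)
    a≤ {w} {e} uw h correlated e≤η =
      a                          ≡⟨ solve 3 (λ a η q → a := a :- η :- q :+ (η :+ q)) refl a η q ⟩≤
      a - η - q + (η + q)        ≤⟨ +-mono-≤ (≤-trans (+-mono-≤ h ≤-refl) (≤-trans (captured uw) correlated)) (+-mono-≤ ≤-refl q≤η) ⟩
      𝔼 w * 𝔼 v + e + (η + η)  ≤⟨ +-mono-≤ (+-mono-≤ ≤-refl e≤η) ≤-refl ⟩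
      𝔼 w * 𝔼 v + η + (η + η)  ≡⟨ solve 2 (λ x η → x :+ η :+ (η :+ η) := x :+ (η :+ η :+ η)) refl (𝔼 w * 𝔼 v) η ⟩≤
      𝔼 w * 𝔼 v + (η + η + η) □

    a≤w₁v : a ≤ 𝔼 w₁ * 𝔼 v + (η + η + η)
    a≤w₁v = a≤ w₁-unit a-η≤𝔼fw₁
      (powers-correlation k l positive-ν ν-unit 11q≤ν⁴ 0≤κ f-unit (complement-unit f-unit) 0≤κ (λ x → f-unit _) (complement-unit v-unit))
      (≤-trans (error-bound l 0≤κ κ≤16) error₁≤η)

    a≤w₂v : a ≤ 𝔼 w₂ * 𝔼 v + (η + η + η)
    a≤w₂v = a≤ w₂-unit a-η≤𝔼fw₂
      (powers-correlation k m positive-ν ν-unit 11q≤ν⁴ 0≤κ f-unit (complement-unit f-unit) 0≤κ₁ (λ x → w₁-unit _) (complement-unit v-unit))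
      (≤-trans (error-bound m 0≤κ₁ κ₁≤16) error₂≤η)

    few : triple w₂ w₁ v + triple w₂ w₁ v ≤ η * η * (η * η)
    few = *-cancelˡ-≤ (positive-suc m) (
      M * (T + T)           ≡⟨ distribˡ M T T ⟩≤
      M * T + M * T         ≤⟨ +-mono-≤ few-triples few-triples ⟩
      fromℕ 2               ≤⟨ 2≤η⁴m ⟩
      η * η * (η * η) * M   ≡⟨ *-comm _ M ⟩≤
      M * (η * η * (η * η)) □)
      where
      M T : Carrier
      M = fromℕ (suc m)
      T = triple w₂ w₁ v

    h : Carrier
    h = η + η + η + η

    h-unit : UnitInterval h
    h-unit = +-nonneg (+-nonneg (+-nonneg 0≤η 0≤η) 0≤η) 0≤η , (
      h             ≡⟨ solve 1 (λ η → η :+ η :+ η :+ η := con (ℤ.+ 4) :* η) refl η ⟩≤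
      fromℕ 4 * η   ≤⟨ 4η≤a ⟩
      a             ≤⟨ proj₂ a-unit ⟩
      1# □)

    -- For x + y ≤ 1 + h - z one has 4(x + y)z ≤ (1 + h)²; this is where 1/8 comes from.
    density-bound : fromℕ 8 * a ≤ 1# + fromℕ 9 * h
    density-bound = cases (few-sums positive-η 0≤η {j} j≤η η≤2j w₂-unit w₁-unit v-unit few (3η≤ w₂-unit a-η≤𝔼fw₂) 3η≤𝔼w₁)
      where
      x y z : Carrier
      x = 𝔼 w₂
      y = 𝔼 w₁
      z = 𝔼 v
      cases : x + y + z ≤ 1# + h ⊎ z ≤ η → fromℕ 8 * a ≤ 1# + fromℕ 9 * h
      cases (inj₁ s≤1+h) =
        fromℕ 8 * a
          ≡⟨ solve 1 (λ a → con (ℤ.+ 8) :* a := con (ℤ.+ 4) :* (a :+ a)) refl a ⟩≤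
        fromℕ 4 * (a + a)
          ≤⟨ *-monoˡ-≤ (fromℕ 4) (fromℕ-nonneg 4) (+-mono-≤ a≤w₂v a≤w₁v) ⟩
        fromℕ 4 * (x * z + (η + η + η) + (y * z + (η + η + η)))
          ≡⟨ solve 4 (λ x y z η → con (ℤ.+ 4) :* (x :* z :+ (η :+ η :+ η) :+ (y :* z :+ (η :+ η :+ η))) := con (ℤ.+ 4) :*
              (z :* (x :+ y)) :+ con (ℤ.+ 6) :* (η :+ η :+ η :+ η)) refl x y z η ⟩≤
        fromℕ 4 * (z * (x + y)) + fromℕ 6 * h
          ≤⟨ +-mono-≤ (*-monoˡ-≤ (fromℕ 4) (fromℕ-nonneg 4) (*-monoˡ-≤ z (proj₁ (𝔼-unit v-unit)) x+y≤c-z)) ≤-refl ⟩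
        fromℕ 4 * (z * (1# + h - z)) + fromℕ 6 * h
          -- With c = 1 + h, 4z(c - z) = c² - (c - 2z)², and c² + 6h = 1 + 8h + h² is at most 1 + 9h
          -- because h ≤ 1.
          ≤⟨ ≤-by ((1# + h - (z + z)) * (1# + h - (z + z)) + h * (1# - h))
              (+-nonneg (square-nonneg _) (*-nonneg (proj₁ h-unit) (proj₁ (unit-1- h-unit))))
               (solve 2 (λ z h → :1 :+ con (ℤ.+ 9) :* h := con (ℤ.+ 4) :* (z :* (:1 :+ h :- z)) :+ con (ℤ.+ 6) :* h
                 :+ ((:1 :+ h :- (z :+ z)) :* (:1 :+ h :- (z :+ z)) :+ h :* (:1 :- h))) refl z h) ⟩
        1# + fromℕ 9 * h □
        where
        x+y≤c-z : x + y ≤ 1# + h - z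
        x+y≤c-z = ∸-cancelʳ-≤ (- z) (subst₂ _≤_ (solve 3 (λ x y z → x :+ y :+ z := x :+ y :- :- z) refl x y z)
            (solve 2 (λ c z → c := c :- z :- :- z) refl (1# + h) z) s≤1+h)
      -- If 𝔼 v ≤ η, then a ≤ 𝔼 w₁ 𝔼 v + 3η is at most 4η = h.
      cases (inj₂ v≤η) =
        fromℕ 8 * a
          ≤⟨ *-monoˡ-≤ (fromℕ 8) (fromℕ-nonneg 8) (≤-trans a≤w₁v (+-mono-≤
              (*-mono-≤ (proj₁ (𝔼-unit w₁-unit)) 0≤η (proj₂ (𝔼-unit w₁-unit)) v≤η) ≤-refl)) ⟩
        fromℕ 8 * (1# * η + (η + η + η))
          ≡⟨ cong (fromℕ 8 *_) (solve 1 (λ η → :1 :* η :+ (η :+ η :+ η) := η :+ η :+ η :+ η) refl η) ⟩≤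
        fromℕ 8 * h
          ≤⟨ ≤-by (1# + h) (+-nonneg 0≤1 (proj₁ h-unit)) (solve 1 (λ h → :1 :+ con (ℤ.+ 9) :* h := con (ℤ.+ 8) :* h :+ (:1 :+ h)) refl h) ⟩
        1# + fromℕ 9 * h □

-- Choice of the parameters

module Asymptotic (K : OrderedField) (archimedean : ∀ x → ∃ λ n → OrderedField._≤_ K x (OrderedFieldProperties.fromℕ K n)) where
  open OrderedField K
  open OrderedFieldProperties K
  open IntegerCoefficients commutativeRing
  open Counting

  1≤^ : ∀ {x} k → 1# ≤ x → 1# ≤ x ^ k
  1≤^ zero    1≤x = ≤-refl
  1≤^ {x} (suc k) 1≤x = subst (_≤ x * x ^ k) (*-identityʳ 1#) (*-mono-≤ 0≤1 (≤-trans 0≤1 (1≤^ k 1≤x)) 1≤x (1≤^ k 1≤x))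

  1≤* : ∀ {x y} → 1# ≤ x → 1# ≤ y → 1# ≤ x * y
  1≤* {x} {y} 1≤x 1≤y = subst (_≤ x * y) (*-identityʳ 1#) (*-mono-≤ 0≤1 (≤-trans 0≤1 1≤y) 1≤x 1≤y)

  fromℕ≤fromℕ-suc : ∀ n → fromℕ n ≤ fromℕ (suc n)
  fromℕ≤fromℕ-suc n = fromℕ-mono (ℕ.n≤1+n n)

  module _ (α : Carrier) (0≤β : 0# ≤ fromℕ 8 * α - 1#) (positive-β : Positive (fromℕ 8 * α - 1#)) where
    β : Carrier
    β = fromℕ 8 * α - 1#

    D : ℕ
    D = proj₁ (archimedean (inverse positive-β))

    opaque
      -- The density bound gives β ≤ 9·4η = 36/E, which fails for E = 37(D + 1) since D ≥ 1/β.
      E : ℕ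
      E = 37 ℕ.* suc D

      E≡37[1+D] : E ≡ 37 ℕ.* suc D
      E≡37[1+D] = refl

      instance
        E≢0 : ℕ.NonZero E
        E≢0 = _

    E′ : Carrier
    E′ = fromℕ E

    1≤E : 1# ≤ E′
    1≤E = fromℕ-mono (ℕ.>-nonZero⁻¹ E)

    positive-E : Positive E′
    positive-E = positive-≤ positive-1 1≤E

    η : Carrier
    η = inverse positive-E

    0≤η : 0# ≤ η
    0≤η = 0≤inverse positive-E

    E*η≡1 : E′ * η ≡ 1#
    E*η≡1 = *-inverse positive-E

    positive-η : Positive η
    positive-η = positive E′ (fromℕ-nonneg E) (trans (*-comm η E′) E*η≡1)

    opaque
      -- Chosen backwards, with η = 1/E: m = 2η⁻⁴ for the triples, then l = 2m/η and k = l/η for the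
      -- losses.
      m l k : ℕ
      m = 2 ℕ.* (E ℕ.* E ℕ.* (E ℕ.* E))
      l = 2 ℕ.* m ℕ.* E
      k = l ℕ.* E

      m≡2E⁴ : m ≡ 2 ℕ.* (E ℕ.* E ℕ.* (E ℕ.* E))
      m≡2E⁴ = refl

      l≡2mE : l ≡ 2 ℕ.* m ℕ.* E
      l≡2mE = refl

      k≡lE : k ≡ l ℕ.* E
      k≡lE = refl

    η*[n*E] : ∀ n → η * fromℕ (n ℕ.* E) ≡ fromℕ n
    η*[n*E] n = trans (cong (η *_) (fromℕ-* n E)) (trans (solve 3 (λ η n E → η :* (n :* E) := n :* (E :* η)) refl η (fromℕ n) E′)
      (trans (cong (fromℕ n *_) E*η≡1) (*-identityʳ _)))

    l≤ηk : fromℕ l ≤ η * fromℕ (suc k)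
    l≤ηk = ≤-trans (≤-reflexive (sym (trans (cong (λ n → η * fromℕ n) k≡lE) (η*[n*E] l)))) (*-monoˡ-≤ η 0≤η (fromℕ≤fromℕ-suc k))

    2m≤ηl : fromℕ 2 * fromℕ m ≤ η * fromℕ (suc l)
    2m≤ηl = ≤-trans (≤-reflexive (trans (sym (fromℕ-* 2 m)) (sym (trans (cong (λ n → η * fromℕ n) l≡2mE) (η*[n*E] (2 ℕ.* m))))))
        (*-monoˡ-≤ η 0≤η (fromℕ≤fromℕ-suc l))

    2≤η⁴m : fromℕ 2 ≤ η * η * (η * η) * fromℕ (suc m)
    2≤η⁴m = ≤-trans (≤-reflexive (sym (trans (cong (η * η * (η * η) *_) m≡)
        (trans (solve 3 (λ η E n → η :* η :* (η :* η) :* (n :* (E :* E :* (E :* E))) := n :*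
            ((E :* η) :* (E :* η) :* ((E :* η) :* (E :* η)))) refl η E′ (fromℕ 2))
        (trans (cong (λ z → fromℕ 2 * (z * z * (z * z))) E*η≡1) (solve 1 (λ n → n :* (:1 :* :1 :* (:1 :* :1)) := n) refl (fromℕ 2)))))))
      (*-monoˡ-≤ (η * η * (η * η)) (square-nonneg (η * η)) (fromℕ≤fromℕ-suc m))
      where
      m≡ : fromℕ m ≡ fromℕ 2 * (E′ * E′ * (E′ * E′))
      m≡ = trans (cong fromℕ m≡2E⁴) (trans (fromℕ-* 2 (E ℕ.* E ℕ.* (E ℕ.* E)))
          (cong (fromℕ 2 *_) (trans (fromℕ-* (E ℕ.* E) (E ℕ.* E)) (cong₂ _*_ (fromℕ-* E E) (fromℕ-* E E)))))

    -- `W₁` and `W₂` bound the factors of the two correlation errors. Both are at least 1, so Y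
    -- exceeds neither fewer than E·W₁ nor fewer than E·W₂, and ν = 1/Y brings both errors below η.
    B W₁ W₂ Y : Carrier
    B  = fromℕ 16
    W₁ = B ^ l * B ^ k
    W₂ = B ^ m * B ^ k
    Y  = E′ * (W₁ * W₂)

    1≤fromℕ-suc : ∀ n → 1# ≤ fromℕ (suc n)
    1≤fromℕ-suc n = fromℕ-mono {1} {suc n} (ℕ.s≤s ℕ.z≤n)

    1≤W₁ : 1# ≤ W₁
    1≤W₁ = 1≤* (1≤^ l (1≤fromℕ-suc 15)) (1≤^ k (1≤fromℕ-suc 15))

    1≤W₂ : 1# ≤ W₂
    1≤W₂ = 1≤* (1≤^ m (1≤fromℕ-suc 15)) (1≤^ k (1≤fromℕ-suc 15))

    1≤Y : 1# ≤ Y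
    1≤Y = 1≤* 1≤E (1≤* 1≤W₁ 1≤W₂)

    positive-Y : Positive Y
    positive-Y = positive-≤ positive-1 1≤Y

    ν : Carrier
    ν = inverse positive-Y

    0≤ν : 0# ≤ ν
    0≤ν = 0≤inverse positive-Y

    positive-ν : Positive ν
    positive-ν = positive Y (≤-trans 0≤1 1≤Y) (trans (*-comm ν Y) (*-inverse positive-Y))

    ν-unit : UnitInterval ν
    ν-unit = 0≤ν , subst₂ _≤_ (*-identityˡ ν) (*-inverse positive-Y) (*-mono-≤ 0≤1 0≤ν 1≤Y ≤-refl)

    error-bound : ∀ x y w → 1# ≤ w → 0# ≤ x * y → E′ * (x * y * w) ≡ Y → x * (y * ν) ≤ η
    error-bound x y w 1≤w 0≤xy e =
      x * (y * ν)                 ≡⟨ trans (solve 3 (λ x y ν → x :* (y :* ν) := :1 :* (x :* y :* ν)) refl x y ν)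
          (cong (_* (x * y * ν)) (sym E*η≡1)) ⟩≤
      E′ * η * (x * y * ν)        ≡⟨ solve 5 (λ E η x y ν → E :* η :* (x :* y :* ν) := E :* η :* (x :* y :* ν) :* :1) refl E′ η x y ν ⟩≤
      E′ * η * (x * y * ν) * 1#   ≤⟨ *-monoˡ-≤ (E′ * η * (x * y * ν)) (*-nonneg (*-nonneg (fromℕ-nonneg E) 0≤η) (*-nonneg 0≤xy 0≤ν)) 1≤w ⟩
      E′ * η * (x * y * ν) * w    ≡⟨ trans (solve 6 (λ E η x y ν w
          → E :* η :* (x :* y :* ν) :* w := η :* (E :* (x :* y :* w) :* ν)) refl E′ η x y ν w)
                                      (trans (cong (λ z → η * (z * ν)) e) (trans (cong (η *_) (*-inverse positive-Y)) (*-identityʳ η))) ⟩≤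
      η □

    error₁≤η : B ^ l * (B ^ k * ν) ≤ η
    error₁≤η = error-bound (B ^ l) (B ^ k) W₂ 1≤W₂ (≤-trans 0≤1 1≤W₁) refl

    error₂≤η : B ^ m * (B ^ k * ν) ≤ η
    error₂≤η = error-bound (B ^ m) (B ^ k) W₁ 1≤W₁ (≤-trans 0≤1 1≤W₂) (cong (E′ *_) (*-comm W₂ W₁))

    32η≤1 : fromℕ 32 * η ≤ 1#
    32η≤1 = ≤-trans (*-mono-≤ (fromℕ-nonneg 32) 0≤η (fromℕ-mono 32≤E) ≤-refl) (≤-reflexive E*η≡1)
      where
      32≤E : 32 ℕ.≤ E
      32≤E = ℕ.≤-trans (ℕ.m≤m+n 32 5) (ℕ.≤-trans (ℕ.m≤m*n 37 (suc D)) (ℕ.≤-reflexive (sym E≡37[1+D])))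

    -- p ≥ N₁ ≥ 11Y⁴ gives 11/p ≤ ν⁴; p ≥ 2E gives 2/p ≤ η, which allows rounding ηp to an integer.
    N₁ N : ℕ
    N₁ = proj₁ (archimedean (fromℕ 11 * (Y * Y * (Y * Y))))
    N  = N₁ ℕ.+ 2 ℕ.* E

    module _ {p : ℕ} (N≤p : N ℕ.≤ p) (F : FiniteField p) (A : Fin p → Bool) (dense : α * fromℕ p ≤ fromℕ (count A))
             (t : Fin p) (t≢𝟘 : t ≢ FiniteField.𝟘 F)
             (avoids : ∀ x y z → A x ≡ true → A y ≡ true → A z ≡ true → FiniteField._⊗_ F x (FiniteField._⊕_ F y z) ≢ t) where
      2E≤p : 2 ℕ.* E ℕ.≤ p
      2E≤p = ℕ.≤-trans (ℕ.m≤n+m (2 ℕ.* E) N₁) N≤p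

      positive-p : Positive (fromℕ p)
      positive-p = positive-≤ (positive-* (positive-suc 1) positive-E) (≤-trans (≤-reflexive (sym (fromℕ-* 2 E))) (fromℕ-mono 2E≤p))

      open Averages K p positive-p
      open Pollard K positive-p F using (density; 𝔼-ind; ind)
      open DensityBound K positive-p F t t≢𝟘 A avoids using (density-bound)

      q*-mono : ∀ {x} c → 0# ≤ c → x ≤ P → x * (q * c) ≤ c
      q*-mono {x} c 0≤c x≤P = ≤-trans (*-mono-≤′ x≤P) (≤-reflexive
          (trans (sym (*-assoc P q c)) (trans (cong (_* c) P*q≡1) (*-identityˡ c))))
        where
        *-mono-≤′ : x ≤ P → x * (q * c) ≤ P * (q * c)
        *-mono-≤′ x≤P = subst₂ _≤_ (*-comm _ x) (*-comm _ P) (*-monoˡ-≤ (q * c) (*-nonneg 0≤q 0≤c) x≤P)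

      2q≤η : q + q ≤ η
      2q≤η = subst (_≤ η)
        (trans (solve 4 (λ n E q η → n :* E :* (q :* η) := n :* q :* (E :* η)) refl (fromℕ 2) E′ q η)
          (trans (cong (fromℕ 2 * q *_) E*η≡1) (solve 1 (λ q → (:1 :+ :1) :* q :* :1 := q :+ q) refl q)))
        (q*-mono η 0≤η (≤-trans (≤-reflexive (sym (fromℕ-* 2 E))) (fromℕ-mono 2E≤p)))

      q≤η : q ≤ η
      q≤η = ≤-trans (≤-by q 0≤q refl) 2q≤η

      11q≤ν⁴ : fromℕ 11 * q ≤ (ν * ν) * (ν * ν)
      11q≤ν⁴ = subst (_≤ (ν * ν) * (ν * ν))
        (trans (solve 4 (λ n Y q ν → n :* (Y :* Y :* (Y :* Y)) :* (q :* (ν :* ν :* (ν :* ν))) := n :* q :*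
            ((Y :* ν) :* (Y :* ν) :* ((Y :* ν) :* (Y :* ν)))) refl (fromℕ 11) Y q ν)
          (trans (cong (λ z → fromℕ 11 * q * (z * z * (z * z))) (*-inverse positive-Y))
              (solve 1 (λ q → q :* (:1 :* :1 :* (:1 :* :1)) := q) refl (fromℕ 11 * q))))
        (q*-mono ((ν * ν) * (ν * ν)) (square-nonneg (ν * ν)) (≤-trans (proj₂ (archimedean (fromℕ 11 * (Y * Y * (Y * Y)))))
            (fromℕ-mono (ℕ.≤-trans (ℕ.m≤m+n N₁ (2 ℕ.* E)) N≤p))))

      -- The integer part of ηp. Rounding loses at most 1/p ≤ η/2, so its density lies between η/2
      -- and η.
      j : ℕ
      j = p ℕ./ E

      j≤η : density j ≤ η
      j≤η = subst (_≤ η)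
        (trans (solve 4 (λ j E q η → j :* E :* (q :* η) := q :* j :* (E :* η)) refl (fromℕ j) E′ q η)
            (trans (cong (q * fromℕ j *_) E*η≡1) (*-identityʳ _)))
        (q*-mono η 0≤η (≤-trans (≤-reflexive (sym (fromℕ-* j E))) (fromℕ-mono (ℕ.m/n*n≤m p E))))

      p≤[1+j]E : P ≤ (1# + fromℕ j) * E′
      p≤[1+j]E = ≤-trans (fromℕ-mono (ℕ.≤-trans (ℕ.≤-reflexive (ℕ.m≡m%n+[m/n]*n p E)) (ℕ.+-monoˡ-≤ (j ℕ.* E) (ℕ.<⇒≤ (ℕ.m%n<n p E)))))
        (≤-reflexive (trans (fromℕ-* (suc j) E) (cong (_* E′) (fromℕ-suc j))))

      η≤j+q : η ≤ density j + q
      η≤j+q =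
        η                                ≡⟨ trans (sym (*-identityˡ η)) (trans (cong (_* η) (sym P*q≡1)) (*-assoc P q η)) ⟩≤
        P * (q * η)                      ≤⟨ subst₂ _≤_ (*-comm _ P) (*-comm _ ((1# + fromℕ j) * E′))
            (*-monoˡ-≤ (q * η) (*-nonneg 0≤q 0≤η) p≤[1+j]E) ⟩
        (1# + fromℕ j) * E′ * (q * η)    ≡⟨ trans (solve 4 (λ j E q η → (:1 :+ j) :* E :* (q :* η) := (q :* j :+ q) :* (E :* η)) refl
            (fromℕ j) E′ q η) (trans (cong ((density j + q) *_) E*η≡1) (*-identityʳ _)) ⟩≤
        density j + q □

      η≤2j : η ≤ density j + density j
      η≤2j = ≤-by ((d + q - η) + (d + q - η) + (η - (q + q))) (+-nonneg (+-nonneg h h) (x≤y⇒0≤y-x 2q≤η))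
        (solve 3 (λ d q η → d :+ d := η :+ ((d :+ q :- η) :+ (d :+ q :- η) :+ (η :- (q :+ q)))) refl d q η)
        where
        d : Carrier
        d = density j
        h : 0# ≤ d + q - η
        h = x≤y⇒0≤y-x η≤j+q

      α≤a : α ≤ 𝔼 (ind A)
      α≤a =
        α                       ≡⟨ trans (sym (*-identityʳ α)) (trans (cong (α *_) (sym P*q≡1))
            (solve 3 (λ α P q → α :* (P :* q) := q :* (α :* P)) refl α P q)) ⟩≤
        q * (α * P)             ≤⟨ *-monoˡ-≤ q 0≤q dense ⟩
        q * fromℕ (count A)     ≡⟨ sym (𝔼-ind A) ⟩≤
        𝔼 (ind A) □

      8α≤8a : fromℕ 8 * α ≤ fromℕ 8 * 𝔼 (ind A)
      8α≤8a = *-monoˡ-≤ (fromℕ 8) (fromℕ-nonneg 8) α≤a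

      β≤9h : β ≤ fromℕ 9 * (η + η + η + η)
      β≤9h = ∸-cancelʳ-≤ (- 1#) (subst₂ _≤_ (solve 1 (λ x → x := x :- :1 :- :- :1) refl (fromℕ 8 * α))
          (solve 1 (λ x → :1 :+ x := x :- :- :1) refl (fromℕ 9 * (η + η + η + η)))
        (≤-trans 8α≤8a (density-bound k l m j positive-η 0≤η 32η≤1 positive-ν ν-unit 11q≤ν⁴ q≤η j≤η η≤2j l≤ηk 2m≤ηl 2≤η⁴m error₁≤η error₂≤η
          (≤-trans (0≤y-x⇒x≤y 0≤β) 8α≤8a))))

      impossible : ⊥
      impossible = 1≰0 (∸-cancelʳ-≤ (- fromℕ 36) (subst₂ _≤_ (fromℕ-suc-36) (solve 1 (λ x → x := :0 :- :- x) refl (fromℕ 36))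
          (≤-trans 37≤Eβ Eβ≤36)))
        where
        fromℕ-suc-36 : fromℕ 37 ≡ 1# - - fromℕ 36
        fromℕ-suc-36 = trans (fromℕ-suc 36) (solve 1 (λ x → :1 :+ x := :1 :- :- x) refl (fromℕ 36))
        1≤Dβ : 1# ≤ fromℕ (suc D) * β
        1≤Dβ = ≤-trans (≤-reflexive (trans (sym (*-inverse positive-β)) (*-comm β _)))
          (*-mono-≤ (0≤inverse positive-β) 0≤β (≤-trans (proj₂ (archimedean (inverse positive-β))) (fromℕ≤fromℕ-suc D)) ≤-refl)
        37≤Eβ : fromℕ 37 ≤ E′ * β
        37≤Eβ = ≤-trans (≤-reflexive (sym (*-identityʳ (fromℕ 37)))) (≤-trans (*-monoˡ-≤ (fromℕ 37) (fromℕ-nonneg 37) 1≤Dβ)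
          (≤-reflexive (trans (sym (*-assoc (fromℕ 37) (fromℕ (suc D)) β))
              (cong (_* β) (trans (sym (fromℕ-* 37 (suc D))) (cong fromℕ (sym E≡37[1+D])))))))
        Eβ≤36 : E′ * β ≤ fromℕ 36
        Eβ≤36 = ≤-trans (*-monoˡ-≤ E′ (fromℕ-nonneg E) β≤9h) (≤-reflexive
            (trans (solve 3 (λ E n η → E :* (n :* (η :+ η :+ η :+ η)) := n :* (E :* η :+ E :* η :+ E :* η :+ E :* η)) refl E′ (fromℕ 9) η)
          (trans (cong (λ z → fromℕ 9 * (z + z + z + z)) E*η≡1) (sym (fromℕ-* 9 4)))))

open import Defs
open import Algebra.Consequences.Propositional using (comm∧idˡ⇒id; comm∧invˡ⇒inv; comm∧distrˡ⇒distrʳ)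
open import Data.Fin using (toℕ)
open import Data.Fin.Properties using (any?; toℕ-injective; toℕ-fromℕ<; toℕ<n; toℕ≤n)
open import Data.Nat using (NonZero) renaming (_≤_ to _≤ℕ_)
open import Data.Nat.Coprimality as Coprimality using (prime⇒coprime; coprime-Bézout)
open import Data.Nat.DivMod using (_mod_; _%_)
open import Data.Nat.GCD using (module Bézout)
open import Data.Nat.Primality using (Prime)

-- The integers modulo a prime

module PrimeField (p : ℕ) .{{_ : NonZero p}} (prime : Prime p) where
  toℕ-mod : ∀ n → toℕ (n mod p) ≡ n % p
  toℕ-mod n = toℕ-fromℕ< (ℕ.m%n<n n p)

  mod-cong : ∀ {m n} → m % p ≡ n % p → m mod p ≡ n mod p
  mod-cong {m} {n} e = toℕ-injective (trans (toℕ-mod m) (trans e (sym (toℕ-mod n))))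

  mod-toℕ : ∀ x → toℕ x mod p ≡ x
  mod-toℕ x = toℕ-injective (trans (toℕ-mod (toℕ x)) (ℕ.m<n⇒m%n≡m (toℕ<n x)))

  mod-+ : ∀ m n → (m mod p) +ₚ (n mod p) ≡ (m ℕ.+ n) mod p
  mod-+ m n = mod-cong (trans (cong₂ (λ a b → (a ℕ.+ b) % p) (toℕ-mod m) (toℕ-mod n)) (sym (ℕ.%-distribˡ-+ m n p)))

  mod-* : ∀ m n → (m mod p) *ₚ (n mod p) ≡ (m ℕ.* n) mod p
  mod-* m n = mod-cong (trans (cong₂ (λ a b → (a ℕ.* b) % p) (toℕ-mod m) (toℕ-mod n)) (sym (ℕ.%-distribˡ-* m n p)))

  𝟘 𝟙 : Fin p
  𝟘 = 0 mod p
  𝟙 = 1 mod p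

  -ₚ_ : Fin p → Fin p
  -ₚ x = (p ℕ.∸ toℕ x) mod p

  mod-∣ : ∀ k → (k ℕ.* p) mod p ≡ 𝟘
  mod-∣ k = mod-cong (ℕ.[m+kn]%n≡m%n 0 k p)

  +ₚ-mod : ∀ x n → x +ₚ (n mod p) ≡ (toℕ x ℕ.+ n) mod p
  +ₚ-mod x n = trans (cong (_+ₚ (n mod p)) (sym (mod-toℕ x))) (mod-+ (toℕ x) n)

  mod-+ₚ : ∀ n x → (n mod p) +ₚ x ≡ (n ℕ.+ toℕ x) mod p
  mod-+ₚ n x = trans (cong ((n mod p) +ₚ_) (sym (mod-toℕ x))) (mod-+ n (toℕ x))

  *ₚ-mod : ∀ x n → x *ₚ (n mod p) ≡ (toℕ x ℕ.* n) mod p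
  *ₚ-mod x n = trans (cong (_*ₚ (n mod p)) (sym (mod-toℕ x))) (mod-* (toℕ x) n)

  mod-*ₚ : ∀ n x → (n mod p) *ₚ x ≡ (n ℕ.* toℕ x) mod p
  mod-*ₚ n x = trans (cong ((n mod p) *ₚ_) (sym (mod-toℕ x))) (mod-* n (toℕ x))

  +ₚ-comm : ∀ x y → x +ₚ y ≡ y +ₚ x
  +ₚ-comm x y = cong (_mod p) (ℕ.+-comm (toℕ x) (toℕ y))

  *ₚ-comm : ∀ x y → x *ₚ y ≡ y *ₚ x
  *ₚ-comm x y = cong (_mod p) (ℕ.*-comm (toℕ x) (toℕ y))

  +ₚ-assoc : ∀ x y z → (x +ₚ y) +ₚ z ≡ x +ₚ (y +ₚ z)
  +ₚ-assoc x y z = trans (mod-+ₚ (toℕ x ℕ.+ toℕ y) z) (trans (cong (_mod p) (ℕ.+-assoc (toℕ x) (toℕ y) (toℕ z)))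
      (sym (+ₚ-mod x (toℕ y ℕ.+ toℕ z))))

  *ₚ-assoc : ∀ x y z → (x *ₚ y) *ₚ z ≡ x *ₚ (y *ₚ z)
  *ₚ-assoc x y z = trans (mod-*ₚ (toℕ x ℕ.* toℕ y) z) (trans (cong (_mod p) (ℕ.*-assoc (toℕ x) (toℕ y) (toℕ z)))
      (sym (*ₚ-mod x (toℕ y ℕ.* toℕ z))))

  *ₚ-distribˡ-+ₚ : ∀ x y z → x *ₚ (y +ₚ z) ≡ (x *ₚ y) +ₚ (x *ₚ z)
  *ₚ-distribˡ-+ₚ x y z = trans (*ₚ-mod x (toℕ y ℕ.+ toℕ z)) (trans (cong (_mod p) (ℕ.*-distribˡ-+ (toℕ x) (toℕ y) (toℕ z)))
      (sym (mod-+ (toℕ x ℕ.* toℕ y) (toℕ x ℕ.* toℕ z))))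

  +ₚ-identityˡ : ∀ x → 𝟘 +ₚ x ≡ x
  +ₚ-identityˡ x = trans (mod-+ₚ 0 x) (mod-toℕ x)

  *ₚ-identityˡ : ∀ x → 𝟙 *ₚ x ≡ x
  *ₚ-identityˡ x = trans (mod-*ₚ 1 x) (trans (cong (_mod p) (ℕ.*-identityˡ (toℕ x))) (mod-toℕ x))

  -ₚ-inverseˡ : ∀ x → (-ₚ x) +ₚ x ≡ 𝟘
  -ₚ-inverseˡ x = trans (mod-+ₚ (p ℕ.∸ toℕ x) x) (trans (cong (_mod p) (trans (ℕ.m∸n+n≡m (toℕ≤n x)) (sym (ℕ.*-identityˡ p)))) (mod-∣ 1))

  isCommutativeRing : IsCommutativeRing _≡_ _+ₚ_ _*ₚ_ -ₚ_ 𝟘 𝟙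
  isCommutativeRing = record
    { isRing = record
      { +-isAbelianGroup = record
        { isGroup = record
          { isMonoid = record
            { isSemigroup = record
              { isMagma = record { isEquivalence = isEquivalence ; ∙-cong = cong₂ _+ₚ_ }
              ; assoc = +ₚ-assoc
              }
            ; identity = comm∧idˡ⇒id +ₚ-comm +ₚ-identityˡ
            }
          ; inverse = comm∧invˡ⇒inv +ₚ-comm -ₚ-inverseˡ
          ; ⁻¹-cong = cong -ₚ_
          }
        ; comm = +ₚ-comm
        }
      ; *-cong = cong₂ _*ₚ_
      ; *-assoc = *ₚ-assoc
      ; *-identity = comm∧idˡ⇒id *ₚ-comm *ₚ-identityˡ
      ; distrib = *ₚ-distribˡ-+ₚ , comm∧distrˡ⇒distrʳ *ₚ-comm *ₚ-distribˡ-+ₚ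
      }
    ; *-comm = *ₚ-comm
    }

  ring : CommutativeRing _ _
  ring = record { isCommutativeRing = isCommutativeRing }

  open Algebra.Properties.Ring (CommutativeRing.ring ring) using (-‿distribʳ-*)
  open Algebra.Properties.Group (CommutativeRing.+-group ring) using (inverseˡ-unique)

  inverse-exists : ∀ x → x ≢ 𝟘 → ∃ λ y → x *ₚ y ≡ 𝟙
  inverse-exists x x≢𝟘 = bézout (coprime-Bézout (Coprimality.sym (prime⇒coprime prime (toℕ<n x))))
    where
    instance
      toℕx≢0 : NonZero (toℕ x)
      toℕx≢0 = ℕ.≢-nonZero (λ e → x≢𝟘 (trans (sym (mod-toℕ x)) (cong (_mod p) e)))
    bézout : Bézout.Identity 1 (toℕ x) p → ∃ λ y → x *ₚ y ≡ 𝟙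
    bézout (Bézout.+- i k 1+kp≡ix) = i mod p ,
      trans (*ₚ-mod x i) (trans (cong (_mod p) (trans (ℕ.*-comm (toℕ x) i) (sym 1+kp≡ix))) (mod-cong (ℕ.[m+kn]%n≡m%n 1 k p)))
    -- Here 1 + ix = kp, so the inverse of x is -i.
    bézout (Bézout.-+ i k 1+ix≡kp) = -ₚ (i mod p) , sym (trans 𝟙≡ (-‿distribʳ-* x (i mod p)))
      where
      𝟙≡ : 𝟙 ≡ -ₚ (x *ₚ (i mod p))
      𝟙≡ = inverseˡ-unique 𝟙 (x *ₚ (i mod p)) (trans (cong (𝟙 +ₚ_) (*ₚ-mod x i)) (trans (mod-+ 1 (toℕ x ℕ.* i))
        (trans (cong (_mod p) (trans (cong suc (ℕ.*-comm (toℕ x) i)) 1+ix≡kp)) (mod-∣ k))))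

  inv : Fin p → Fin p
  inv x with x ≟ 𝟘
  ... | yes _    = 𝟘
  ... | no  x≢𝟘 = proj₁ (inverse-exists x x≢𝟘)

  inv-𝟘 : inv 𝟘 ≡ 𝟘
  inv-𝟘 with 𝟘 ≟ 𝟘
  ... | yes _    = refl
  ... | no  𝟘≢𝟘 = contradiction refl 𝟘≢𝟘

  *ₚ-inv : ∀ {x} → x ≢ 𝟘 → x *ₚ inv x ≡ 𝟙
  *ₚ-inv {x} x≢𝟘 with x ≟ 𝟘
  ... | yes x≡𝟘 = contradiction x≡𝟘 x≢𝟘
  ... | no  x≢𝟘 = proj₂ (inverse-exists x x≢𝟘)

  open Algebra.Properties.Semiring.Mult (CommutativeRing.semiring ring) using () renaming (_×_ to _·_)

  ·𝟙 : ∀ k → k · 𝟙 ≡ k mod p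
  ·𝟙 zero    = refl
  ·𝟙 (suc k) = trans (cong (𝟙 +ₚ_) (·𝟙 k)) (mod-+ 1 k)

  primeField : FiniteField p
  primeField = record
    { isCommutativeRing = isCommutativeRing
    ; inv               = inv
    ; inv-𝟘             = inv-𝟘
    ; ⊗-inv             = *ₚ-inv
    ; cyclic            = λ x → toℕ x , sym (trans (·𝟙 (toℕ x)) (mod-toℕ x))
    }

open import Data.Fin.Subset using (Subset; ∣_∣)
open import Data.Fin.Subset.Properties using (_∈?_)
open import Data.Integer using (+_)
open import Data.Rational using (ℚ; _/_; _<_; _≤_; _*_)
import Data.Rational as ℚ
import Data.Rational.Properties as ℚ
open import Data.Vec using (lookup; _∷_; [])
open import Data.Vec.Properties using (lookup⇒[]=)

-- The rational numbers and the conclusion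

rationals : OrderedField
rationals = record
  { isCommutativeRing = ℚ.+-*-isCommutativeRing
  ; _≤_               = _≤_
  ; ≤-refl            = ℚ.≤-refl
  ; ≤-trans           = ℚ.≤-trans
  ; ≤-total           = ℚ.≤-total
  ; +-mono-≤          = ℚ.+-mono-≤
  ; *-nonneg          = λ {x} {y} 0≤x 0≤y → subst (_≤ x * y) (ℚ.*-zeroʳ x) (ℚ.*-monoˡ-≤-nonNeg x {{ℚ.nonNegative 0≤x}} 0≤y)
  ; 1≰0               = λ { (ℚ.*≤* (ℤ.+≤+ ())) }
  ; recip             = recip
  }
  where
  recip : ∀ x → ¬ x ≤ ℚ.0ℚ → ∃ λ y → ℚ.0ℚ ≤ y × x * y ≡ ℚ.1ℚ
  recip x x≰0 = ℚ.1/ x , ℚ.nonNegative⁻¹ (ℚ.1/ x) {{ℚ.pos⇒nonNeg (ℚ.1/ x) {{ℚ.1/pos⇒pos x}}}} , ℚ.*-inverseʳ x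
    where
    instance
      pos : ℚ.Positive x
      pos = ℚ.positive (ℚ.≰⇒> x≰0)
      nonZero : ℚ.NonZero x
      nonZero = ℚ.pos⇒nonZero x

private module ℚ-Field = OrderedFieldProperties rationals

-- The fraction in lowest terms, on which addition computes; `+ n / 1` is defined through a greatest
-- common divisor and stays blocked for a variable n.
natural : ℕ → ℚ
natural n = ℚ.mkℚ (+ n) 0 (Coprimality.sym (Coprimality.1-coprimeTo n))

/1≡natural : ∀ n → + n / 1 ≡ natural n
/1≡natural n = ℚ.normalize-coprime (Coprimality.sym (Coprimality.1-coprimeTo n))

fromℕ≡/1 : ∀ n → ℚ-Field.fromℕ n ≡ + n / 1
fromℕ≡/1 ℕ.zero    = refl
fromℕ≡/1 (ℕ.suc n) = trans (ℚ-Field.fromℕ-suc n)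
  (trans (cong (ℚ.1ℚ ℚ.+_) (trans (fromℕ≡/1 n) (/1≡natural n))) (cong (λ i → (+ 1 ℤ.+ i) / 1) (ℤ.*-identityʳ (+ n))))

fromℕ≡natural : ∀ n → ℚ-Field.fromℕ n ≡ natural n
fromℕ≡natural n = trans (fromℕ≡/1 n) (/1≡natural n)

-- The denominator is at least 1, so the absolute value of the numerator is a bound.
archimedean : ∀ x → ∃ λ n → x ≤ ℚ-Field.fromℕ n
archimedean x@(ℚ.mkℚ i d _) = ℤ.∣ i ∣ , subst (x ≤_) (sym (fromℕ≡natural ℤ.∣ i ∣)) (ℚ.*≤* (numerators i))
  where
  numerators : ∀ i → i ℤ.* + 1 ℤ.≤ + ℤ.∣ i ∣ ℤ.* + ℕ.suc d
  numerators (+ n)       = ℤ.*-monoˡ-≤-nonNeg (+ n) (ℤ.+≤+ (ℕ.s≤s ℕ.z≤n))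
  numerators ℤ.-[1+ n ] = ℤ.≤-trans ℤ.-≤+ (ℤ.≤-reflexive (ℤ.pos-* (ℕ.suc n) (ℕ.suc d)))

open Counting using (count)

∣∣≡count : ∀ {n} (A : Subset n) → ∣ A ∣ ≡ count (lookup A)
∣∣≡count []          = refl
∣∣≡count (true  ∷ A) = cong ℕ.suc (∣∣≡count A)
∣∣≡count (false ∷ A) = ∣∣≡count A

theorem1 : (α : ℚ) → (+ 1 / 8) < α →
    ∃ λ (N : ℕ) → (p : ℕ) .{{_ : NonZero p}} → Prime p → N ≤ℕ p →
    (A : Subset p) → α * (+ p / 1) ≤ (+ ∣ A ∣ / 1) →
    (t : Fin p) → toℕ t ≢ 0 → t ∈A[A+A] A
theorem1 α 1/8<α = N , λ p prime N≤p A dense t t≢0 → decidable-stable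
    -- Membership in A(A+A) is decided by a finite search, which permits the proof by contradiction.
    (any? (λ x → any? (λ y → any? (λ z → (x ∈? A) ×-dec ((y ∈? A) ×-dec ((z ∈? A) ×-dec (x *ₚ (y +ₚ z) ≟ t)))))))
    (λ none → Asymptotic.impossible rationals archimedean α 0≤β positive-β N≤p (PrimeField.primeField p prime) (lookup A)
      (subst₂ (λ u v → α * u ≤ v) (sym (fromℕ≡/1 p)) (trans (sym (fromℕ≡/1 ∣ A ∣)) (cong ℚ-Field.fromℕ (∣∣≡count A))) dense)
      t (λ t≡𝟘 → t≢0 (trans (cong toℕ t≡𝟘) (trans (toℕ-fromℕ< _) (ℕ.m<n⇒m%n≡m (ℕ.>-nonZero⁻¹ p)))))
      (λ x y z Ax Ay Az e → none (x , y , z , lookup⇒[]= x A Ax , lookup⇒[]= y A Ay , lookup⇒[]= z A Az , e)))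
  where
  open OrderedField rationals using (_-_)
  β : ℚ
  β = ℚ-Field.fromℕ 8 * α - ℚ.1ℚ
  β≰0 : ¬ β ≤ ℚ.0ℚ
  β≰0 β≤0 = ℚ.<-irrefl refl (ℚ.<-≤-trans 1/8<α (ℚ-Field.*-cancelˡ-≤ (ℚ-Field.positive-suc 7) (ℚ-Field.∸-cancelʳ-≤ ℚ.1ℚ β≤0)))
  0≤β : ℚ.0ℚ ≤ β
  0≤β with ℚ.≤-total ℚ.0ℚ β
  ... | inj₁ 0≤β = 0≤β
  ... | inj₂ β≤0 = contradiction β≤0 β≰0
  positive-β : ℚ-Field.Positive β
  positive-β = let (i , 0≤i , βi≡1) = OrderedField.recip rationals β β≰0 in ℚ-Field.positive i 0≤i βi≡1
  N : ℕ
  N = Asymptotic.N rationals archimedean α 0≤β positive-β
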